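{- Let $k$ and $p$ be positive integers with $k\ge 2p+1$, and write $k=s(p+1)+r$ with integers $s\ge 1$ and $0\le r<p+1$. Suppose $r\neq 0$, and let $m\ge 0$ and $1\le t\le s$ be the unique integers satisfying $r=ms+t$. Then for all sufficiently large $n$, $$\mathrm{EX}(n,C_k^p)=\{K_{t-1}\vee T_{n-t+1,\,p+m+1}\}$$ (up to isomorphism).
   Context: All graphs are finite, simple and undirected. $C_k$ is the cycle on $k$ vertices, and $C_k^p$ (its $p$-th power) is the graph on the same vertices in which two distinct vertices are adjacent iff their distance in $C_k$ is at most $p$. A graph is $F$-free if it contains no subgraph (not necessarily induced) isomorphic to $F$. $\mathrm{ex}(n,F)$ is the maximum number of edges $e(G)$ of an $n$-vertex $F$-free graph $G$, and $\mathrm{EX}(n,F)$ is the set of $n$-vertex $F$-free graphs $G$ with $e(G)=\mathrm{ex}(n,F)$. $K_a$ is the complete graph on $a$ vertices ($K_0$ is the empty graph). $T_{n,q}$ is the $q$-partite Turán graph: the complete $q$-partite graph on $n$ vertices with part sizes pairwise differing by at most $1$. $G\vee H$ (join) is obtained from the disjoint union of $G$ and $H$ by adding all edges between $V(G)$ and $V(H)$. -}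

module Defs where

open import Level using (0ℓ)
open import Data.Empty using (⊥-elim)
open import Data.Unit using (⊤; tt)
open import Data.Nat using (ℕ; zero; suc; NonZero; _+_; _*_; _∸_; _≤_; _<_; s≤s; s≤s⁻¹; _/_; _%_)
import Data.Nat as ℕ
import Data.Nat.Properties as ℕₚ
open import Data.Nat.DivMod
  using (_mod_; m≡m%n+[m/n]*n; m%n<n; +-distrib-/-∣ʳ; m*n/n≡m; m<n⇒m/n≡0; m≥n⇒m/n>0; m<n*o⇒m/o<n; /-monoˡ-≤; n/n≡1)
open import Data.Nat.Divisibility using (divides-refl; ∣-refl)
open import Data.Fin using (Fin; zero; suc; toℕ; splitAt)
import Data.Fin as Fin
import Data.Fin.Properties as Finₚ
open import Data.List using (length; filter; allFin; cartesianProduct; tabulate)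
open import Data.Product using (Σ-syntax; ∃-syntax; _×_; _,_)
open import Data.Sum using (_⊎_; inj₁; inj₂)
import Data.Sum as Sum
open import Function.Base using (_∘_)
open import Function.Bundles using (_↔_; _⇔_; Inverse)
open import Function.Definitions using (Injective)
open import Relation.Binary.Core using (Rel)
open import Relation.Binary.Definitions using (Decidable; Symmetric; Irreflexive; tri<; tri≈; tri>)
open import Relation.Binary.PropositionalEquality
open import Relation.Nullary using (¬_; yes; no)
open import Relation.Nullary.Decidable using (map′; _×-dec_; _⊎-dec_; ¬?)

-- Decidability of adjacency makes the number of edges computable.
record Graph (n : ℕ) : Set₁ where
  infix 4 _∼_ _∼?_
  field
    _∼_    : Rel (Fin n) 0ℓ
    _∼?_   : Decidable _∼_
    sym-∼  : Symmetric _∼_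
    irrefl : Irreflexive _≡_ _∼_

open Graph using () renaming (_∼_ to Adj; _∼?_ to adj?)

-- Each edge {i , j} is counted once, as the pair with i < j.
e : ∀ {n} → Graph n → ℕ
e {n} G = length (filter (λ (i , j) → (i Finₚ.<? j) ×-dec adj? G i j)
                         (cartesianProduct (allFin n) (allFin n)))

infix 4 _≅_

_≅_ : ∀ {m n} → Graph m → Graph n → Set
_≅_ {m} {n} G H =
  Σ[ f ∈ Fin m ↔ Fin n ] (∀ i j → Adj G i j ⇔ Adj H (Inverse.to f i) (Inverse.to f j))

-- A subgraph of G isomorphic to F is the image of F under an injective
-- edge-preserving (not necessarily edge-reflecting) map.
Contains : ∀ {m n} → Graph n → Graph m → Set
Contains {m} {n} G F =
  Σ[ f ∈ (Fin m → Fin n) ] Injective _≡_ _≡_ f × (∀ i j → Adj F i j → Adj G (f i) (f j))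

Free : ∀ {m n} → Graph m → Graph n → Set
Free F G = ¬ Contains G F

-- ex(n, F) = x.  A relation because ex(n, F) need not exist: there may be no
-- F-free graph at all (when F has no edges).
IsEx : ∀ {m} → ℕ → Graph m → ℕ → Set₁
IsEx n F x = (Σ[ G ∈ Graph n ] Free F G × e G ≡ x)
           × ((G : Graph n) → Free F G → e G ≤ x)

-- G ∈ EX(n, F)
EX : ∀ {m} (n : ℕ) → Graph m → Graph n → Set₁
EX n F G = Free F G × IsEx n F (e G)

K : (a : ℕ) → Graph a
K a = record
  { _∼_    = _≢_
  ; _∼?_   = λ i j → ¬? (i Fin.≟ j)
  ; sym-∼  = ≢-sym
  ; irrefl = λ i≡j i≢j → i≢j i≡j
  }

-- The vertices of G ∨ H are those of G followed by those of H.
module _ {a b : ℕ} (G : Graph a) (H : Graph b) where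

  JoinAdj : Rel (Fin a ⊎ Fin b) 0ℓ
  JoinAdj (inj₁ x) (inj₁ y) = Adj G x y
  JoinAdj (inj₁ _) (inj₂ _) = ⊤
  JoinAdj (inj₂ _) (inj₁ _) = ⊤
  JoinAdj (inj₂ x) (inj₂ y) = Adj H x y

  joinAdj? : Decidable JoinAdj
  joinAdj? (inj₁ x) (inj₁ y) = adj? G x y
  joinAdj? (inj₁ _) (inj₂ _) = yes tt
  joinAdj? (inj₂ _) (inj₁ _) = yes tt
  joinAdj? (inj₂ x) (inj₂ y) = adj? H x y

  joinAdj-sym : Symmetric JoinAdj
  joinAdj-sym {inj₁ _} {inj₁ _} = Graph.sym-∼ G
  joinAdj-sym {inj₁ _} {inj₂ _} _ = tt
  joinAdj-sym {inj₂ _} {inj₁ _} _ = tt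
  joinAdj-sym {inj₂ _} {inj₂ _} = Graph.sym-∼ H

  joinAdj-irrefl : ∀ x → ¬ JoinAdj x x
  joinAdj-irrefl (inj₁ _) = Graph.irrefl G refl
  joinAdj-irrefl (inj₂ _) = Graph.irrefl H refl

  infixr 6 _∨_

  _∨_ : Graph (a + b)
  _∨_ = record
    { _∼_    = λ i j → JoinAdj (splitAt a i) (splitAt a j)
    ; _∼?_   = λ i j → joinAdj? (splitAt a i) (splitAt a j)
    ; sym-∼  = λ {i} {j} → joinAdj-sym {splitAt a i} {splitAt a j}
    ; irrefl = λ { {i} refl → joinAdj-irrefl (splitAt a i) }
    }

-- C_k has edges {i , i+1} for i + 1 < k, and {k-1 , 0}.  The condition i ≢ j
-- only matters for k = 1.
Next : ∀ {k} → Rel (Fin k) 0ℓ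
Next {k} i j = suc (toℕ i) ≡ toℕ j ⊎ (suc (toℕ i) ≡ k × toℕ j ≡ 0)

next? : ∀ {k} → Decidable (Next {k})
next? {k} i j = (suc (toℕ i) ℕ.≟ toℕ j) ⊎-dec ((suc (toℕ i) ℕ.≟ k) ×-dec (toℕ j ℕ.≟ 0))

C : (k : ℕ) → Graph k
C k = record
  { _∼_    = λ i j → i ≢ j × (Next i j ⊎ Next j i)
  ; _∼?_   = λ i j → ¬? (i Fin.≟ j) ×-dec (next? i j ⊎-dec next? j i)
  ; sym-∼  = λ (i≢j , ij) → ≢-sym i≢j , Sum.swap ij
  ; irrefl = λ i≡j (i≢j , _) → i≢j i≡j
  }

module _ {n : ℕ} (G : Graph n) where

  Walk : ℕ → Rel (Fin n) 0ℓ
  Walk zero    i j = i ≡ j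
  Walk (suc ℓ) i j = ∃[ h ] (Adj G i h × Walk ℓ h j)

  walk? : ∀ ℓ → Decidable (Walk ℓ)
  walk? zero    i j = i Fin.≟ j
  walk? (suc ℓ) i j = Finₚ.any? (λ h → adj? G i h ×-dec walk? ℓ h j)

  walk-snoc : ∀ ℓ {i h j} → Walk ℓ i h → Adj G h j → Walk (suc ℓ) i j
  walk-snoc zero    refl         hj = _ , hj , refl
  walk-snoc (suc ℓ) (_ , il , w) hj = _ , il , walk-snoc ℓ w hj

  walk-sym : ∀ ℓ → Symmetric (Walk ℓ)
  walk-sym zero    refl         = refl
  walk-sym (suc ℓ) (_ , ih , w) = walk-snoc ℓ (walk-sym ℓ w) (Graph.sym-∼ G ih)

  Dist≤ : ℕ → Rel (Fin n) 0ℓ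
  Dist≤ p i j = ∃[ ℓ ] (ℓ ≤ p × Walk ℓ i j)

  dist≤? : ∀ p → Decidable (Dist≤ p)
  dist≤? p i j = map′ (λ (ℓ , ℓ<1+p , w) → ℓ , s≤s⁻¹ ℓ<1+p , w)
                      (λ (ℓ , ℓ≤p , w) → ℓ , s≤s ℓ≤p , w)
                      (ℕₚ.anyUpTo? (λ ℓ → walk? ℓ i j) (suc p))

  infixr 8 _^_

  _^_ : ℕ → Graph n
  _^_ p = record
    { _∼_    = λ i j → i ≢ j × Dist≤ p i j
    ; _∼?_   = λ i j → ¬? (i Fin.≟ j) ×-dec dist≤? p i j
    ; sym-∼  = λ (i≢j , ℓ , ℓ≤p , w) → ≢-sym i≢j , ℓ , ℓ≤p , walk-sym ℓ w
    ; irrefl = λ i≡j (i≢j , _) → i≢j i≡j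
    }

completeMultipartite : ∀ {n q} → (Fin n → Fin q) → Graph n
completeMultipartite part = record
  { _∼_    = λ i j → part i ≢ part j
  ; _∼?_   = λ i j → ¬? (part i Fin.≟ part j)
  ; sym-∼  = ≢-sym
  ; irrefl = λ i≡j ne → ne (cong part i≡j)
  }

partSize : ∀ {n q} → (Fin n → Fin q) → Fin q → ℕ
partSize {n} part a = length (filter (λ i → part i Fin.≟ a) (allFin n))

Balanced : ∀ {n q} → (Fin n → Fin q) → Set
Balanced part = ∀ a b → partSize part a ≤ suc (partSize part b)

residue : ∀ n q .{{_ : NonZero q}} → Fin n → Fin q
residue n q i = toℕ i mod q

-- The parts are the residue classes modulo q; their sizes pairwise differ by
-- at most one by residue-balanced below.
T : ∀ n q .{{_ : NonZero q}} → Graph n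
T n q = completeMultipartite (residue n q)

module _ (q : ℕ) .{{_ : NonZero q}} (a : Fin q) where

  private
    co : ℕ
    co = q ∸ suc (toℕ a)

    co-eq : suc (toℕ a + co) ≡ q
    co-eq = ℕₚ.m+[n∸m]≡n (Finₚ.toℕ<n a)

    -- The number of x < s with x mod q = a.
    below : ℕ → ℕ
    below s = (s + co) / q

    shift : ∀ r d → (r + d * q + co) / q ≡ (r + co) / q + d
    shift r d = begin
      (r + d * q + co) / q      ≡⟨ cong (_/ q) (trans (ℕₚ.+-assoc r (d * q) co) (trans (cong (r +_) (ℕₚ.+-comm (d * q) co)) (sym (ℕₚ.+-assoc r co (d * q))))) ⟩
      (r + co + d * q) / q      ≡⟨ +-distrib-/-∣ʳ (r + co) (divides-refl d) ⟩
      (r + co) / q + d * q / q  ≡⟨ cong ((r + co) / q +_) (m*n/n≡m d q) ⟩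
      (r + co) / q + d          ∎
      where open ≡-Reasoning

    div≡1 : ∀ {x} → q ≤ x → x < q + q → x / q ≡ 1
    div≡1 {x} lo hi = ℕₚ.≤-antisym
      (s≤s⁻¹ (m<n*o⇒m/o<n {x} {2} {q} (subst (x <_) (cong (q +_) (sym (ℕₚ.+-identityʳ q))) hi)))
      (m≥n⇒m/n>0 lo)

    co<q : co < q
    co<q = subst (suc co ≤_) co-eq (s≤s (ℕₚ.m≤n+m co (toℕ a)))

    small : ∀ {r} → r ≤ toℕ a → (r + co) / q ≡ 0
    small {r} r≤a = m<n⇒m/n≡0 (subst (suc (r + co) ≤_) co-eq (s≤s (ℕₚ.+-monoˡ-≤ co r≤a)))

    large : ∀ {r} → toℕ a < r → r ≤ q → (r + co) / q ≡ 1
    large {r} a<r r≤q = div≡1 (subst (_≤ r + co) co-eq (ℕₚ.+-monoˡ-≤ co a<r))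
                              (ℕₚ.+-mono-≤-< r≤q co<q)

    split : ∀ s → s ≡ s % q + s / q * q
    split s = m≡m%n+[m/n]*n s q

    below-eq : ∀ s → below s ≡ (s % q + co) / q + s / q
    below-eq s = trans (cong below (split s)) (shift (s % q) (s / q))

    below-suc-eq : ∀ s → below (suc s) ≡ (suc (s % q) + co) / q + s / q
    below-suc-eq s = trans (cong (below ∘ suc) (split s)) (shift (suc (s % q)) (s / q))

    below-hit : ∀ s → s % q ≡ toℕ a → below (suc s) ≡ suc (below s)
    below-hit s eq = begin
      below (suc s)                        ≡⟨ below-suc-eq s ⟩
      (suc (s % q) + co) / q + s / q       ≡⟨ cong (_+ s / q) (large (s≤s (ℕₚ.≤-reflexive (sym eq))) (m%n<n s q)) ⟩
      suc (s / q)                          ≡⟨ cong (λ z → suc (z + s / q)) (sym (small (ℕₚ.≤-reflexive eq))) ⟩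
      suc ((s % q + co) / q + s / q)       ≡⟨ cong suc (sym (below-eq s)) ⟩
      suc (below s)                        ∎
      where open ≡-Reasoning

    below-miss : ∀ s → s % q ≢ toℕ a → below (suc s) ≡ below s
    below-miss s ne = trans (below-suc-eq s) (trans (cong (_+ s / q) same) (sym (below-eq s)))
      where
      same : (suc (s % q) + co) / q ≡ (s % q + co) / q
      same with ℕₚ.<-cmp (s % q) (toℕ a)
      ... | tri< r<a _ _ = trans (small r<a) (sym (small (ℕₚ.<⇒≤ r<a)))
      ... | tri≈ _ r≡a _ = ⊥-elim (ne r≡a)
      ... | tri> _ _ a<r = trans (large (ℕₚ.m<n⇒m<1+n a<r) (m%n<n s q)) (sym (large a<r (ℕₚ.<⇒≤ (m%n<n s q))))

    count : ∀ {n m} s (f : Fin n → Fin m) → (∀ i → toℕ (f i) ≡ s + toℕ i) →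
            length (filter (λ i → residue m q i Fin.≟ a) (tabulate f)) + below s ≡ below (s + n)
    count {zero}      s f eq = cong below (sym (ℕₚ.+-identityʳ s))
    count {suc n} {m} s f eq with residue m q (f zero) Fin.≟ a
    ... | yes hit = begin
        suc (rest + below s)   ≡⟨ sym (ℕₚ.+-suc rest (below s)) ⟩
        rest + suc (below s)   ≡⟨ cong (rest +_) (sym (below-hit s s%q≡a)) ⟩
        rest + below (suc s)   ≡⟨ count (suc s) (f ∘ suc) (λ i → trans (eq (suc i)) (ℕₚ.+-suc s (toℕ i))) ⟩
        below (suc s + n)      ≡⟨ cong below (sym (ℕₚ.+-suc s n)) ⟩
        below (s + suc n)      ∎
      where
      open ≡-Reasoning
      rest = length (filter (λ i → residue m q i Fin.≟ a) (tabulate (f ∘ suc)))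
      s%q≡a : s % q ≡ toℕ a
      s%q≡a = trans (cong (_% q) (sym (trans (eq zero) (ℕₚ.+-identityʳ s))))
                    (trans (sym (Finₚ.toℕ-fromℕ< (m%n<n (toℕ (f zero)) q))) (cong toℕ hit))
    ... | no miss = begin
        rest + below s         ≡⟨ cong (rest +_) (sym (below-miss s s%q≢a)) ⟩
        rest + below (suc s)   ≡⟨ count (suc s) (f ∘ suc) (λ i → trans (eq (suc i)) (ℕₚ.+-suc s (toℕ i))) ⟩
        below (suc s + n)      ≡⟨ cong below (sym (ℕₚ.+-suc s n)) ⟩
        below (s + suc n)      ∎
      where
      open ≡-Reasoning
      rest = length (filter (λ i → residue m q i Fin.≟ a) (tabulate (f ∘ suc)))
      s%q≢a : s % q ≢ toℕ a
      s%q≢a h = miss (Finₚ.toℕ-injective (trans (Finₚ.toℕ-fromℕ< (m%n<n (toℕ (f zero)) q))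
                  (trans (cong (_% q) (trans (eq zero) (ℕₚ.+-identityʳ s))) h)))

  residue-partSize : ∀ n → partSize (residue n q) a ≡ (n + (q ∸ suc (toℕ a))) / q
  residue-partSize n = begin
    size            ≡⟨ sym (ℕₚ.+-identityʳ size) ⟩
    size + 0        ≡⟨ cong (size +_) (sym (m<n⇒m/n≡0 co<q)) ⟩
    size + below 0  ≡⟨ count 0 (λ i → i) (λ _ → refl) ⟩
    below n         ∎
    where
    open ≡-Reasoning
    size = partSize (residue n q) a

residue-balanced : ∀ n q .{{_ : NonZero q}} → Balanced (residue n q)
residue-balanced n q a b = begin
  partSize (residue n q) a            ≡⟨ residue-partSize q a n ⟩
  (n + (q ∸ suc (toℕ a))) / q         ≤⟨ /-monoˡ-≤ q (ℕₚ.+-monoʳ-≤ n (ℕₚ.m∸n≤m q (suc (toℕ a)))) ⟩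
  (n + q) / q                         ≡⟨ +-distrib-/-∣ʳ n ∣-refl ⟩
  n / q + q / q                       ≡⟨ cong (n / q +_) (n/n≡1 q) ⟩
  n / q + 1                           ≡⟨ ℕₚ.+-comm (n / q) 1 ⟩
  suc (n / q)                         ≤⟨ s≤s (/-monoˡ-≤ q (ℕₚ.m≤m+n n _)) ⟩
  suc ((n + (q ∸ suc (toℕ b))) / q)   ≡⟨ cong suc (sym (residue-partSize q b n)) ⟩
  suc (partSize (residue n q) b)      ∎
  where open ℕₚ.≤-Reasoning

{-# OPTIONS --safe #-}
module Submission where

-- Put q = p + m + 1, so that k = s q + t.  Deleting a suitable matching of t edges makes C_k^p
-- q-colourable, with all ends of the matching in a single colour class; deleting t - 1 vertices never
-- does, because independent sets have at most s vertices.  Under these conditions one can use Simonovits'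
-- progressive induction: a dense F-free graph contains, by Erdős–Stone, a large balanced complete
-- q-partite graph.  Passing to neighbourhoods, one finds at most t - 1 apexes joined to all of it, while
-- every other vertex sees little of its own part, and a bounded cover removes all edges that could form
-- a matching inside a part.  Deleting the complete q-partite graph that remains then loses fewer edges
-- than in K_{t-1} ∨ T_{n-t+1,q}, so the excess grows as the order shrinks, unless there are t - 1 apexes
-- and the classes of the other vertices are independent.  In that case Turán's optimisation over the
-- class sizes identifies the graph.

open import Defs
open import Data.Bool using (Bool; true; false; if_then_else_)
open import Data.Empty using (⊥; ⊥-elim)
open import Data.Fin using (Fin; zero; suc; toℕ; _↑ˡ_; _↑ʳ_; splitAt; punchIn)
import Data.Fin as Fin
import Data.Fin.Permutation as Perm
import Data.Fin.Properties as Finₚ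
open import Data.List using (List; []; _∷_; _++_; length; filter; allFin; map; concatMap; cartesianProduct; tabulate; lookup; take)
open import Data.List.Membership.Propositional using (_∈_; _∉_; lose)
import Data.List.Membership.Propositional.Properties as ∈ₚ
open import Data.List.Membership.Propositional.Properties.WithK using (unique∧set⇒bag)
import Data.List.Properties as Listₚ
open import Data.List.Relation.Binary.BagAndSetEquality using (∼bag⇒↭)
open import Data.List.Relation.Binary.Permutation.Propositional using (_↭_; ↭-sym; ↭-trans; ↭⇒↭ₛ)
import Data.List.Relation.Binary.Permutation.Propositional.Properties as ↭ₚ
import Data.List.Relation.Binary.Permutation.Setoid.Properties as ↭ₛₚ
open import Data.List.Relation.Unary.All using (All; []; _∷_)
import Data.List.Relation.Unary.All as All
import Data.List.Relation.Unary.All.Properties as Allₚ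
import Data.List.Relation.Unary.AllPairs as AllPairs
import Data.List.Relation.Unary.AllPairs.Properties as AllPairsₚ
open import Data.List.Relation.Unary.Any using (here; there)
open import Data.List.Relation.Unary.Unique.Propositional using (Unique; []; _∷_)
import Data.List.Relation.Unary.Unique.Propositional.Properties as Uniqueₚ
open import Data.Nat using (ℕ; zero; suc; _+_; _*_; _∸_; _≤_; _<_; _≥_; z≤n; s≤s; s≤s⁻¹; NonZero)
import Data.Nat as ℕ
open import Data.Nat.DivMod
  using (_/_; _%_; m≡m%n+[m/n]*n; m%n<n; +-distrib-/-∣ʳ; m*n/n≡m; /-monoˡ-≤; m/n*n≤m; m<n*o⇒m/o<n; n/n≡1)
open import Data.Nat.Divisibility using (divides-refl; ∣-refl)
open import Data.Nat.Induction using (<-rec)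
open import Data.Nat.ListAction using (sum)
open import Data.Nat.ListAction.Properties using (sum-++; sum-↭)
import Data.Nat.Properties as ℕₚ
open import Data.Nat.Tactic.RingSolver using (solve-∀)
open import Data.Product using (Σ-syntax; ∃-syntax; _×_; _,_; proj₁; proj₂)
open import Data.Sum using (_⊎_; inj₁; inj₂)
open import Data.Unit using (tt)
open import Function.Base using (_∘_; id; case_of_)
open import Function.Bundles using (_⇔_; _↔_; Inverse; Injection; Equivalence; mk⇔)
open import Function.Definitions using (Injective)
open import Function.Properties.Inverse using (↔⇒↣)
open import Relation.Binary.Definitions using (tri<; tri≈; tri>)
open import Relation.Binary.PropositionalEquality
open import Relation.Nullary using (¬_; yes; no; Dec; _because_)
open import Relation.Nullary.Decidable using (_×-dec_; _⊎-dec_; ¬?)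

open Graph using () renaming (_∼_ to Adj; _∼?_ to adj?)

𝟙 : ∀ {P : Set} → Dec P → ℕ
𝟙 (true  because _) = 1
𝟙 (false because _) = 0

𝟙≤1 : ∀ {P : Set} (d : Dec P) → 𝟙 d ≤ 1
𝟙≤1 (true  because _) = s≤s z≤n
𝟙≤1 (false because _) = z≤n

𝟙-yes : ∀ {P : Set} (d : Dec P) → P → 𝟙 d ≡ 1
𝟙-yes (yes _) _ = refl
𝟙-yes (no ¬p) p = ⊥-elim (¬p p)

𝟙-no : ∀ {P : Set} (d : Dec P) → ¬ P → 𝟙 d ≡ 0
𝟙-no (yes p) ¬p = ⊥-elim (¬p p)
𝟙-no (no _)  _  = refl

𝟙-mono : ∀ {P Q : Set} (d : Dec P) (d′ : Dec Q) → (P → Q) → 𝟙 d ≤ 𝟙 d′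
𝟙-mono (yes p) d′ f = ℕₚ.≤-reflexive (sym (𝟙-yes d′ (f p)))
𝟙-mono (no _)  d′ f = z≤n

𝟙-cong : ∀ {P Q : Set} (d : Dec P) (d′ : Dec Q) → (P → Q) → (Q → P) → 𝟙 d ≡ 𝟙 d′
𝟙-cong d d′ f g = ℕₚ.≤-antisym (𝟙-mono d d′ f) (𝟙-mono d′ d g)

𝟙+𝟙¬ : ∀ {P Q : Set} (d : Dec P) (d′ : Dec Q) → (P → ¬ Q) → (¬ P → Q) → 𝟙 d + 𝟙 d′ ≡ 1
𝟙+𝟙¬ (yes p) d′ f g = cong suc (𝟙-no d′ (f p))
𝟙+𝟙¬ (no ¬p) d′ f g = 𝟙-yes d′ (g ¬p)

infixr 8 ∑
∑ : ∀ {A : Set} → List A → (A → ℕ) → ℕ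
∑ xs f = sum (map f xs)

syntax ∑ xs (λ x → t) = ∑[ x ← xs ] t

module _ {A : Set} where

  ∑-mono : ∀ (xs : List A) {f g : A → ℕ} → (∀ {x} → x ∈ xs → f x ≤ g x) → ∑ xs f ≤ ∑ xs g
  ∑-mono []       h = z≤n
  ∑-mono (x ∷ xs) h = ℕₚ.+-mono-≤ (h (here refl)) (∑-mono xs (h ∘ there))

  ∑-mono-< : ∀ (xs : List A) {f g : A → ℕ} → (∀ {x} → x ∈ xs → f x ≤ g x) →
             ∀ {x} → x ∈ xs → f x < g x → ∑ xs f < ∑ xs g
  ∑-mono-< (x ∷ xs) h (here refl) lt = ℕₚ.+-mono-<-≤ lt (∑-mono xs (h ∘ there))
  ∑-mono-< (x ∷ xs) h (there x∈)  lt = ℕₚ.+-mono-≤-< (h (here refl)) (∑-mono-< xs (h ∘ there) x∈ lt)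

  ∑-tight : ∀ (xs : List A) {f g : A → ℕ} → (∀ {x} → x ∈ xs → f x ≤ g x) → ∑ xs g ≤ ∑ xs f →
            ∀ {x} → x ∈ xs → f x ≡ g x
  ∑-tight xs {f} {g} h le {x} x∈ with f x ℕ.<? g x
  ... | yes lt = ⊥-elim (ℕₚ.<⇒≱ (∑-mono-< xs h x∈ lt) le)
  ... | no ≮   = ℕₚ.≤-antisym (h x∈) (ℕₚ.≮⇒≥ ≮)

  ∑-cong : ∀ (xs : List A) {f g : A → ℕ} → (∀ {x} → x ∈ xs → f x ≡ g x) → ∑ xs f ≡ ∑ xs g
  ∑-cong xs h = ℕₚ.≤-antisym (∑-mono xs (ℕₚ.≤-reflexive ∘ h)) (∑-mono xs (ℕₚ.≤-reflexive ∘ sym ∘ h))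

  ∑-+ : ∀ (xs : List A) (f g : A → ℕ) → ∑[ x ← xs ] (f x + g x) ≡ ∑ xs f + ∑ xs g
  ∑-+ []       f g = refl
  ∑-+ (x ∷ xs) f g rewrite ∑-+ xs f g = interchange (f x) (g x) (∑ xs f) (∑ xs g)
    where
    interchange : ∀ a b c d → a + b + (c + d) ≡ a + c + (b + d)
    interchange = solve-∀

  ∑-*ˡ : ∀ (xs : List A) c (f : A → ℕ) → ∑[ x ← xs ] (c * f x) ≡ c * ∑ xs f
  ∑-*ˡ []       c f = sym (ℕₚ.*-zeroʳ c)
  ∑-*ˡ (x ∷ xs) c f rewrite ∑-*ˡ xs c f = sym (ℕₚ.*-distribˡ-+ c (f x) (∑ xs f))

  ∑-const : ∀ (xs : List A) c → ∑[ _ ← xs ] c ≡ length xs * c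
  ∑-const []       c = refl
  ∑-const (x ∷ xs) c = cong (c +_) (∑-const xs c)

  ∑-++ : ∀ (xs ys : List A) (f : A → ℕ) → ∑ (xs ++ ys) f ≡ ∑ xs f + ∑ ys f
  ∑-++ xs ys f = trans (cong sum (Listₚ.map-++ f xs ys)) (sum-++ (map f xs) (map f ys))

  ∑-↭ : ∀ {xs ys : List A} → xs ↭ ys → (f : A → ℕ) → ∑ xs f ≡ ∑ ys f
  ∑-↭ p f = sum-↭ (↭ₚ.map⁺ f p)

  ∑-concatMap : ∀ {B : Set} (h : B → List A) (bs : List B) (f : A → ℕ) →
                ∑ (concatMap h bs) f ≡ ∑[ b ← bs ] ∑ (h b) f
  ∑-concatMap h []       f = refl
  ∑-concatMap h (b ∷ bs) f = trans (∑-++ (h b) (concatMap h bs) f) (cong (∑ (h b) f +_) (∑-concatMap h bs f))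

  ∑-map : ∀ {B : Set} (h : B → A) (bs : List B) (f : A → ℕ) → ∑ (map h bs) f ≡ ∑ bs (f ∘ h)
  ∑-map h bs f = cong sum (sym (Listₚ.map-∘ bs))

  length-filter : ∀ {P : A → Set} (P? : ∀ x → Dec (P x)) (xs : List A) →
                  length (filter P? xs) ≡ ∑[ x ← xs ] 𝟙 (P? x)
  length-filter P? []       = refl
  length-filter P? (x ∷ xs) with P? x
  ... | yes _ = cong suc (length-filter P? xs)
  ... | no  _ = length-filter P? xs

∑-swap : ∀ {A B : Set} (xs : List A) (ys : List B) (f : A → B → ℕ) →
         ∑[ x ← xs ] ∑[ y ← ys ] f x y ≡ ∑[ y ← ys ] ∑[ x ← xs ] f x y
∑-swap []       ys f = sym (trans (∑-const ys 0) (ℕₚ.*-zeroʳ (length ys)))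
∑-swap (x ∷ xs) ys f = trans (cong (∑ ys (f x) +_) (∑-swap xs ys f)) (sym (∑-+ ys (f x) _))

∑-δ-∉ : ∀ {n} (xs : List (Fin n)) {i} → i ∉ xs → ∑[ x ← xs ] 𝟙 (x Finₚ.≟ i) ≡ 0
∑-δ-∉ []       i∉ = refl
∑-δ-∉ (x ∷ xs) {i} i∉ = cong₂ _+_ (𝟙-no (x Finₚ.≟ i) (i∉ ∘ here ∘ sym)) (∑-δ-∉ xs (i∉ ∘ there))

∑-δ-unique : ∀ {n} {xs : List (Fin n)} {i} → Unique xs → i ∈ xs → ∑[ x ← xs ] 𝟙 (x Finₚ.≟ i) ≡ 1
∑-δ-unique {xs = x ∷ xs} (ne ∷ u) (here refl) =
  cong₂ _+_ (𝟙-yes (x Finₚ.≟ x) refl) (∑-δ-∉ xs (λ x∈ → All.lookup ne x∈ refl))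
∑-δ-unique {xs = x ∷ xs} {i} (ne ∷ u) (there i∈) =
  cong₂ _+_ (𝟙-no (x Finₚ.≟ i) (λ eq → All.lookup ne i∈ eq)) (∑-δ-unique u i∈)

∑-δ : ∀ {n} (i : Fin n) → ∑[ x ← allFin n ] 𝟙 (x Finₚ.≟ i) ≡ 1
∑-δ {n} i = ∑-δ-unique (Uniqueₚ.allFin⁺ n) (∈ₚ.∈-allFin i)

∑-δ-* : ∀ {n} (i : Fin n) c → ∑[ x ← allFin n ] (𝟙 (x Finₚ.≟ i) * c) ≡ c
∑-δ-* {n} i c = begin
  ∑[ x ← allFin n ] (𝟙 (x Finₚ.≟ i) * c)   ≡⟨ ∑-cong (allFin n) (λ {x} _ → ℕₚ.*-comm (𝟙 (x Finₚ.≟ i)) c) ⟩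
  ∑[ x ← allFin n ] (c * 𝟙 (x Finₚ.≟ i))   ≡⟨ ∑-*ˡ (allFin n) c _ ⟩
  c * ∑[ x ← allFin n ] 𝟙 (x Finₚ.≟ i)     ≡⟨ cong (c *_) (∑-δ i) ⟩
  c * 1                                    ≡⟨ ℕₚ.*-identityʳ c ⟩
  c                                        ∎
  where open ≡-Reasoning

length-allFin : ∀ n → length (allFin n) ≡ n
length-allFin n = Listₚ.length-tabulate id

∑-allFin-const : ∀ n c → ∑[ _ ← allFin n ] c ≡ n * c
∑-allFin-const n c = trans (∑-const (allFin n) c) (cong (_* c) (length-allFin n))

module _ {n : ℕ} where

  open import Data.List.Membership.DecPropositional (Finₚ._≟_ {n}) public using (_∈?_)

-- In a linear combination of inequalities both sides usually share a summand c.
≤-cancel : ∀ {x y} c {a b} → a ≤ b → x + c ≡ a → b ≡ y + c → x ≤ y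
≤-cancel {x} {y} c a≤b eq eq′ = ℕₚ.+-cancelʳ-≤ c x y (subst₂ _≤_ (sym eq) eq′ a≤b)

Unique-↭ : ∀ {n} {xs ys : List (Fin n)} → Unique xs → Unique ys →
           (∀ {x} → x ∈ xs → x ∈ ys) → (∀ {x} → x ∈ ys → x ∈ xs) → xs ↭ ys
Unique-↭ u v f g = ∼bag⇒↭ (unique∧set⇒bag u v (mk⇔ f g))

rest : ∀ {n} → List (Fin n) → List (Fin n)
rest {n} xs = filter (λ x → ¬? (x ∈? xs)) (allFin n)

Unique-rest : ∀ {n} (xs : List (Fin n)) → Unique (rest xs)
Unique-rest {n} xs = Uniqueₚ.filter⁺ (λ x → ¬? (x ∈? xs)) (Uniqueₚ.allFin⁺ n)

allFin-↭ : ∀ {n} {xs : List (Fin n)} → Unique xs → allFin n ↭ xs ++ rest xs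
allFin-↭ {n} {xs} u = Unique-↭ (Uniqueₚ.allFin⁺ n)
  (Uniqueₚ.++⁺ u (Unique-rest xs)
    (λ (x∈xs , x∈rest) → proj₂ (∈ₚ.∈-filter⁻ (λ x → ¬? (x ∈? xs)) {xs = allFin n} x∈rest) x∈xs))
  to (λ {x} _ → ∈ₚ.∈-allFin x)
  where
  to : ∀ {x} → x ∈ allFin n → x ∈ xs ++ rest xs
  to {x} x∈ with x ∈? xs
  ... | yes x∈xs = ∈ₚ.∈-++⁺ˡ x∈xs
  ... | no  x∉xs = ∈ₚ.∈-++⁺ʳ xs (∈ₚ.∈-filter⁺ (λ x → ¬? (x ∈? xs)) x∈ x∉xs)

length+length-rest : ∀ {n} {xs : List (Fin n)} → Unique xs → length xs + length (rest xs) ≡ n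
length+length-rest {n} {xs} u = trans (sym (Listₚ.length-++ xs))
  (trans (sym (↭ₚ.↭-length (allFin-↭ u))) (length-allFin n))

module _ {n : ℕ} (G : Graph n) where

  deg : Fin n → List (Fin n) → ℕ
  deg x ys = ∑[ y ← ys ] 𝟙 (adj? G x y)

  edges : List (Fin n) → List (Fin n) → ℕ
  edges xs ys = ∑[ x ← xs ] deg x ys

  -- Ordered pairs: every edge is counted twice.
  size : ℕ
  size = edges (allFin n) (allFin n)

  𝟙-adj-sym : ∀ x y → 𝟙 (adj? G x y) ≡ 𝟙 (adj? G y x)
  𝟙-adj-sym x y = 𝟙-cong (adj? G x y) (adj? G y x) (Graph.sym-∼ G) (Graph.sym-∼ G)

  deg≤length : ∀ x ys → deg x ys ≤ length ys
  deg≤length x ys = subst (deg x ys ≤_) (trans (∑-const ys 1) (ℕₚ.*-identityʳ (length ys)))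
    (∑-mono ys (λ {y} _ → 𝟙≤1 (adj? G x y)))

  size≤ : size ≤ n * n
  size≤ = ℕₚ.≤-trans (∑-mono (allFin n) (λ {x} _ → deg≤length x (allFin n)))
    (ℕₚ.≤-reflexive (trans (∑-allFin-const n (length (allFin n))) (cong (n *_) (length-allFin n))))

  edges-sym : ∀ xs ys → edges xs ys ≡ edges ys xs
  edges-sym xs ys = trans (∑-swap xs ys _)
    (∑-cong ys (λ {y} _ → ∑-cong xs (λ {x} _ → 𝟙-adj-sym x y)))

  edges-++ˡ : ∀ xs xs′ ys → edges (xs ++ xs′) ys ≡ edges xs ys + edges xs′ ys
  edges-++ˡ xs xs′ ys = ∑-++ xs xs′ _

  edges-++ʳ : ∀ xs ys ys′ → edges xs (ys ++ ys′) ≡ edges xs ys + edges xs ys′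
  edges-++ʳ xs ys ys′ = trans (∑-cong xs (λ {x} _ → ∑-++ ys ys′ _)) (∑-+ xs _ _)

  edges-↭ : ∀ {xs xs′ ys ys′} → xs ↭ xs′ → ys ↭ ys′ → edges xs ys ≡ edges xs′ ys′
  edges-↭ {xs} p p′ = trans (∑-cong xs (λ _ → ∑-↭ p′ _)) (∑-↭ p _)

  induced : (xs : List (Fin n)) → Graph (length xs)
  induced xs = record
    { _∼_    = λ i j → Adj G (lookup xs i) (lookup xs j)
    ; _∼?_   = λ i j → adj? G (lookup xs i) (lookup xs j)
    ; sym-∼  = Graph.sym-∼ G
    ; irrefl = λ i≡j → Graph.irrefl G (cong (lookup xs) i≡j)
    }

lookup-injective : ∀ {A : Set} {xs : List A} → Unique xs → ∀ {i j} → lookup xs i ≡ lookup xs j → i ≡ j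
lookup-injective (x ∷ u) {zero}  {zero}  eq = refl
lookup-injective (ne ∷ u) {zero}  {suc j} eq = ⊥-elim (All.lookup ne (∈ₚ.∈-lookup j) eq)
lookup-injective (ne ∷ u) {suc i} {zero}  eq = ⊥-elim (All.lookup ne (∈ₚ.∈-lookup i) (sym eq))
lookup-injective (x ∷ u) {suc i} {suc j} eq = cong suc (lookup-injective u eq)

∑-lookup : ∀ {A : Set} (xs : List A) (f : A → ℕ) → ∑[ i ← allFin (length xs) ] f (lookup xs i) ≡ ∑ xs f
∑-lookup xs f = trans (sym (∑-map (lookup xs) (allFin (length xs)) f))
  (cong (λ ys → ∑ ys f) (trans (Listₚ.map-tabulate id (lookup xs)) (Listₚ.tabulate-lookup xs)))

module _ {n : ℕ} (G : Graph n) where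

  size-induced : ∀ xs → size (induced G xs) ≡ edges G xs xs
  size-induced xs = trans
    (∑-cong (allFin (length xs)) (λ {i} _ → ∑-lookup xs (λ y → 𝟙 (adj? G (lookup xs i) y))))
    (∑-lookup xs (λ x → deg G x xs))

  size-remove : ∀ {xs} → Unique xs →
    size G + edges G xs xs ≡ size (induced G (rest xs)) + 2 * ∑[ x ← allFin n ] deg G x xs
  size-remove {xs} u = begin
    size G + edges G xs xs
      ≡⟨ cong (_+ edges G xs xs) (edges-↭ G (allFin-↭ u) (allFin-↭ u)) ⟩
    edges G (xs ++ rest xs) (xs ++ rest xs) + edges G xs xs
      ≡⟨ cong (_+ edges G xs xs) (trans (edges-++ˡ G xs (rest xs) (xs ++ rest xs)) (cong₂ _+_ (edges-++ʳ G xs xs (rest xs)) (edges-++ʳ G (rest xs) xs (rest xs)))) ⟩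
    edges G xs xs + edges G xs (rest xs) + (edges G (rest xs) xs + edges G (rest xs) (rest xs)) + edges G xs xs
      ≡⟨ cong (λ z → edges G xs xs + z + (edges G (rest xs) xs + edges G (rest xs) (rest xs)) + edges G xs xs) (edges-sym G xs (rest xs)) ⟩
    edges G xs xs + edges G (rest xs) xs + (edges G (rest xs) xs + edges G (rest xs) (rest xs)) + edges G xs xs
      ≡⟨ arith (edges G xs xs) (edges G (rest xs) xs) (edges G (rest xs) (rest xs)) ⟩
    edges G (rest xs) (rest xs) + 2 * (edges G xs xs + edges G (rest xs) xs)
      ≡⟨ cong₂ (λ a b → a + 2 * b) (sym (size-induced (rest xs))) (sym (trans (∑-↭ (allFin-↭ u) _) (edges-++ˡ G xs (rest xs) xs))) ⟩
    size (induced G (rest xs)) + 2 * ∑[ x ← allFin n ] deg G x xs ∎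
    where
    open ≡-Reasoning
    arith : ∀ a b c → a + b + (b + c) + a ≡ c + 2 * (a + b)
    arith = solve-∀

  induced-free : ∀ {k} {F : Graph k} {xs} → Unique xs → Free F G → Free F (induced G xs)
  induced-free {xs = xs} u free (f , inj , hom) =
    free (lookup xs ∘ f , (λ eq → inj (lookup-injective u eq)) , hom)

∑-cartesianProduct : ∀ {A B : Set} (xs : List A) (ys : List B) (f : A × B → ℕ) →
                     ∑ (cartesianProduct xs ys) f ≡ ∑[ x ← xs ] ∑[ y ← ys ] f (x , y)
∑-cartesianProduct []       ys f = refl
∑-cartesianProduct (x ∷ xs) ys f = trans (∑-++ (map (x ,_) ys) (cartesianProduct xs ys) f)
  (cong₂ _+_ (∑-map (x ,_) ys f) (∑-cartesianProduct xs ys f))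

2e≡size : ∀ {n} (G : Graph n) → 2 * e G ≡ size G
2e≡size {n} G = begin
  2 * e G
    ≡⟨ cong (e G +_) (ℕₚ.+-identityʳ (e G)) ⟩
  e G + e G
    ≡⟨ cong₂ _+_ half (trans half (∑-swap V V _)) ⟩
  ∑[ x ← V ] ∑[ y ← V ] 𝟙 (lt x y) + ∑[ x ← V ] ∑[ y ← V ] 𝟙 (lt y x)
    ≡⟨ sym (trans (∑-cong V (λ _ → ∑-+ V _ _)) (∑-+ V _ _)) ⟩
  ∑[ x ← V ] ∑[ y ← V ] (𝟙 (lt x y) + 𝟙 (lt y x))
    ≡⟨ ∑-cong V (λ {x} _ → ∑-cong V (λ {y} _ → one x y)) ⟩
  size G ∎
  where
  open ≡-Reasoning
  V = allFin n
  lt : ∀ x y → Dec (x Fin.< y × Adj G x y)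
  lt x y = (x Finₚ.<? y) ×-dec adj? G x y
  half : e G ≡ ∑[ x ← V ] ∑[ y ← V ] 𝟙 (lt x y)
  half = trans (length-filter (λ (i , j) → lt i j) (cartesianProduct V V)) (∑-cartesianProduct V V _)
  one : ∀ x y → 𝟙 (lt x y) + 𝟙 (lt y x) ≡ 𝟙 (adj? G x y)
  one x y with Finₚ.<-cmp x y
  ... | tri< x<y _ y≮x = trans (cong₂ _+_ (𝟙-cong (lt x y) (adj? G x y) proj₂ (x<y ,_)) (𝟙-no (lt y x) (y≮x ∘ proj₁)))
                               (ℕₚ.+-identityʳ _)
  ... | tri≈ x≮y refl _ = trans (cong₂ _+_ (𝟙-no (lt x x) (x≮y ∘ proj₁)) (𝟙-no (lt x x) (x≮y ∘ proj₁)))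
                                (sym (𝟙-no (adj? G x x) (Graph.irrefl G refl)))
  ... | tri> x≮y _ y<x = trans (cong₂ _+_ (𝟙-no (lt x y) (x≮y ∘ proj₁)) refl)
                           (𝟙-cong (lt y x) (adj? G x y) (Graph.sym-∼ G ∘ proj₂) (λ a → y<x , Graph.sym-∼ G a))

allFin-↔ : ∀ {m n} (f : Fin m ↔ Fin n) → map (Inverse.to f) (allFin m) ↭ allFin n
allFin-↔ {m} {n} f = Unique-↭ (Uniqueₚ.map⁺ (Injection.injective (↔⇒↣ f)) (Uniqueₚ.allFin⁺ m)) (Uniqueₚ.allFin⁺ n)
  (λ {x} _ → ∈ₚ.∈-allFin x)
  (λ {x} _ → subst (_∈ map (Inverse.to f) (allFin m)) (Inverse.strictlyInverseˡ f x)
               (∈ₚ.∈-map⁺ (Inverse.to f) (∈ₚ.∈-allFin (Inverse.from f x))))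

∑-↔ : ∀ {m n} (f : Fin m ↔ Fin n) (h : Fin n → ℕ) → ∑[ i ← allFin m ] h (Inverse.to f i) ≡ ∑ (allFin n) h
∑-↔ {m} f h = trans (sym (∑-map (Inverse.to f) (allFin m) h)) (∑-↭ (allFin-↔ f) h)

size-≅ : ∀ {m n} {G : Graph m} {H : Graph n} → G ≅ H → size G ≡ size H
size-≅ {m} {n} {G} {H} (f , iso) = begin
  size G
    ≡⟨ ∑-cong (allFin m) (λ {i} _ → ∑-cong (allFin m) (λ {j} _ →
         𝟙-cong (adj? G i j) (adj? H (Inverse.to f i) (Inverse.to f j))
                (Equivalence.to (iso i j)) (Equivalence.from (iso i j)))) ⟩
  ∑[ i ← allFin m ] ∑[ j ← allFin m ] 𝟙 (adj? H (Inverse.to f i) (Inverse.to f j))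
    ≡⟨ ∑-cong (allFin m) (λ {i} _ → ∑-↔ f (λ y → 𝟙 (adj? H (Inverse.to f i) y))) ⟩
  ∑[ i ← allFin m ] deg H (Inverse.to f i) (allFin n)
    ≡⟨ ∑-↔ f (λ x → deg H x (allFin n)) ⟩
  size H ∎
  where open ≡-Reasoning

-- Simonovits' progressive induction, with n the number of vertices and x the excess:
-- n + D x never decreases, so the excess outgrows its bound unless n stays small.
progressive-induction : (c D n₀ : ℕ) → ∃[ N ] ∀ (A : Set) (R : ℕ → ℕ → Set₁) →
  (∀ {n x} → R n x → x ≤ c * (n * n)) →
  (∀ {n x} → n₀ ≤ n → R n x → A ⊎ (∃[ n′ ] n′ < n × n ≤ n′ + D × R n′ (suc x))) →
  ∀ {n} → N ≤ n → R n 0 → A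
progressive-induction c D n₀ = suc (n₀ + D * B) , proof
  where
  B = c * (n₀ * n₀)
  proof : ∀ A R → _ → _ → _
  proof A R bound step {n} N≤n r with invariant n r
    where
    P : ℕ → Set₁
    P n = ∀ {x} → R n x → A ⊎ n + D * x ≤ n₀ + D * B
    invariant : ∀ n → P n
    invariant = <-rec P rec
      where
      rec : ∀ n → (∀ {n′} → n′ < n → P n′) → P n
      rec n ih {x} r with n₀ ℕ.≤? n
      ... | no n₀≰n = inj₂ (ℕₚ.+-mono-≤ n≤n₀
              (ℕₚ.*-monoʳ-≤ D (ℕₚ.≤-trans (bound r) (ℕₚ.*-monoʳ-≤ c (ℕₚ.*-mono-≤ n≤n₀ n≤n₀)))))
        where n≤n₀ = ℕₚ.<⇒≤ (ℕₚ.≰⇒> n₀≰n)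
      ... | yes n₀≤n with step n₀≤n r
      ...   | inj₁ a = inj₁ a
      ...   | inj₂ (n′ , n′<n , n≤n′+D , r′) with ih n′<n r′
      ...     | inj₁ a  = inj₁ a
      ...     | inj₂ le = inj₂ (begin
        n + D * x         ≤⟨ ℕₚ.+-monoˡ-≤ (D * x) n≤n′+D ⟩
        n′ + D + D * x    ≡⟨ arith n′ D x ⟩
        n′ + D * suc x    ≤⟨ le ⟩
        n₀ + D * B        ∎)
        where
        open ℕₚ.≤-Reasoning
        arith : ∀ a d y → a + d + d * y ≡ a + d * suc y
        arith = solve-∀
  ... | inj₁ a  = a
  ... | inj₂ le = ⊥-elim (ℕₚ.<⇒≱ N≤n (ℕₚ.≤-trans (ℕₚ.m≤m+n n (D * 0)) le))

∈-take⁻ : ∀ {A : Set} n {xs : List A} {x} → x ∈ take n xs → x ∈ xs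
∈-take⁻ n {xs} x∈ = subst (_ ∈_) (Listₚ.take++drop≡id n xs) (∈ₚ.∈-++⁺ˡ x∈)

length-take-≤ : ∀ {A : Set} n (xs : List A) → n ≤ length xs → length (take n xs) ≡ n
length-take-≤ n xs n≤ = trans (Listₚ.length-take n xs) (ℕₚ.m≤n⇒m⊓n≡m n≤)

record Parts {n : ℕ} (G : Graph n) (q Λ : ℕ) : Set where
  field
    part     : Fin q → List (Fin n)
    unique   : ∀ i → Unique (part i)
    card     : ∀ i → length (part i) ≡ Λ
    complete : ∀ {i j x y} → i ≢ j → x ∈ part i → y ∈ part j → Adj G x y

  vertices : List (Fin n)
  vertices = concatMap part (allFin q)

  disjoint : ∀ {i j x} → i ≢ j → x ∈ part i → x ∉ part j
  disjoint i≢j x∈i x∈j = Graph.irrefl G refl (complete i≢j x∈i x∈j)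

  vertices-unique : Unique vertices
  vertices-unique = Uniqueₚ.concat⁺ (Allₚ.map⁺ (All.tabulate (λ {i} _ → unique i)))
    (AllPairsₚ.map⁺ (AllPairs.map (λ i≢j {_} (x∈i , x∈j) → disjoint i≢j x∈i x∈j) (Uniqueₚ.allFin⁺ q)))

  ∑-vertices : ∀ f → ∑ vertices f ≡ ∑[ i ← allFin q ] ∑ (part i) f
  ∑-vertices f = ∑-concatMap part (allFin q) f

  length-vertices : length vertices ≡ q * Λ
  length-vertices = begin
    length vertices                             ≡⟨ sym (trans (∑-const vertices 1) (ℕₚ.*-identityʳ _)) ⟩
    ∑[ _ ← vertices ] 1                         ≡⟨ ∑-vertices _ ⟩
    ∑[ i ← allFin q ] ∑[ _ ← part i ] 1         ≡⟨ ∑-cong (allFin q) (λ {i} _ → trans (∑-const (part i) 1) (trans (ℕₚ.*-identityʳ _) (card i))) ⟩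
    ∑[ i ← allFin q ] Λ                         ≡⟨ ∑-allFin-const q Λ ⟩
    q * Λ                                       ∎
    where open ≡-Reasoning

  ∈-vertices : ∀ {i x} → x ∈ part i → x ∈ vertices
  ∈-vertices {i} x∈ = ∈ₚ.∈-concatMap⁺ part (lose (∈ₚ.∈-allFin i) x∈)

  deg-part≤ : ∀ x i → deg G x (part i) ≤ Λ
  deg-part≤ x i = subst (deg G x (part i) ≤_) (card i) (deg≤length G x (part i))

  full⇒deg : ∀ {x i} → (∀ {y} → y ∈ part i → Adj G x y) → deg G x (part i) ≡ Λ
  full⇒deg {x} {i} full = trans (∑-cong (part i) (λ {y} y∈ → 𝟙-yes (adj? G x y) (full y∈)))
    (trans (∑-const (part i) 1) (trans (ℕₚ.*-identityʳ _) (card i)))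

  deg-vertices : ∀ x → deg G x vertices ≡ ∑[ i ← allFin q ] deg G x (part i)
  deg-vertices x = ∑-vertices _

  edges-vertices : q * q * (Λ * Λ) ≤ edges G vertices vertices + q * (Λ * Λ)
  edges-vertices = begin
    q * q * (Λ * Λ)
      ≡⟨ trans (ℕₚ.*-assoc q q (Λ * Λ)) (sym (∑-allFin-const q (q * (Λ * Λ)))) ⟩
    ∑[ i ← allFin q ] (q * (Λ * Λ))
      ≤⟨ ∑-mono (allFin q) (λ {i} _ → row i) ⟩
    ∑[ i ← allFin q ] (∑[ x ← part i ] deg G x vertices + Λ * Λ)
      ≡⟨ ∑-+ (allFin q) _ _ ⟩
    ∑[ i ← allFin q ] ∑[ x ← part i ] deg G x vertices + ∑[ i ← allFin q ] (Λ * Λ)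
      ≡⟨ cong₂ _+_ (sym (∑-vertices _)) (∑-allFin-const q (Λ * Λ)) ⟩
    edges G vertices vertices + q * (Λ * Λ) ∎
    where
    open ℕₚ.≤-Reasoning
    term : ∀ {i x} → x ∈ part i → ∀ j → Λ ≤ deg G x (part j) + 𝟙 (j Finₚ.≟ i) * Λ
    term {i} {x} x∈ j with j Finₚ.≟ i
    ... | yes _  = ℕₚ.≤-trans (ℕₚ.≤-reflexive (sym (ℕₚ.+-identityʳ Λ))) (ℕₚ.m≤n+m (Λ + 0) (deg G x (part j)))
    ... | no j≢i = ℕₚ.≤-trans (ℕₚ.≤-reflexive (sym (full⇒deg (complete (j≢i ∘ sym) x∈)))) (ℕₚ.m≤m+n _ _)
    vertex : ∀ {i x} → x ∈ part i → q * Λ ≤ deg G x vertices + Λ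
    vertex {i} {x} x∈ = begin
      q * Λ                                                          ≡⟨ sym (∑-allFin-const q Λ) ⟩
      ∑[ j ← allFin q ] Λ                                            ≤⟨ ∑-mono (allFin q) (λ {j} _ → term x∈ j) ⟩
      ∑[ j ← allFin q ] (deg G x (part j) + 𝟙 (j Finₚ.≟ i) * Λ)      ≡⟨ ∑-+ (allFin q) _ _ ⟩
      ∑[ j ← allFin q ] deg G x (part j) + ∑[ j ← allFin q ] (𝟙 (j Finₚ.≟ i) * Λ)
                                                                     ≡⟨ cong₂ _+_ (sym (deg-vertices x)) (∑-δ-* i Λ) ⟩
      deg G x vertices + Λ                                           ∎
    row : ∀ i → q * (Λ * Λ) ≤ ∑[ x ← part i ] deg G x vertices + Λ * Λ
    row i = begin
      q * (Λ * Λ)                                       ≡⟨ arith q Λ ⟩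
      Λ * (q * Λ)                                       ≡⟨ sym (trans (∑-const (part i) _) (cong (_* (q * Λ)) (card i))) ⟩
      ∑[ x ← part i ] (q * Λ)                           ≤⟨ ∑-mono (part i) vertex ⟩
      ∑[ x ← part i ] (deg G x vertices + Λ)            ≡⟨ ∑-+ (part i) _ _ ⟩
      ∑[ x ← part i ] deg G x vertices + ∑[ _ ← part i ] Λ ≡⟨ cong ((∑[ x ← part i ] deg G x vertices) +_) (trans (∑-const (part i) Λ) (cong (_* Λ) (card i))) ⟩
      ∑[ x ← part i ] deg G x vertices + Λ * Λ          ∎
      where
      arith : ∀ a b → a * (b * b) ≡ b * (a * b)
      arith = solve-∀

  remainder : Graph (length (rest vertices))
  remainder = induced G (rest vertices)

  length-remainder : q * Λ + length (rest vertices) ≡ n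
  length-remainder = trans (cong (_+ length (rest vertices)) (sym length-vertices))
                           (length+length-rest vertices-unique)

  size-remainder : size G + q * q * (Λ * Λ) ≤
                   size remainder + 2 * ∑[ x ← allFin n ] deg G x vertices + q * (Λ * Λ)
  size-remainder = ≤-cancel (edges G vertices vertices)
    (ℕₚ.+-mono-≤ (ℕₚ.≤-reflexive (size-remove G vertices-unique)) edges-vertices)
    (shuffle₁ (size G) (edges G vertices vertices) (q * q * (Λ * Λ)))
    (shuffle₂ (size remainder) (∑[ x ← allFin n ] deg G x vertices) (edges G vertices vertices) (q * (Λ * Λ)))
    where
    shuffle₁ : ∀ a b c → a + c + b ≡ a + b + c
    shuffle₁ = solve-∀
    shuffle₂ : ∀ a b c d → a + 2 * b + (c + d) ≡ a + 2 * b + d + c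
    shuffle₂ = solve-∀

shrink : ∀ {n q Λ Λ′} {G : Graph n} (P : Parts G q Λ) (B : Fin q → List (Fin n)) →
         (∀ i → Unique (B i)) → (∀ {i x} → x ∈ B i → x ∈ Parts.part P i) →
         (∀ i → Λ′ ≤ length (B i)) → Parts G q Λ′
shrink {Λ′ = Λ′} P B u sub len = record
  { part     = λ i → take Λ′ (B i)
  ; unique   = λ i → Uniqueₚ.take⁺ Λ′ (u i)
  ; card     = λ i → length-take-≤ Λ′ (B i) (len i)
  ; complete = λ i≢j x∈ y∈ → Parts.complete P i≢j (sub (∈-take⁻ Λ′ x∈)) (sub (∈-take⁻ Λ′ y∈))
  }

Parts-induced : ∀ {n q Λ} (G : Graph n) {xs : List (Fin n)} → Unique xs → Parts (induced G xs) q Λ → Parts G q Λ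
Parts-induced G {xs} u P = record
  { part     = λ i → map (lookup xs) (part i)
  ; unique   = λ i → Uniqueₚ.map⁺ (lookup-injective u) (unique i)
  ; card     = λ i → trans (Listₚ.length-map (lookup xs) (part i)) (card i)
  ; complete = λ i≢j x∈ y∈ → case (∈ₚ.∈-map⁻ (lookup xs) x∈ , ∈ₚ.∈-map⁻ (lookup xs) y∈) of λ
      { ((_ , x′∈ , refl) , (_ , y′∈ , refl)) → complete i≢j x′∈ y′∈ }
  }
  where open Parts P

∑-one-small : ∀ {q} (f : Fin q → ℕ) {Λ d} i → (∀ j → f j ≤ Λ) → f i ≤ d →
              ∑ (allFin q) f + Λ ≤ q * Λ + d
∑-one-small {q} f {Λ} {d} i f≤Λ fi≤d = begin
  ∑ (allFin q) f + Λ                                          ≡⟨ cong (∑ (allFin q) f +_) (sym (∑-δ-* i Λ)) ⟩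
  ∑ (allFin q) f + ∑[ j ← allFin q ] (𝟙 (j Finₚ.≟ i) * Λ)     ≡⟨ sym (∑-+ (allFin q) _ _) ⟩
  ∑[ j ← allFin q ] (f j + 𝟙 (j Finₚ.≟ i) * Λ)                ≤⟨ ∑-mono (allFin q) (λ {j} _ → term j) ⟩
  ∑[ j ← allFin q ] (Λ + 𝟙 (j Finₚ.≟ i) * d)                  ≡⟨ ∑-+ (allFin q) _ _ ⟩
  ∑[ j ← allFin q ] Λ + ∑[ j ← allFin q ] (𝟙 (j Finₚ.≟ i) * d) ≡⟨ cong₂ _+_ (∑-allFin-const q Λ) (∑-δ-* i d) ⟩
  q * Λ + d                                                   ∎
  where
  open ℕₚ.≤-Reasoning
  term : ∀ j → f j + 𝟙 (j Finₚ.≟ i) * Λ ≤ Λ + 𝟙 (j Finₚ.≟ i) * d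
  term j with j Finₚ.≟ i
  ... | yes refl = begin
    f j + (Λ + 0)   ≡⟨ trans (cong (f j +_) (ℕₚ.+-identityʳ Λ)) (ℕₚ.+-comm (f j) Λ) ⟩
    Λ + f j         ≤⟨ ℕₚ.+-monoʳ-≤ Λ fi≤d ⟩
    Λ + d           ≡⟨ cong (Λ +_) (sym (ℕₚ.+-identityʳ d)) ⟩
    Λ + (d + 0)     ∎
  ... | no _ = ℕₚ.+-monoˡ-≤ 0 (f≤Λ j)

-- The Erdős–Stone theorem

-- Halving the list once for every vertex of ks.
homogeneous : ∀ {n} (G : Graph n) (ks xs : List (Fin n)) {L} → Unique xs → L * 2 ℕ.^ length ks ≤ length xs →
  ∃[ ys ] Unique ys × (∀ {x} → x ∈ ys → x ∈ xs) × L ≤ length ys ×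
          (∀ {a} → a ∈ ks → (∀ {x} → x ∈ ys → Adj G x a) ⊎ (∀ {x} → x ∈ ys → ¬ Adj G x a))
homogeneous G [] xs {L} u le = xs , u , id , subst (_≤ length xs) (ℕₚ.*-identityʳ L) le , λ ()
homogeneous {n} G (a ∷ ks) xs {L} u le with L * 2 ℕ.^ length ks ℕ.≤? length (filter (λ x → adj? G x a) xs)
... | yes le′ with ys , u′ , sub , len , hom ← homogeneous G ks (filter (λ x → adj? G x a) xs) (Uniqueₚ.filter⁺ _ u) le′ =
  ys , u′ , proj₁ ∘ ∈ₚ.∈-filter⁻ (λ x → adj? G x a) ∘ sub , len , λ
    { (here refl) → inj₁ (proj₂ ∘ ∈ₚ.∈-filter⁻ (λ x → adj? G x a) {xs = xs} ∘ sub)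
    ; (there b∈) → hom b∈ }
... | no ≰ =
  let ys , u′ , sub , len , hom = homogeneous G ks (filter (λ x → ¬? (adj? G x a)) xs) (Uniqueₚ.filter⁺ _ u) le′ in
  ys , u′ , proj₁ ∘ ∈ₚ.∈-filter⁻ (λ x → ¬? (adj? G x a)) ∘ sub , len , λ
    { (here refl) → inj₂ (proj₂ ∘ ∈ₚ.∈-filter⁻ (λ x → ¬? (adj? G x a)) {xs = xs} ∘ sub)
    ; (there b∈) → hom b∈ }
  where
  total : length (filter (λ x → adj? G x a) xs) + length (filter (λ x → ¬? (adj? G x a)) xs) ≡ length xs
  total = begin
    length (filter (λ x → adj? G x a) xs) + length (filter (λ x → ¬? (adj? G x a)) xs)
      ≡⟨ cong₂ _+_ (length-filter (λ x → adj? G x a) xs) (length-filter (λ x → ¬? (adj? G x a)) xs) ⟩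
    ∑[ x ← xs ] 𝟙 (adj? G x a) + ∑[ x ← xs ] 𝟙 (¬? (adj? G x a))
      ≡⟨ sym (∑-+ xs _ _) ⟩
    ∑[ x ← xs ] (𝟙 (adj? G x a) + 𝟙 (¬? (adj? G x a)))
      ≡⟨ ∑-cong xs (λ {x} _ → 𝟙+𝟙¬ (adj? G x a) (¬? (adj? G x a)) (λ p ¬p → ¬p p) id) ⟩
    ∑[ x ← xs ] 1
      ≡⟨ trans (∑-const xs 1) (ℕₚ.*-identityʳ _) ⟩
    length xs ∎
    where open ≡-Reasoning
  double : L * (2 * 2 ℕ.^ length ks) ≡ L * 2 ℕ.^ length ks + L * 2 ℕ.^ length ks
  double = arith L (2 ℕ.^ length ks)
    where
    arith : ∀ l p → l * (2 * p) ≡ l * p + l * p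
    arith = solve-∀
  le′ : L * 2 ℕ.^ length ks ≤ length (filter (λ x → ¬? (adj? G x a)) xs)
  le′ = ℕₚ.≮⇒≥ (λ lt → ℕₚ.<⇒≱ (ℕₚ.+-mono-< (ℕₚ.≰⇒> ≰) lt)
          (subst₂ _≤_ double (sym total) le))

module _ {n q Λ : ℕ} {G : Graph n} (P : Parts G q Λ) (L : ℕ) where
  open Parts P

  rich? : ∀ x → Dec (∀ i → L ≤ deg G x (part i))
  rich? x = Finₚ.all? (λ i → L ℕ.≤? deg G x (part i))

  rich : List (Fin n)
  rich = filter rich? (allFin n)

  extend-parts : 1 ≤ L → L * 2 ℕ.^ (q * Λ) ≤ length rich → Parts G (suc q) L
  extend-parts (s≤s _) le
    with homogeneous G vertices rich {L} (Uniqueₚ.filter⁺ rich? (Uniqueₚ.allFin⁺ n))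
           (subst (λ m → L * 2 ℕ.^ m ≤ length rich) (sym length-vertices) le)
  ... | x ∷ ys , u , sub , len , hom = record
    { part     = part′
    ; unique   = λ { zero → Uniqueₚ.take⁺ L u ; (suc i) → Uniqueₚ.take⁺ L (Uniqueₚ.filter⁺ (adj? G x) (unique i)) }
    ; card     = λ { zero → length-take-≤ L (x ∷ ys) len
                   ; (suc i) → length-take-≤ L (filter (adj? G x) (part i)) (ℕₚ.≤-trans (proj₂ (∈ₚ.∈-filter⁻ rich? {xs = allFin n} (sub (here refl))) i)
                                                         (ℕₚ.≤-reflexive (sym (length-filter (adj? G x) (part i))))) }
    ; complete = complete′
    }
    where
    part′ : Fin (suc q) → List (Fin n)
    part′ zero    = take L (x ∷ ys)
    part′ (suc i) = take L (filter (adj? G x) (part i))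
    common : ∀ {i y z} → y ∈ part′ zero → z ∈ part′ (suc i) → Adj G y z
    common {i} y∈ z∈ with ∈ₚ.∈-filter⁻ (adj? G x) {xs = part i} (∈-take⁻ L z∈)
    ... | z∈i , x∼z with hom (∈-vertices z∈i)
    ... | inj₁ all  = all (∈-take⁻ L y∈)
    ... | inj₂ none = ⊥-elim (none (here refl) x∼z)
    complete′ : ∀ {i j x y} → i ≢ j → x ∈ part′ i → y ∈ part′ j → Adj G x y
    complete′ {zero}  {zero}  i≢j = ⊥-elim (i≢j refl)
    complete′ {zero}  {suc j} i≢j x∈ y∈ = common x∈ y∈
    complete′ {suc i} {zero}  i≢j x∈ y∈ = Graph.sym-∼ G (common y∈ x∈)
    complete′ {suc i} {suc j} i≢j x∈ y∈ = complete (i≢j ∘ cong suc)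
      (proj₁ (∈ₚ.∈-filter⁻ (adj? G x) (∈-take⁻ L x∈)))
      (proj₁ (∈ₚ.∈-filter⁻ (adj? G x) (∈-take⁻ L y∈)))

  ∑-deg-poor : 1 ≤ q → ∑[ x ← allFin n ] deg G x vertices + n * Λ ≤ n * (q * Λ + L) + q * Λ * length rich
  ∑-deg-poor 1≤q = begin
    ∑[ x ← allFin n ] deg G x vertices + n * Λ
      ≡⟨ cong ((∑[ x ← allFin n ] deg G x vertices) +_) (sym (∑-allFin-const n Λ)) ⟩
    ∑[ x ← allFin n ] deg G x vertices + ∑[ _ ← allFin n ] Λ
      ≡⟨ sym (∑-+ (allFin n) _ _) ⟩
    ∑[ x ← allFin n ] (deg G x vertices + Λ)
      ≤⟨ ∑-mono (allFin n) (λ {x} _ → term x) ⟩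
    ∑[ x ← allFin n ] (q * Λ + L + q * Λ * 𝟙 (rich? x))
      ≡⟨ trans (∑-+ (allFin n) _ _) (cong₂ _+_ (∑-allFin-const n _) (trans (∑-*ˡ (allFin n) (q * Λ) _)
           (cong (q * Λ *_) (sym (length-filter rich? (allFin n)))))) ⟩
    n * (q * Λ + L) + q * Λ * length rich ∎
    where
    open ℕₚ.≤-Reasoning
    term : ∀ x → deg G x vertices + Λ ≤ q * Λ + L + q * Λ * 𝟙 (rich? x)
    term x with rich? x
    ... | yes _ = begin
      deg G x vertices + Λ     ≤⟨ ℕₚ.+-mono-≤ (subst (deg G x vertices ≤_) length-vertices (deg≤length G x vertices))
                                              (ℕₚ.m≤n*m Λ q {{ℕ.>-nonZero 1≤q}}) ⟩
      q * Λ + q * Λ            ≤⟨ ℕₚ.+-monoˡ-≤ (q * Λ) (ℕₚ.m≤m+n (q * Λ) L) ⟩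
      q * Λ + L + q * Λ        ≡⟨ cong (q * Λ + L +_) (sym (ℕₚ.*-identityʳ (q * Λ))) ⟩
      q * Λ + L + q * Λ * 1    ∎
    ... | no poor with i , ≰ ← Finₚ.¬∀⟶∃¬ q _ (λ i → L ℕ.≤? deg G x (part i)) poor = begin
      deg G x vertices + Λ                              ≡⟨ cong (_+ Λ) (deg-vertices x) ⟩
      ∑[ i ← allFin q ] deg G x (part i) + Λ            ≤⟨ ∑-one-small _ i (deg-part≤ x) (ℕₚ.<⇒≤ (ℕₚ.≰⇒> ≰)) ⟩
      q * Λ + L                                         ≤⟨ ℕₚ.m≤m+n _ _ ⟩
      q * Λ + L + q * Λ * 0                             ∎

-- The density (2q₀-1)/(2q₀+1) lies strictly between those of the Turán graphs
-- with q₀ and with q₀+1 parts.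
Dense : ∀ {n} → ℕ → Graph n → Set
Dense {n} q₀ G = (2 * q₀ + 1) * (n * n) ≤ (2 * q₀ + 1) * size G + 2 * (n * n)

module _ (q₀ L c Λ M : ℕ) (c≡ : 2 * q₀ + 1 + 2 ≡ c) (Λ≡ : Λ ≡ c * L + 1) (M≡ : M ≡ suc q₀ * Λ) where

  private
    B cap Z need : ℕ
    B = q₀ * Λ + L
    cap = L * 2 ℕ.^ (suc q₀ * Λ)
    Z = M * cap
    need = suc (2 * c * Z + 2 * c * (M * B))

    1≤M : 1 ≤ M
    1≤M = subst (1 ≤_) (sym M≡) (ℕₚ.*-mono-≤ {1} {suc q₀} {1} {Λ} (s≤s z≤n) (subst (1 ≤_) (sym Λ≡) (ℕₚ.m≤n+m 1 (c * L))))

    weaken : ∀ n S {x} → c * (n * n) + x ≤ c * S + 2 * (n * n) → S ≤ n * n →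
             (2 * q₀ + 1) * (n * n) ≤ (2 * q₀ + 1) * S + 2 * (n * n)
    weaken n S {x} hyp S≤ = ≤-cancel (2 * (n * n) + x + 2 * S)
      (ℕₚ.+-mono-≤ (ℕₚ.+-mono-≤ (subst (λ c → c * (n * n) + x ≤ c * S + 2 * (n * n)) (sym c≡) hyp) (ℕₚ.*-monoʳ-≤ 2 S≤)) (z≤n {x}))
      (l (2 * q₀ + 1) (n * n) S x) (r (2 * q₀ + 1) (n * n) S x)
      where
      l : ∀ d a S x → d * a + (2 * a + x + 2 * S) ≡ (d + 2) * a + x + 2 * S + 0
      l = solve-∀
      r : ∀ d a S x → (d + 2) * S + 2 * a + 2 * a + x ≡ d * S + 2 * a + (2 * a + x + 2 * S)
      r = solve-∀

    balance : 2 * M + c * B + 1 ≡ c * M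
    balance = begin
      2 * M + c * (q₀ * Λ + L) + 1               ≡⟨ l M c (q₀ * Λ) L ⟩
      2 * M + (c * (q₀ * Λ) + (c * L + 1))       ≡⟨ cong (λ y → 2 * M + (c * (q₀ * Λ) + y)) (sym Λ≡) ⟩
      2 * M + (c * (q₀ * Λ) + Λ)                 ≡⟨ cong₂ (λ M c → 2 * M + (c * (q₀ * Λ) + Λ)) M≡ (sym c≡) ⟩
      2 * (suc q₀ * Λ) + ((2 * q₀ + 1 + 2) * (q₀ * Λ) + Λ)  ≡⟨ r q₀ Λ ⟩
      (2 * q₀ + 1 + 2) * (suc q₀ * Λ)            ≡⟨ sym (cong₂ (λ M c → c * M) M≡ (sym c≡)) ⟩
      c * M                                      ∎
      where
      open ≡-Reasoning
      l : ∀ M c x y → 2 * M + c * (x + y) + 1 ≡ 2 * M + (c * x + (c * y + 1))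
      l = solve-∀
      r : ∀ q₀ Λ → 2 * (suc q₀ * Λ) + ((2 * q₀ + 1 + 2) * (q₀ * Λ) + Λ) ≡ (2 * q₀ + 1 + 2) * (suc q₀ * Λ)
      r = solve-∀

    gain : ∀ n n′ S S′ D X {x} → M + n′ ≡ n → need ≤ 2 * n′ → X ≤ cap →
           c * (n * n) + x ≤ c * S + 2 * (n * n) → S ≤ S′ + 2 * D → D + n * Λ ≤ n * (Λ + B) + M * X →
           c * (n′ * n′) + suc x ≤ c * S′ + 2 * (n′ * n′)
    gain .(M + n′) n′ S S′ D X {x} refl large X≤ hyp S≤ D≤ = ≤-cancel
      (c * (2 * (n′ * M) + M * M) + c * S + 2 * c * (D + (M + n′) * Λ) + 2 * c * Z + 2 * c * (M * B) + 2 * n′ * (2 * M + c * B + 1))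
      (ℕₚ.+-mono-≤ (ℕₚ.+-mono-≤ (ℕₚ.+-mono-≤ (ℕₚ.+-mono-≤ (ℕₚ.+-mono-≤ hyp (ℕₚ.*-monoʳ-≤ c S≤))
        (ℕₚ.*-monoʳ-≤ (2 * c) (ℕₚ.≤-trans D≤ (ℕₚ.+-monoʳ-≤ ((M + n′) * (Λ + B)) (ℕₚ.*-monoʳ-≤ M X≤))))) large)
        (ℕₚ.≤-reflexive (cong (2 * n′ *_) balance))) (z≤n {(2 * q₀ + 1) * (M * M)}))
      (l c M n′ S D Λ B Z x)
      (subst (λ c → c * S + 2 * ((M + n′) * (M + n′)) + c * (S′ + 2 * D) + 2 * c * ((M + n′) * (Λ + B) + Z) + 2 * n′ + 2 * n′ * (c * M) + (2 * q₀ + 1) * (M * M) ≡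
          c * S′ + 2 * (n′ * n′) + (c * (2 * (n′ * M) + M * M) + c * S + 2 * c * (D + (M + n′) * Λ) + 2 * c * Z + 2 * c * (M * B) + 2 * n′ * (2 * M + c * B + 1)))
          c≡
          (r (2 * q₀ + 1) M n′ S S′ D Λ B Z))
      where
      l : ∀ c M n′ S D Λ B Z x →
          c * (n′ * n′) + suc x + (c * (2 * (n′ * M) + M * M) + c * S + 2 * c * (D + (M + n′) * Λ) + 2 * c * Z + 2 * c * (M * B) + 2 * n′ * (2 * M + c * B + 1)) ≡
          c * ((M + n′) * (M + n′)) + x + c * S + 2 * c * (D + (M + n′) * Λ) + suc (2 * c * Z + 2 * c * (M * B)) + 2 * n′ * (2 * M + c * B + 1) + 0
      l = solve-∀
      r : ∀ d M n′ S S′ D Λ B Z →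
          (d + 2) * S + 2 * ((M + n′) * (M + n′)) + (d + 2) * (S′ + 2 * D) + 2 * (d + 2) * ((M + n′) * (Λ + B) + Z) + 2 * n′ + 2 * n′ * ((d + 2) * M) + d * (M * M) ≡
          (d + 2) * S′ + 2 * (n′ * n′) + ((d + 2) * (2 * (n′ * M) + M * M) + (d + 2) * S + 2 * (d + 2) * (D + (M + n′) * Λ) + 2 * (d + 2) * Z + 2 * (d + 2) * (M * B) + 2 * n′ * (2 * M + (d + 2) * B + 1))
      r = solve-∀

  erdős-stone-step : 1 ≤ L →
    (∃[ N ] ∀ {n} → N ≤ n → (G : Graph n) → Dense q₀ G → Parts G (suc q₀) Λ) →
    ∃[ N ] ∀ {n} → N ≤ n → (G : Graph n) → c * (n * n) ≤ c * size G + 2 * (n * n) → Parts G (suc (suc q₀)) L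
  erdős-stone-step 1≤L (N₁ , find) = N , λ {n} N≤n G dense →
    proof (Parts G (suc (suc q₀)) L) (R G) (bound G) (step G) N≤n
      (G , id , subst (_≤ c * size G + 2 * (n * n)) (sym (ℕₚ.+-identityʳ _)) dense)
    where
    ind = progressive-induction (c + 2) M (N₁ + (M + need))
    N = proj₁ ind
    proof = proj₂ ind
    module _ {n₁} (G₁ : Graph n₁) where
      R : ℕ → ℕ → Set₁
      R n x = Σ[ G ∈ Graph n ] (Parts G (suc (suc q₀)) L → Parts G₁ (suc (suc q₀)) L) × c * (n * n) + x ≤ c * size G + 2 * (n * n)
      bound : ∀ {n x} → R n x → x ≤ (c + 2) * (n * n)
      bound {n} {x} (G , _ , hyp) = begin
        x                               ≤⟨ ℕₚ.m≤n+m x _ ⟩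
        c * (n * n) + x                 ≤⟨ hyp ⟩
        c * size G + 2 * (n * n)        ≤⟨ ℕₚ.+-monoˡ-≤ _ (ℕₚ.*-monoʳ-≤ c (size≤ G)) ⟩
        c * (n * n) + 2 * (n * n)       ≡⟨ sym (ℕₚ.*-distribʳ-+ (n * n) c 2) ⟩
        (c + 2) * (n * n)               ∎
        where open ℕₚ.≤-Reasoning
      step : ∀ {n x} → N₁ + (M + need) ≤ n → R n x →
             Parts G₁ (suc (suc q₀)) L ⊎ (∃[ n′ ] n′ < n × n ≤ n′ + M × R n′ (suc x))
      step {n} {x} n≥ (G , lift , hyp) = decide (cap ℕ.≤? length (rich P L))
        where
        P : Parts G (suc q₀) Λ
        P = find (ℕₚ.≤-trans (ℕₚ.m≤m+n N₁ _) n≥) G (weaken n (size G) hyp (size≤ G))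
        open Parts P
        n′ = length (rest vertices)
        M+n′ : M + n′ ≡ n
        M+n′ = trans (cong (_+ n′) M≡) length-remainder
        large : need ≤ 2 * n′
        large = ℕₚ.≤-trans (ℕₚ.+-cancelˡ-≤ M need n′ (ℕₚ.≤-trans (ℕₚ.m≤n+m _ N₁) (subst (N₁ + (M + need) ≤_) (sym M+n′) n≥)))
                           (ℕₚ.m≤m+n n′ (n′ + 0))
        loss : size G ≤ size remainder + 2 * ∑[ x ← allFin n ] deg G x vertices
        loss = subst (size G ≤_) (size-remove G vertices-unique) (ℕₚ.m≤m+n (size G) _)
        poor : ∑[ x ← allFin n ] deg G x vertices + n * Λ ≤ n * (Λ + B) + M * length (rich P L)
        poor = subst₂ (λ a m → ∑[ x ← allFin n ] deg G x vertices + n * Λ ≤ n * a + m * length (rich P L))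
                 (ℕₚ.+-assoc Λ (q₀ * Λ) L) (sym M≡) (∑-deg-poor P L (s≤s z≤n))
        decide : Dec (cap ≤ length (rich P L)) →
                 Parts G₁ (suc (suc q₀)) L ⊎ (∃[ n′ ] n′ < n × n ≤ n′ + M × R n′ (suc x))
        decide (yes le) = inj₁ (lift (extend-parts P L 1≤L le))
        decide (no ≰) = inj₂ (n′ , subst (n′ <_) M+n′ (ℕₚ.m<n+m n′ 1≤M)
                        , ℕₚ.≤-reflexive (trans (sym M+n′) (ℕₚ.+-comm M n′))
                        , remainder , lift ∘ Parts-induced G (Unique-rest vertices)
                        , gain n n′ (size G) (size remainder) (∑[ x ← allFin n ] deg G x vertices) (length (rich P L)) M+n′ large
                            (ℕₚ.<⇒≤ (ℕₚ.≰⇒> ≰)) hyp loss poor)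

erdős-stone : ∀ q₀ L → 1 ≤ L → ∃[ N ] ∀ {n} → N ≤ n → (G : Graph n) → Dense q₀ G → Parts G (suc q₀) L
erdős-stone zero L 1≤L = L , λ {n} L≤n G _ → record
  { part     = λ _ → take L (allFin n)
  ; unique   = λ _ → Uniqueₚ.take⁺ L (Uniqueₚ.allFin⁺ n)
  ; card     = λ _ → length-take-≤ L (allFin n) (subst (L ≤_) (sym (length-allFin n)) L≤n)
  ; complete = λ { {zero} {zero} i≢j → ⊥-elim (i≢j refl) }
  }
erdős-stone (suc q₀) L 1≤L = erdős-stone-step q₀ L _ _ _ (c≡ q₀) refl refl 1≤L (erdős-stone q₀ _ (ℕₚ.m≤n+m 1 _))
  where
  c≡ : ∀ q₀ → 2 * q₀ + 1 + 2 ≡ 2 * suc q₀ + 1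
  c≡ = solve-∀

Unique-resp-↭ : ∀ {A : Set} {xs ys : List A} → xs ↭ ys → Unique xs → Unique ys
Unique-resp-↭ {A} p = ↭ₛₚ.Unique-resp-↭ (setoid A) (↭⇒↭ₛ p)

∑-𝟙-∈ : ∀ {n} {xs : List (Fin n)} → Unique xs → ∀ ys → ∑[ x ← xs ] 𝟙 (x ∈? ys) ≤ length ys
∑-𝟙-∈ {xs = xs} u []       = ℕₚ.≤-reflexive (trans (∑-const xs 0) (ℕₚ.*-zeroʳ (length xs)))
∑-𝟙-∈ {xs = xs} u (y ∷ ys) = begin
  ∑[ x ← xs ] 𝟙 (x ∈? (y ∷ ys))                        ≤⟨ ∑-mono xs (λ {x} _ → term x) ⟩
  ∑[ x ← xs ] (𝟙 (x Finₚ.≟ y) + 𝟙 (x ∈? ys))           ≡⟨ ∑-+ xs _ _ ⟩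
  ∑[ x ← xs ] 𝟙 (x Finₚ.≟ y) + ∑[ x ← xs ] 𝟙 (x ∈? ys) ≤⟨ ℕₚ.+-mono-≤ δ≤1 (∑-𝟙-∈ u ys) ⟩
  1 + length ys                                        ∎
  where
  open ℕₚ.≤-Reasoning
  δ≤1 : ∑[ x ← xs ] 𝟙 (x Finₚ.≟ y) ≤ 1
  δ≤1 with y ∈? xs
  ... | yes y∈ = ℕₚ.≤-reflexive (∑-δ-unique u y∈)
  ... | no  y∉ = ℕₚ.≤-trans (ℕₚ.≤-reflexive (∑-δ-∉ xs y∉)) z≤n
  term′ : ∀ {x} (d : Dec (x ≡ y)) (d′ : Dec (x ∈ y ∷ ys)) → 𝟙 d′ ≤ 𝟙 d + 𝟙 (x ∈? ys)
  term′     (yes _)  d′ = ℕₚ.≤-trans (𝟙≤1 d′) (s≤s z≤n)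
  term′ {x} (no x≢y) d′ = 𝟙-mono d′ (x ∈? ys) λ { (here eq) → ⊥-elim (x≢y eq) ; (there x∈) → x∈ }
  term : ∀ x → 𝟙 (x ∈? (y ∷ ys)) ≤ 𝟙 (x Finₚ.≟ y) + 𝟙 (x ∈? ys)
  term x = term′ (x Finₚ.≟ y) (x ∈? (y ∷ ys))

length-filter-∉ : ∀ {n} {xs : List (Fin n)} → Unique xs → ∀ ys →
                  length xs ≤ length (filter (λ x → ¬? (x ∈? ys)) xs) + length ys
length-filter-∉ {xs = xs} u ys = begin
  length xs
    ≡⟨ sym (trans (∑-const xs 1) (ℕₚ.*-identityʳ _)) ⟩
  ∑[ _ ← xs ] 1
    ≡⟨ ∑-cong xs (λ {x} _ → sym (𝟙+𝟙¬ (¬? (x ∈? ys)) (x ∈? ys) id (λ ¬¬p → case x ∈? ys of λ { (yes p) → p ; (no ¬p) → ⊥-elim (¬¬p ¬p) }))) ⟩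
  ∑[ x ← xs ] (𝟙 (¬? (x ∈? ys)) + 𝟙 (x ∈? ys))
    ≡⟨ ∑-+ xs _ _ ⟩
  ∑[ x ← xs ] 𝟙 (¬? (x ∈? ys)) + ∑[ x ← xs ] 𝟙 (x ∈? ys)
    ≤⟨ ℕₚ.+-mono-≤ (ℕₚ.≤-reflexive (sym (length-filter (λ x → ¬? (x ∈? ys)) xs))) (∑-𝟙-∈ u ys) ⟩
  length (filter (λ x → ¬? (x ∈? ys)) xs) + length ys ∎
  where open ℕₚ.≤-Reasoning

fresh : ∀ {n} {xs : List (Fin n)} → Unique xs → ∀ ys → length ys < length xs → ∃[ x ] x ∈ xs × x ∉ ys
fresh {xs = xs} u ys lt with filter (λ x → ¬? (x ∈? ys)) xs in eq | length-filter-∉ u ys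
... | []    | le = ⊥-elim (ℕₚ.<⇒≱ lt le)
... | x ∷ _ | _  = x , ∈ₚ.∈-filter⁻ (λ x → ¬? (x ∈? ys)) (subst (x ∈_) (sym eq) (here refl))

length-filter-all : ∀ {A B : Set} {R : B → A → Set} (R? : ∀ z a → Dec (R z a)) (zs : List B) (xs : List A) w →
  (∀ {z} → z ∈ zs → length xs ≤ ∑[ a ← xs ] 𝟙 (R? z a) + w) →
  length xs ≤ length (filter (λ a → All.all? (λ z → R? z a) zs) xs) + length zs * w
length-filter-all {R = R} R? zs xs w few =
  subst (λ m → length xs ≤ m + length zs * w) (sym (length-filter (λ a → All.all? (λ z → R? z a) zs) xs)) (go zs few)
  where
  all : ∀ zs a → Dec (All (λ z → R z a) zs)
  all zs a = All.all? (λ z → R? z a) zs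
  both : ∀ z zs a → 𝟙 (R? z a) + 𝟙 (all zs a) ≤ 𝟙 (all (z ∷ zs) a) + 1
  both z zs a with R? z a | all zs a | all (z ∷ zs) a
  ... | yes r | yes rs | yes _ = ℕₚ.≤-refl
  ... | yes r | yes rs | no ¬rs = ⊥-elim (¬rs (r ∷ rs))
  ... | yes r | no _   | d = ℕₚ.m≤n+m 1 (𝟙 d)
  ... | no _  | yes _  | d = ℕₚ.m≤n+m 1 (𝟙 d)
  ... | no _  | no _   | d = z≤n
  go : ∀ zs → (∀ {z} → z ∈ zs → length xs ≤ ∑[ a ← xs ] 𝟙 (R? z a) + w) →
       length xs ≤ ∑[ a ← xs ] 𝟙 (all zs a) + length zs * w
  go [] few = ℕₚ.≤-reflexive (sym (trans (ℕₚ.+-identityʳ _) (trans (∑-const xs 1) (ℕₚ.*-identityʳ _))))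
  go (z ∷ zs) few = ≤-cancel (∑[ a ← xs ] 𝟙 (R? z a) + ∑[ a ← xs ] 𝟙 (all zs a) + length xs)
    (ℕₚ.+-mono-≤ (ℕₚ.+-mono-≤ (few (here refl)) (go zs (few ∘ there)))
      (subst₂ _≤_ (∑-+ xs _ _) (trans (∑-+ xs _ _) (cong ((∑[ a ← xs ] 𝟙 (all (z ∷ zs) a)) +_) (trans (∑-const xs 1) (ℕₚ.*-identityʳ (length xs)))))
        (∑-mono xs (λ {a} _ → both z zs a))))
    (l (length xs) (∑[ a ← xs ] 𝟙 (R? z a)) (∑[ a ← xs ] 𝟙 (all zs a)))
    (r (∑[ a ← xs ] 𝟙 (R? z a)) w (∑[ a ← xs ] 𝟙 (all zs a)) (length zs * w) (∑[ a ← xs ] 𝟙 (all (z ∷ zs) a)) (length xs))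
    where
    l : ∀ x r s → x + (r + s + x) ≡ x + x + (r + s)
    l = solve-∀
    r : ∀ r w s zw t x → r + w + (s + zw) + (t + x) ≡ t + (w + zw) + (r + s + x)
    r = solve-∀

endpoints : ∀ {A : Set} → List (A × A) → List A
endpoints []             = []
endpoints ((x , y) ∷ ps) = x ∷ y ∷ endpoints ps

length-endpoints : ∀ {A : Set} (ps : List (A × A)) → length (endpoints ps) ≡ 2 * length ps
length-endpoints []       = refl
length-endpoints (p ∷ ps) = trans (cong (2 +_) (length-endpoints ps)) (arith (length ps))
  where
  arith : ∀ a → 2 + 2 * a ≡ 2 * suc a
  arith = solve-∀

side : ∀ {A : Set} → Bool → A × A → A
side b (x , y) = if b then x else y

side∈endpoints : ∀ {A : Set} (ps : List (A × A)) j b → side b (lookup ps j) ∈ endpoints ps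
side∈endpoints (p ∷ ps) zero    true  = here refl
side∈endpoints (p ∷ ps) zero    false = there (here refl)
side∈endpoints (p ∷ ps) (suc j) b     = there (there (side∈endpoints ps j b))

side-injective : ∀ {A : Set} {ps : List (A × A)} → Unique (endpoints ps) → ∀ {i b j c} →
                 side b (lookup ps i) ≡ side c (lookup ps j) → (i , b) ≡ (j , c)
side-injective {ps = _ ∷ _}  _ {zero}  {true}  {zero}  {true}  eq = refl
side-injective {ps = _ ∷ _}  _ {zero}  {false} {zero}  {false} eq = refl
side-injective {ps = _ ∷ _}  ((x≢y ∷ _) ∷ _) {zero} {true}  {zero} {false} eq = ⊥-elim (x≢y eq)
side-injective {ps = _ ∷ _}  ((x≢y ∷ _) ∷ _) {zero} {false} {zero} {true}  eq = ⊥-elim (x≢y (sym eq))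
side-injective {ps = _ ∷ ps} ((_ ∷ ne) ∷ _ ∷ _) {zero} {true}  {suc j} {c} eq = ⊥-elim (All.lookup ne (side∈endpoints ps j c) eq)
side-injective {ps = _ ∷ ps} (_ ∷ ne ∷ _)       {zero} {false} {suc j} {c} eq = ⊥-elim (All.lookup ne (side∈endpoints ps j c) eq)
side-injective {ps = _ ∷ ps} ((_ ∷ ne) ∷ _ ∷ _) {suc i} {b} {zero} {true}  eq = ⊥-elim (All.lookup ne (side∈endpoints ps i b) (sym eq))
side-injective {ps = _ ∷ ps} (_ ∷ ne ∷ _)       {suc i} {b} {zero} {false} eq = ⊥-elim (All.lookup ne (side∈endpoints ps i b) (sym eq))
side-injective {ps = _ ∷ ps} (_ ∷ _ ∷ u) {suc i} {b} {suc j} {c} eq with side-injective u {i} {b} {j} {c} eq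
... | refl = refl

-- A proper colouring of F minus t disjoint edges, all of whose ends have colour zero.
-- The ends are tagged with the index of their edge and a side.
record AlmostColouring {k : ℕ} (F : Graph k) (q t : ℕ) : Set where
  field
    colour : Fin k → Fin (suc q) ⊎ (Fin t × Bool)
    proper : ∀ {u v c d} → Adj F u v → colour u ≡ inj₁ c → colour v ≡ inj₁ d → c ≢ d
    proper₀ : ∀ {u v c z} → Adj F u v → colour u ≡ inj₁ c → colour v ≡ inj₂ z → c ≢ zero
    matched : ∀ {u v i b j c} → Adj F u v → colour u ≡ inj₂ (i , b) → colour v ≡ inj₂ (j , c) → i ≡ j × b ≢ c
    injective₂ : ∀ {u v z} → colour u ≡ inj₂ z → colour v ≡ inj₂ z → u ≡ v

module _ {k q t : ℕ} {F : Graph k} (A : AlmostColouring F q t)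
         {n Λ : ℕ} {G : Graph n} (P : Parts G (suc q) Λ) (i₀ : Fin (suc q)) (w : ℕ)
         (large : k + 2 * t * suc w ≤ Λ) where
  open AlmostColouring A
  open Parts P

  NearFull : Fin n → Set
  NearFull z = ∀ i → i ≢ i₀ → Λ ≤ deg G z (part i) + w

  embed : (ps : List (Fin n × Fin n)) → length ps ≡ t → All (λ (x , y) → Adj G x y) ps →
          Unique (endpoints ps) → All NearFull (endpoints ps) → Contains G F
  embed ps refl adj uniq near = f , inj , hom
    where
    zs = endpoints ps
    π : Perm.Permutation (suc q) (suc q)
    π = Perm.transpose zero i₀
    σ : Fin (suc q) → Fin (suc q)
    σ = Inverse.to π
    σ-injective : ∀ {c d} → σ c ≡ σ d → c ≡ d
    σ-injective = Injection.injective (↔⇒↣ π)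
    Good : Fin (suc q) → Fin n → Fin n → Set
    Good i z a = (i ≡ i₀ × a ≢ z) ⊎ (i ≢ i₀ × Adj G z a)
    good? : ∀ i z a → Dec (Good i z a)
    good? i z a = ((i Finₚ.≟ i₀) ×-dec ¬? (a Finₚ.≟ z)) ⊎-dec (¬? (i Finₚ.≟ i₀) ×-dec adj? G z a)
    few : ∀ i {z} → z ∈ zs → length (part i) ≤ ∑[ a ← part i ] 𝟙 (good? i z a) + suc w
    few i {z} z∈ = few′ (i Finₚ.≟ i₀)
      where
      open ℕₚ.≤-Reasoning
      few′ : Dec (i ≡ i₀) → length (part i) ≤ ∑[ a ← part i ] 𝟙 (good? i z a) + suc w
      few′ (yes i≡i₀) = begin
        length (part i)                                                      ≤⟨ length-filter-∉ (unique i) (z ∷ []) ⟩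
        length (filter (λ a → ¬? (a ∈? (z ∷ []))) (part i)) + 1              ≡⟨ cong (_+ 1) (length-filter (λ a → ¬? (a ∈? (z ∷ []))) (part i)) ⟩
        ∑[ a ← part i ] 𝟙 (¬? (a ∈? (z ∷ []))) + 1                          ≤⟨ ℕₚ.+-mono-≤ (∑-mono (part i) (λ {a} _ → 𝟙-mono (¬? (a ∈? (z ∷ []))) (good? i z a) (λ a∉ → inj₁ (i≡i₀ , a∉ ∘ here)))) (s≤s z≤n) ⟩
        ∑[ a ← part i ] 𝟙 (good? i z a) + suc w                              ∎
      few′ (no i≢i₀) = begin
        length (part i)                              ≡⟨ card i ⟩
        Λ                                            ≤⟨ All.lookup near z∈ i i≢i₀ ⟩
        deg G z (part i) + w                         ≤⟨ ℕₚ.+-mono-≤ (∑-mono (part i) (λ {a} _ → 𝟙-mono (adj? G z a) (good? i z a) (λ za → inj₂ (i≢i₀ , za)))) (ℕₚ.n≤1+n w) ⟩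
        ∑[ a ← part i ] 𝟙 (good? i z a) + suc w      ∎
    allGood? : ∀ i a → Dec (All (λ z → Good i z a) zs)
    allGood? i a = All.all? (λ z → good? i z a) zs
    B : Fin (suc q) → List (Fin n)
    B i = filter (allGood? i) (part i)
    k≤B : ∀ i → k ≤ length (B i)
    k≤B i = ℕₚ.+-cancelʳ-≤ (2 * t * suc w) k (length (B i)) (begin
      k + 2 * t * suc w                    ≤⟨ large ⟩
      Λ                                    ≡⟨ sym (card i) ⟩
      length (part i)                      ≤⟨ length-filter-all (good? i) zs (part i) (suc w) (few i) ⟩
      length (B i) + length zs * suc w     ≡⟨ cong (λ m → length (B i) + m * suc w) (length-endpoints ps) ⟩
      length (B i) + 2 * t * suc w         ∎)
      where open ℕₚ.≤-Reasoning
    f′ : Fin k → Fin (suc q) ⊎ (Fin t × Bool) → Fin n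
    f′ v (inj₁ c)       = lookup (B (σ c)) (Fin.inject≤ v (k≤B (σ c)))
    f′ v (inj₂ (j , b)) = side b (lookup ps j)
    f : Fin k → Fin n
    f v = f′ v (colour v)
    ∈B : ∀ v c → f′ v (inj₁ c) ∈ part (σ c) × All (λ z → Good (σ c) z (f′ v (inj₁ c))) zs
    ∈B v c = ∈ₚ.∈-filter⁻ (allGood? (σ c)) (∈ₚ.∈-lookup {xs = B (σ c)} (Fin.inject≤ v (k≤B (σ c))))
    good : ∀ v c j b → Good (σ c) (side b (lookup ps j)) (f′ v (inj₁ c))
    good v c j b = All.lookup (proj₂ (∈B v c)) (side∈endpoints ps j b)
    ≢bad : ∀ v c j b → f′ v (inj₁ c) ≢ side b (lookup ps j)
    ≢bad v c j b eq with good v c j b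
    ... | inj₁ (_ , ne)  = ne eq
    ... | inj₂ (_ , adj) = Graph.irrefl G (sym eq) adj
    inj′ : ∀ u v κ κ′ → colour u ≡ κ → colour v ≡ κ′ → f′ u κ ≡ f′ v κ′ → u ≡ v
    inj′ u v (inj₁ c) (inj₁ d) _ _ eq with c Finₚ.≟ d
    ... | yes refl = Finₚ.inject≤-injective (k≤B (σ c)) (k≤B (σ c)) u v
                       (lookup-injective (Uniqueₚ.filter⁺ (allGood? (σ c)) (unique (σ c))) eq)
    ... | no c≢d   = ⊥-elim (disjoint (c≢d ∘ σ-injective) (proj₁ (∈B u c))
                       (subst (_∈ part (σ d)) (sym eq) (proj₁ (∈B v d))))
    inj′ u v (inj₁ c) (inj₂ (j , b)) _ _ eq = ⊥-elim (≢bad u c j b eq)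
    inj′ u v (inj₂ (j , b)) (inj₁ c) _ _ eq = ⊥-elim (≢bad v c j b (sym eq))
    inj′ u v (inj₂ (i , b)) (inj₂ (j , c)) p p′ eq with side-injective uniq {i} {b} {j} {c} eq
    ... | refl = injective₂ p p′
    inj : Injective _≡_ _≡_ f
    inj {u} {v} eq = inj′ u v (colour u) (colour v) refl refl eq
    matchedAdj : ∀ {ps : List (Fin n × Fin n)} → All (λ (x , y) → Adj G x y) ps → ∀ j {b c} → b ≢ c →
                 Adj G (side b (lookup ps j)) (side c (lookup ps j))
    matchedAdj (a ∷ _)  zero    {true}  {true}  b≢c = ⊥-elim (b≢c refl)
    matchedAdj (a ∷ _)  zero    {true}  {false} b≢c = a
    matchedAdj (a ∷ _)  zero    {false} {true}  b≢c = Graph.sym-∼ G a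
    matchedAdj (a ∷ _)  zero    {false} {false} b≢c = ⊥-elim (b≢c refl)
    matchedAdj (_ ∷ as) (suc j) b≢c = matchedAdj as j b≢c
    mixed : ∀ {u v c j b} → Adj F u v → colour u ≡ inj₁ c → colour v ≡ inj₂ (j , b) →
            Adj G (f′ u (inj₁ c)) (f′ v (inj₂ (j , b)))
    mixed {u} {v} {c} {j} {b} uv p p′ with good u c j b
    ... | inj₁ (σc≡i₀ , _) = ⊥-elim (proper₀ uv p p′ (σ-injective σc≡i₀))
    ... | inj₂ (_ , adj)   = Graph.sym-∼ G adj
    hom′ : ∀ u v κ κ′ → Adj F u v → colour u ≡ κ → colour v ≡ κ′ → Adj G (f′ u κ) (f′ v κ′)
    hom′ u v (inj₁ c) (inj₁ d) uv p p′ = complete (proper uv p p′ ∘ σ-injective) (proj₁ (∈B u c)) (proj₁ (∈B v d))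
    hom′ u v (inj₁ c) (inj₂ _) uv p p′ = mixed uv p p′
    hom′ u v (inj₂ _) (inj₁ c) uv p p′ = Graph.sym-∼ G (mixed (Graph.sym-∼ F uv) p′ p)
    hom′ u v (inj₂ (i , b)) (inj₂ (j , c)) uv p p′ with matched uv p p′
    ... | refl , b≢c = matchedAdj adj i b≢c
    hom : ∀ u v → Adj F u v → Adj G (f u) (f v)
    hom u v uv = hom′ u v (colour u) (colour v) uv refl refl

  embed-apex : (zs : List (Fin n)) (ps : List (Fin n × Fin n)) → length zs + length ps ≡ t →
               Unique (zs ++ endpoints ps) → (∀ {z} → z ∈ zs → ∀ {i y} → y ∈ part i → Adj G z y) →
               All (λ (x , y) → Adj G x y) ps → All NearFull (endpoints ps) → Contains G F
  embed-apex []       ps len u full adj near = embed ps len adj u near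
  embed-apex (z ∷ zs) ps len (z∉ ∷ u) full adj near = extend (fresh (unique i₀) (endpoints ps) 2ps<Λ)
    where
    open ℕₚ.≤-Reasoning
    2ps<Λ : length (endpoints ps) < length (part i₀)
    2ps<Λ = begin-strict
      length (endpoints ps)    ≡⟨ length-endpoints ps ⟩
      2 * length ps            <⟨ ℕₚ.*-monoʳ-< 2 (subst (length ps <_) len (s≤s (ℕₚ.m≤n+m (length ps) (length zs)))) ⟩
      2 * t                    ≤⟨ ℕₚ.m≤m*n (2 * t) (suc w) ⟩
      2 * t * suc w            ≤⟨ ℕₚ.m≤n+m _ k ⟩
      k + 2 * t * suc w        ≤⟨ large ⟩
      Λ                        ≡⟨ sym (card i₀) ⟩
      length (part i₀)         ∎
    extend : ∃[ y ] y ∈ part i₀ × y ∉ endpoints ps → Contains G F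
    extend (y , y∈ , y∉) = embed-apex zs ((z , y) ∷ ps) (trans (ℕₚ.+-suc (length zs) (length ps)) len)
      (Unique-resp-↭ shuffle ((z≢y ∷ z∉) ∷ (All.tabulate y≢ ∷ u)))
      (full ∘ there) (full (here refl) y∈ ∷ adj)
      ((λ i _ → ℕₚ.≤-trans (ℕₚ.≤-reflexive (sym (full⇒deg (full (here refl))))) (ℕₚ.m≤m+n _ w)) ∷
       (λ i i≢i₀ → ℕₚ.≤-trans (ℕₚ.≤-reflexive (sym (full⇒deg (complete (i≢i₀ ∘ sym) y∈)))) (ℕₚ.m≤m+n _ w)) ∷ near)
      where
      z≢y : z ≢ y
      z≢y refl = Graph.irrefl G refl (full (here refl) y∈)
      y≢ : ∀ {x} → x ∈ zs ++ endpoints ps → y ≢ x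
      y≢ x∈ refl with ∈ₚ.∈-++⁻ zs x∈
      ... | inj₁ y∈zs = Graph.irrefl G refl (full (there y∈zs) y∈)
      ... | inj₂ y∈ps = y∉ y∈ps
      shuffle : z ∷ y ∷ (zs ++ endpoints ps) ↭ zs ++ z ∷ y ∷ endpoints ps
      shuffle = ↭-sym (↭-trans (↭ₚ.shift z zs (y ∷ endpoints ps)) (_↭_.prep z (↭ₚ.shift y zs (endpoints ps))))

matching-or-cover : ∀ {n} {R : Fin n → Fin n → Set} (R? : ∀ x y → Dec (R x y)) → (∀ {x y} → R x y → x ≢ y) → ∀ τ →
  (∃[ ps ] length ps ≡ τ × All (λ (x , y) → R x y) ps × Unique (endpoints ps)) ⊎
  (∃[ vs ] 2 + length vs ≤ 2 * τ × (∀ {x y} → R x y → x ∈ vs ⊎ y ∈ vs))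
matching-or-cover R? R⇒≢ zero = inj₁ ([] , refl , [] , [])
matching-or-cover {R = R} R? R⇒≢ (suc τ) with matching-or-cover R? R⇒≢ τ
... | inj₂ (vs , short , cover) = inj₂ (vs , ℕₚ.≤-trans short (ℕₚ.*-monoʳ-≤ 2 (ℕₚ.n≤1+n τ)) , cover)
... | inj₁ (ps , len , Rs , u)
    with Finₚ.any? (λ x → Finₚ.any? (λ y → R? x y ×-dec ¬? (x ∈? endpoints ps) ×-dec ¬? (y ∈? endpoints ps)))
... | yes (x , y , r , x∉ , y∉) = inj₁ ((x , y) ∷ ps , cong suc len , r ∷ Rs ,
        (R⇒≢ r ∷ All.tabulate (λ z∈ x≡z → x∉ (subst (_∈ endpoints ps) (sym x≡z) z∈))) ∷
        All.tabulate (λ z∈ y≡z → y∉ (subst (_∈ endpoints ps) (sym y≡z) z∈)) ∷ u)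
... | no none = inj₂ (endpoints ps , ℕₚ.≤-reflexive (trans (cong (2 +_) (trans (length-endpoints ps) (cong (2 *_) len))) (arith τ)) , cover)
  where
  arith : ∀ a → 2 + 2 * a ≡ 2 * suc a
  arith = solve-∀
  cover : ∀ {x y} → R x y → x ∈ endpoints ps ⊎ y ∈ endpoints ps
  cover {x} {y} r with x ∈? endpoints ps | y ∈? endpoints ps
  ... | yes x∈ | _      = inj₁ x∈
  ... | no _   | yes y∈ = inj₂ y∈
  ... | no x∉  | no y∉  = ⊥-elim (none (x , y , r , x∉ , y∉))

∑-two-small : ∀ {q} (f : Fin q → ℕ) {Λ d ℓ} i j → i ≢ j → (∀ c → f c ≤ Λ) → f i ≤ d → f j + ℓ ≤ Λ →
              ∑ (allFin q) f + ℓ + Λ ≤ q * Λ + d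
∑-two-small {q} f {Λ} {d} {ℓ} i j i≢j f≤Λ fi≤d fj+ℓ≤Λ =
  subst (λ s → s + Λ ≤ q * Λ + d) (trans (∑-+ (allFin q) _ _) (cong (∑ (allFin q) f +_) (∑-δ-* j ℓ)))
    (∑-one-small (λ c → f c + 𝟙 (c Finₚ.≟ j) * ℓ) i bounded small)
  where
  bounded : ∀ c → f c + 𝟙 (c Finₚ.≟ j) * ℓ ≤ Λ
  bounded c with c Finₚ.≟ j
  ... | yes refl = subst (_≤ Λ) (cong (f c +_) (sym (ℕₚ.+-identityʳ ℓ))) fj+ℓ≤Λ
  ... | no _     = subst (_≤ Λ) (sym (ℕₚ.+-identityʳ (f c))) (f≤Λ c)
  small : f i + 𝟙 (i Finₚ.≟ j) * ℓ ≤ d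
  small with i Finₚ.≟ j
  ... | yes i≡j = ⊥-elim (i≢j i≡j)
  ... | no _    = subst (_≤ d) (sym (ℕₚ.+-identityʳ (f i))) fi≤d

∑-take≤ : ∀ {A : Set} m (xs : List A) (f : A → ℕ) → ∑ (take m xs) f ≤ ∑ xs f
∑-take≤ zero    xs       f = z≤n
∑-take≤ (suc m) []       f = z≤n
∑-take≤ (suc m) (x ∷ xs) f = ℕₚ.+-monoʳ-≤ (f x) (∑-take≤ m xs f)

∑-filter≤ : ∀ {A : Set} {Q : A → Set} (Q? : ∀ x → Dec (Q x)) (xs : List A) (f : A → ℕ) → ∑ (filter Q? xs) f ≤ ∑ xs f
∑-filter≤ Q? []       f = z≤n
∑-filter≤ Q? (x ∷ xs) f with Q? x
... | yes _ = ℕₚ.+-monoʳ-≤ (f x) (∑-filter≤ Q? xs f)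
... | no  _ = ℕₚ.≤-trans (∑-filter≤ Q? xs f) (ℕₚ.m≤n+m _ (f x))

All-endpoints : ∀ {A : Set} {Q : A → Set} {ps : List (A × A)} → All (λ (x , y) → Q x × Q y) ps → All Q (endpoints ps)
All-endpoints []              = []
All-endpoints ((p , p′) ∷ ps) = p ∷ p′ ∷ All-endpoints ps

module _ {k q t : ℕ} {F : Graph k} (A : AlmostColouring F q t) {n : ℕ} {G : Graph n} (free : Free F G) where

  record Apexes {Λ} (P : Parts G (suc q) Λ) (i : ℕ) : Set where
    field
      apexes : List (Fin n)
      distinct : Unique apexes
      number : length apexes + i ≡ t
      full   : ∀ {z} → z ∈ apexes → ∀ {c y} → y ∈ Parts.part P c → Adj G z y

  apex-search : (lad : ℕ → ℕ) → k + 2 * t * 1 ≤ lad 0 → ∀ i (P : Parts G (suc q) (lad i)) → Apexes P i →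
    ∃[ j ] j < i × Σ[ P ∈ Parts G (suc q) (lad (suc j)) ] Σ[ Z ∈ Apexes P (suc j) ]
      (∀ {x} → x ∉ Apexes.apexes Z → ∃[ c ] deg G x (Parts.part P c) < lad j)
  apex-search lad large zero P Z = ⊥-elim (free (embed-apex A P zero 0 large apexes []
      number (subst Unique (sym (Listₚ.++-identityʳ apexes)) distinct) full [] []))
    where open Apexes Z
  apex-search lad large (suc i) P Z
    with Finₚ.any? (λ x → ¬? (x ∈? Apexes.apexes Z) ×-dec Finₚ.all? (λ c → lad i ℕ.≤? deg G x (Parts.part P c)))
  ... | no none = i , ℕₚ.n<1+n i , P , Z , λ {x} x∉ →
          let c , ≰ = Finₚ.¬∀⟶∃¬ (suc q) _ (λ c → lad i ℕ.≤? deg G x (Parts.part P c)) (λ rich → none (x , x∉ , rich))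
          in c , ℕₚ.≰⇒> ≰
  ... | yes (x , x∉ , rich) =
          let j , j<i , rest = apex-search lad large i P′ Z′ in j , ℕₚ.m<n⇒m<1+n j<i , rest
    where
    open Parts P
    open Apexes Z
    B : Fin (suc q) → List (Fin n)
    B c = filter (adj? G x) (part c)
    P′ : Parts G (suc q) (lad i)
    P′ = shrink P B (λ c → Uniqueₚ.filter⁺ (adj? G x) (unique c)) (λ y∈ → proj₁ (∈ₚ.∈-filter⁻ (adj? G x) y∈))
           (λ c → subst (lad i ≤_) (sym (length-filter (adj? G x) (part c))) (rich c))
    Z′ : Apexes P′ i
    Z′ = record
      { apexes   = x ∷ apexes
      ; distinct = All.tabulate (λ z∈ x≡z → x∉ (subst (_∈ apexes) (sym x≡z) z∈)) ∷ distinct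
      ; number   = trans (sym (ℕₚ.+-suc (length apexes) i)) number
      ; full     = λ
          { (here refl) {c} y∈ → proj₂ (∈ₚ.∈-filter⁻ (adj? G x) {xs = part c} (∈-take⁻ (lad i) y∈))
          ; (there z∈) {c} y∈  → full z∈ (proj₁ (∈ₚ.∈-filter⁻ (adj? G x) {xs = part c} (∈-take⁻ (lad i) y∈))) }
      }

  module _ {Λ ℓ w Λ′ j : ℕ} (P : Parts G (suc q) Λ) (Z : Apexes P (suc j)) where
    open Parts P
    open Apexes Z

    module _ (class : Fin n → Fin (suc q)) (deg<ℓ : ∀ {x} → x ∉ apexes → deg G x (part (class x)) < ℓ)
             (large : k + 2 * t * suc w ≤ Λ) (ℓ-small : suc (suc q * 2 * ℓ) ≤ Λ′)
             (trim : Λ′ + suc q * (2 * j) ≤ Λ) (w-large : Λ + ℓ ≤ Λ′ + w) where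

      Near : Fin (suc q) → Fin n → Set
      Near i = NearFull A P i w large

      near? : ∀ i x → Dec (Near i x)
      near? i x = Finₚ.all? (λ c → dec (c Finₚ.≟ i) (Λ ℕ.≤? deg G x (part c) + w))
        where
        dec : ∀ {Q R : Set} → Dec Q → Dec R → Dec (¬ Q → R)
        dec (yes p) _       = yes (λ ¬p → ⊥-elim (¬p p))
        dec (no _)  (yes r) = yes (λ _ → r)
        dec (no ¬p) (no ¬r) = no (λ f → ¬r (f ¬p))

      not-near : ∀ {i x} → ¬ Near i x → ∃[ c ] c ≢ i × deg G x (part c) + w < Λ
      not-near {i} {x} ¬near with Finₚ.any? (λ c → ¬? (c Finₚ.≟ i) ×-dec (deg G x (part c) + w ℕ.<? Λ))
      ... | yes found = found
      ... | no none   = ⊥-elim (¬near (λ c c≢i → ℕₚ.≮⇒≥ (λ lt → none (c , c≢i , lt))))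

      Own : Fin (suc q) → Fin n → Fin n → Set
      Own i x a = x ∉ apexes × class x ≡ i × Near i x × a ∈ part i × Adj G x a

      own? : ∀ i x a → Dec (Own i x a)
      own? i x a = ¬? (x ∈? apexes) ×-dec (class x Finₚ.≟ i) ×-dec near? i x ×-dec (a ∈? part i) ×-dec adj? G x a

      apex∉part : ∀ {i a} → a ∈ part i → a ∉ apexes
      apex∉part a∈ a∈Z = Graph.irrefl G refl (full a∈Z a∈)

      no-matching : ∀ i ps → length ps ≡ suc j → All (λ (x , y) → Adj G x y) ps → Unique (endpoints ps) →
                    ¬ All (λ (x , y) → (x ∉ apexes × Near i x) × (y ∉ apexes × Near i y)) ps
      no-matching i ps len adj u good = free (embed-apex A P i w large apexes ps
        (trans (cong (length apexes +_) len) number)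
        (Uniqueₚ.++⁺ distinct u (λ (v∈Z , v∈ps) → proj₁ (All.lookup (All-endpoints good) v∈ps) v∈Z))
        full adj (All.map proj₂ (All-endpoints good)))

      cover : ∀ i → ∃[ vs ] length vs ≤ 2 * j × (∀ {x a} → Own i x a → x ∈ vs ⊎ a ∈ vs)
      cover i with matching-or-cover (own? i) (λ (_ , _ , _ , _ , adj) x≡y → Graph.irrefl G x≡y adj) (suc j)
      ... | inj₂ (vs , short , cov) = vs , s≤s⁻¹ (s≤s⁻¹ (subst (2 + length vs ≤_) (arith j) short)) , cov
        where
        arith : ∀ a → 2 * suc a ≡ 2 + 2 * a
        arith = solve-∀
      ... | inj₁ (ps , len , own , u) = ⊥-elim (no-matching i ps len
              (All.map (λ (_ , _ , _ , _ , adj) → adj) own) u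
              (All.map (λ (x∉ , _ , near , a∈ , _) → (x∉ , near) , apex∉part a∈ ,
                 λ c c≢i → ℕₚ.≤-trans (ℕₚ.≤-reflexive (sym (full⇒deg (complete (c≢i ∘ sym) a∈)))) (ℕₚ.m≤m+n _ w)) own))

      covered : List (Fin n)
      covered = concatMap (proj₁ ∘ cover) (allFin (suc q))

      length-covered : length covered ≤ suc q * (2 * j)
      length-covered = begin
        length covered                                       ≡⟨ sym (trans (∑-const covered 1) (ℕₚ.*-identityʳ _)) ⟩
        ∑[ _ ← covered ] 1                                   ≡⟨ ∑-concatMap (proj₁ ∘ cover) (allFin (suc q)) (λ _ → 1) ⟩
        ∑[ i ← allFin (suc q) ] ∑[ _ ← proj₁ (cover i) ] 1   ≤⟨ ∑-mono (allFin (suc q)) (λ {i} _ → ℕₚ.≤-trans (ℕₚ.≤-reflexive (trans (∑-const (proj₁ (cover i)) 1) (ℕₚ.*-identityʳ _))) (proj₁ (proj₂ (cover i)))) ⟩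
        ∑[ i ← allFin (suc q) ] (2 * j)                      ≡⟨ ∑-allFin-const (suc q) (2 * j) ⟩
        suc q * (2 * j)                                      ∎
        where open ℕₚ.≤-Reasoning

      private
        outside : Fin (suc q) → List (Fin n)
        outside i = filter (λ x → ¬? (x ∈? covered)) (part i)

      core : Parts G (suc q) Λ′
      core = shrink P outside (λ i → Uniqueₚ.filter⁺ (λ x → ¬? (x ∈? covered)) (unique i))
        (λ {i} x∈ → proj₁ (∈ₚ.∈-filter⁻ (λ x → ¬? (x ∈? covered)) {xs = part i} x∈))
        (λ i → ℕₚ.+-cancelʳ-≤ (suc q * (2 * j)) Λ′ (length (outside i)) (begin
          Λ′ + suc q * (2 * j)                     ≤⟨ trim ⟩
          Λ                                        ≡⟨ sym (card i) ⟩
          length (part i)                          ≤⟨ length-filter-∉ (unique i) covered ⟩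
          length (outside i) + length covered      ≤⟨ ℕₚ.+-monoʳ-≤ (length (outside i)) length-covered ⟩
          length (outside i) + suc q * (2 * j)     ∎))
        where open ℕₚ.≤-Reasoning

      private
        module Core = Parts core

      deg-core≤ : ∀ x i → deg G x (Core.part i) ≤ deg G x (part i)
      deg-core≤ x i = ℕₚ.≤-trans (∑-take≤ Λ′ (outside i) _) (∑-filter≤ (λ x → ¬? (x ∈? covered)) (part i) _)

      core-uncovered : ∀ {a i} → a ∈ Core.part i → a ∈ part i × a ∉ covered
      core-uncovered {i = i} a∈ = ∈ₚ.∈-filter⁻ (λ x → ¬? (x ∈? covered)) {xs = part i} (∈-take⁻ Λ′ a∈)

      near⇒deg≡0 : ∀ {x} → x ∉ apexes → x ∉ covered → Near (class x) x → deg G x (Core.part (class x)) ≡ 0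
      near⇒deg≡0 {x} x∉Z x∉ near = trans (∑-cong (Core.part (class x)) (λ {a} a∈ → 𝟙-no (adj? G x a) (nonadj a∈)))
        (trans (∑-const (Core.part (class x)) 0) (ℕₚ.*-zeroʳ (length (Core.part (class x)))))
        where
        ∈covered : ∀ {v i} → v ∈ proj₁ (cover i) → v ∈ covered
        ∈covered {i = i} v∈ = ∈ₚ.∈-concatMap⁺ (proj₁ ∘ cover) (lose (∈ₚ.∈-allFin i) v∈)
        nonadj : ∀ {a} → a ∈ Core.part (class x) → ¬ Adj G x a
        nonadj a∈ adj with core-uncovered a∈
        ... | a∈P , a∉ with proj₂ (proj₂ (cover (class x))) (x∉Z , refl , near , a∈P , adj)
        ... | inj₁ x∈ = x∉ (∈covered x∈)
        ... | inj₂ a∈ = a∉ (∈covered a∈)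

      far⇒deg< : ∀ {x} → x ∉ apexes → ¬ Near (class x) x → deg G x Core.vertices + Λ′ < suc q * Λ′
      far⇒deg< {x} x∉Z ¬near with c , c≢ , lt ← not-near ¬near =
        subst (λ d → d + Λ′ < suc q * Λ′) (sym (Core.deg-vertices x))
          (≤-cancel (ℓ + d)
            (ℕₚ.+-mono-≤
              (∑-two-small (λ c → deg G x (Core.part c)) (class x) c (c≢ ∘ sym) (Core.deg-part≤ x) ℕₚ.≤-refl
                (≤-cancel (deg G x (part c) + w + Λ)
                  (ℕₚ.+-mono-≤ (ℕₚ.+-mono-≤ (deg-core≤ x c) (ℕₚ.<⇒≤ lt)) w-large)
                  (l₁ (deg G x (Core.part c)) (deg G x (part c)) ℓ w Λ) (r₁ (deg G x (part c)) Λ Λ′ w)))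
              (ℕₚ.≤-trans (s≤s (deg-core≤ x (class x))) (deg<ℓ x∉Z)))
            (l₂ (∑[ c ← allFin (suc q) ] deg G x (Core.part c)) d ℓ Λ′) (r₂ (suc q * Λ′) d ℓ))
        where
        d = deg G x (Core.part (class x))
        l₁ : ∀ a b ℓ w Λ → a + ℓ + (b + w + Λ) ≡ a + (b + w) + (Λ + ℓ)
        l₁ = solve-∀
        r₁ : ∀ b Λ Λ′ w → b + Λ + (Λ′ + w) ≡ Λ′ + (b + w + Λ)
        r₁ = solve-∀
        l₂ : ∀ s d ℓ Λ′ → suc (s + Λ′) + (ℓ + d) ≡ s + ℓ + Λ′ + suc d
        l₂ = solve-∀
        r₂ : ∀ m d ℓ → m + d + ℓ ≡ m + (ℓ + d)
        r₂ = solve-∀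

      bonus : Fin n → ℕ
      bonus x = 𝟙 (x ∈? apexes) * Λ′ + 𝟙 (x ∈? covered) * ℓ

      deg-core : ∀ x → deg G x Core.vertices + Λ′ ≤ suc q * Λ′ + bonus x
      deg-core x with x ∈? apexes
      ... | yes _ = ℕₚ.+-mono-≤ (subst (deg G x Core.vertices ≤_) Core.length-vertices (deg≤length G x Core.vertices))
                      (ℕₚ.≤-trans (ℕₚ.m≤m+n Λ′ 0) (ℕₚ.m≤m+n (1 * Λ′) _))
      ... | no x∉Z = subst (λ d → d + Λ′ ≤ suc q * Λ′ + 𝟙 (x ∈? covered) * ℓ) (sym (Core.deg-vertices x)) (bounded (x ∈? covered) (near? (class x) x))
        where
        Sum = ∑[ c ← allFin (suc q) ] deg G x (Core.part c)
        bounded : (d : Dec (x ∈ covered)) → Dec (Near (class x) x) → Sum + Λ′ ≤ suc q * Λ′ + 𝟙 d * ℓ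
        bounded (yes _) _ = ∑-one-small _ (class x) (Core.deg-part≤ x)
          (ℕₚ.≤-trans (deg-core≤ x (class x)) (ℕₚ.≤-trans (ℕₚ.<⇒≤ (deg<ℓ x∉Z)) (ℕₚ.m≤m+n ℓ 0)))
        bounded (no x∉) (yes near) = ∑-one-small _ (class x) (Core.deg-part≤ x) (ℕₚ.≤-reflexive (near⇒deg≡0 x∉Z x∉ near))
        bounded (no x∉) (no ¬near) = ℕₚ.≤-trans (ℕₚ.<⇒≤ (subst (λ d → d + Λ′ < suc q * Λ′) (Core.deg-vertices x) (far⇒deg< x∉Z ¬near)))
                                       (ℕₚ.m≤m+n _ 0)

      ∑-deg-core : ∀ ε → ∑[ x ← allFin n ] (deg G x Core.vertices + Λ′) + ε ≤ ∑[ x ← allFin n ] (suc q * Λ′ + bonus x) →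
              ∀ T → t ≡ suc T →
              ∑[ x ← allFin n ] deg G x Core.vertices + n * Λ′ + ε + j ≤ n * (suc q * Λ′) + T * Λ′
      ∑-deg-core ε le T t≡ = begin
        ∑[ x ← allFin n ] deg G x Core.vertices + n * Λ′ + ε + j
          ≡⟨ cong (λ s → s + ε + j) (sym (trans (∑-+ (allFin n) _ _) (cong ((∑[ x ← allFin n ] deg G x Core.vertices) +_) (∑-allFin-const n Λ′)))) ⟩
        ∑[ x ← allFin n ] (deg G x Core.vertices + Λ′) + ε + j
          ≤⟨ ℕₚ.+-monoˡ-≤ j le ⟩
        ∑[ x ← allFin n ] (suc q * Λ′ + bonus x) + j
          ≡⟨ cong (_+ j) (trans (∑-+ (allFin n) _ _) (cong₂ _+_ (∑-allFin-const n _) (trans (∑-+ (allFin n) _ _)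
               (cong₂ _+_ (∑-*ʳ (λ x → 𝟙 (x ∈? apexes)) Λ′) (∑-*ʳ (λ x → 𝟙 (x ∈? covered)) ℓ))))) ⟩
        n * (suc q * Λ′) + (∑[ x ← allFin n ] 𝟙 (x ∈? apexes) * Λ′ + ∑[ x ← allFin n ] 𝟙 (x ∈? covered) * ℓ) + j
          ≤⟨ ℕₚ.+-monoˡ-≤ j (ℕₚ.+-monoʳ-≤ (n * (suc q * Λ′)) (ℕₚ.+-mono-≤
               (ℕₚ.*-monoˡ-≤ Λ′ (∑-𝟙-∈ (Uniqueₚ.allFin⁺ n) apexes))
               (ℕₚ.*-monoˡ-≤ ℓ (ℕₚ.≤-trans (∑-𝟙-∈ (Uniqueₚ.allFin⁺ n) covered) length-covered)))) ⟩
        n * (suc q * Λ′) + (length apexes * Λ′ + suc q * (2 * j) * ℓ) + j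
          ≡⟨ shuffle (n * (suc q * Λ′)) (length apexes * Λ′) (suc q) j ℓ ⟩
        n * (suc q * Λ′) + (length apexes * Λ′ + j * suc (suc q * 2 * ℓ))
          ≤⟨ ℕₚ.+-monoʳ-≤ (n * (suc q * Λ′)) (ℕₚ.+-monoʳ-≤ (length apexes * Λ′) (ℕₚ.*-monoʳ-≤ j ℓ-small)) ⟩
        n * (suc q * Λ′) + (length apexes * Λ′ + j * Λ′)
          ≡⟨ cong (n * (suc q * Λ′) +_) (trans (sym (ℕₚ.*-distribʳ-+ Λ′ (length apexes) j)) (cong (_* Λ′) apexes+j)) ⟩
        n * (suc q * Λ′) + T * Λ′ ∎
        where
        open ℕₚ.≤-Reasoning
        ∑-*ʳ : ∀ (f : Fin n → ℕ) m → ∑[ x ← allFin n ] (f x * m) ≡ ∑ (allFin n) f * m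
        ∑-*ʳ f m = trans (∑-cong (allFin n) (λ {x} _ → ℕₚ.*-comm (f x) m)) (trans (∑-*ˡ (allFin n) m f) (ℕₚ.*-comm m _))
        shuffle : ∀ a b q j ℓ → a + (b + q * (2 * j) * ℓ) + j ≡ a + (b + j * suc (q * 2 * ℓ))
        shuffle = solve-∀
        apexes+j : length apexes + j ≡ T
        apexes+j = ℕₚ.suc-injective (trans (sym (ℕₚ.+-suc (length apexes) j)) (trans number t≡))

      gain-or-rigid : ∀ T → t ≡ suc T →
        ∑[ x ← allFin n ] deg G x Core.vertices + n * Λ′ < n * (suc q * Λ′) + T * Λ′ ⊎
        (j ≡ 0 × (∀ {x} → x ∉ apexes → Near (class x) x))
      gain-or-rigid T t≡ with j ℕ.≟ 0
      ... | no j≢0 = inj₁ (ℕₚ.≤-trans (ℕₚ.≤-reflexive (arith _)) (ℕₚ.≤-trans (ℕₚ.+-monoʳ-≤ _ (ℕₚ.n≢0⇒n>0 j≢0))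
                       (∑-deg-core 0 (ℕₚ.≤-trans (ℕₚ.≤-reflexive (ℕₚ.+-identityʳ _)) (∑-mono (allFin n) (λ {x} _ → deg-core x))) T t≡)))
        where
        arith : ∀ a → suc a ≡ a + 0 + 1
        arith = solve-∀
      ... | yes j≡0 with Finₚ.any? (λ x → ¬? (x ∈? apexes) ×-dec ¬? (near? (class x) x))
      ...   | no none = inj₂ (j≡0 , λ {x} x∉Z → near x∉Z (near? (class x) x))
        where
        near : ∀ {x} → x ∉ apexes → Dec (Near (class x) x) → Near (class x) x
        near x∉Z (yes near) = near
        near x∉Z (no ¬near) = ⊥-elim (none (_ , x∉Z , ¬near))
      ...   | yes (x , x∉Z , ¬near) = inj₁ (ℕₚ.≤-trans (ℕₚ.≤-reflexive (ℕₚ.+-comm 1 _)) (ℕₚ.≤-trans (ℕₚ.m≤m+n _ j)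
                (∑-deg-core 1 (ℕₚ.≤-trans (ℕₚ.≤-reflexive (ℕₚ.+-comm _ 1)) (∑-mono-< (allFin n) (λ {x} _ → deg-core x) (∈ₚ.∈-allFin x)
                  (ℕₚ.<-≤-trans (far⇒deg< x∉Z ¬near) (ℕₚ.m≤m+n _ (bonus x))))) T t≡)))

      rigid-independent : j ≡ 0 → (∀ {x} → x ∉ apexes → Near (class x) x) →
        ∀ {x y} → x ∉ apexes → y ∉ apexes → class x ≡ class y → ¬ Adj G x y
      rigid-independent j≡0 near {x} {y} x∉Z y∉Z same adj = no-matching (class x) ((x , y) ∷ []) (cong suc (sym j≡0))
        (adj ∷ []) (((λ x≡y → Graph.irrefl G x≡y adj) ∷ []) ∷ [] ∷ [])
        (((x∉Z , near x∉Z) , y∉Z , subst (λ i → Near i y) (sym same) (near y∉Z)) ∷ [])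

-- Colour classes and Turán numbers

∑-allFin-+ : ∀ a b (f : Fin (a + b) → ℕ) →
             ∑ (allFin (a + b)) f ≡ ∑[ i ← allFin a ] f (i ↑ˡ b) + ∑[ i ← allFin b ] f (a ↑ʳ i)
∑-allFin-+ zero    b f = refl
∑-allFin-+ (suc a) b f = begin
  f zero + ∑ (tabulate suc) f
    ≡⟨ cong (f zero +_) (shift f) ⟩
  f zero + ∑ (allFin (a + b)) (f ∘ suc)
    ≡⟨ cong (f zero +_) (∑-allFin-+ a b (f ∘ suc)) ⟩
  f zero + (∑[ i ← allFin a ] f (suc (i ↑ˡ b)) + ∑[ i ← allFin b ] f (suc (a ↑ʳ i)))
    ≡⟨ sym (ℕₚ.+-assoc (f zero) _ _) ⟩
  f zero + ∑[ i ← allFin a ] f (suc (i ↑ˡ b)) + ∑[ i ← allFin b ] f (suc (a ↑ʳ i))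
    ≡⟨ cong (λ z → f zero + z + ∑[ i ← allFin b ] f (suc (a ↑ʳ i))) (sym (shift (λ i → f (i ↑ˡ b)))) ⟩
  f zero + ∑[ i ← tabulate suc ] f (i ↑ˡ b) + ∑[ i ← allFin b ] f (suc (a ↑ʳ i)) ∎
  where
  open ≡-Reasoning
  shift : ∀ {m} (h : Fin (suc m) → ℕ) → ∑ (tabulate suc) h ≡ ∑ (allFin m) (h ∘ suc)
  shift {m} h = trans (cong (λ xs → ∑ xs h) (sym (Listₚ.map-tabulate id suc))) (∑-map suc (allFin m) h)

∑-punchIn : ∀ {n} (j : Fin (suc n)) (f : Fin (suc n) → ℕ) → ∑ (allFin (suc n)) f ≡ f j + ∑[ i ← allFin n ] f (punchIn j i)
∑-punchIn {n} j f = trans (∑-↭ (Unique-↭ (Uniqueₚ.allFin⁺ (suc n)) (All.tabulate j∉ ∷ Uniqueₚ.map⁺ (Finₚ.punchIn-injective j _ _) (Uniqueₚ.allFin⁺ n)) to (λ {x} _ → ∈ₚ.∈-allFin x)) f)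
  (cong (f j +_) (∑-map (punchIn j) (allFin n) f))
  where
  j∉ : ∀ {x} → x ∈ map (punchIn j) (allFin n) → j ≢ x
  j∉ x∈ refl with ∈ₚ.∈-map⁻ (punchIn j) x∈
  ... | i , _ , eq = Finₚ.punchInᵢ≢i j i (sym eq)
  to : ∀ {x} → x ∈ allFin (suc n) → x ∈ j ∷ map (punchIn j) (allFin n)
  to {x} _ with j Finₚ.≟ x
  ... | yes refl = here refl
  ... | no j≢x = there (subst (_∈ map (punchIn j) (allFin n)) (Finₚ.punchIn-punchOut j≢x)
                   (∈ₚ.∈-map⁺ (punchIn j) (∈ₚ.∈-allFin (Fin.punchOut j≢x))))

∑≡0⇒ : ∀ {A : Set} (xs : List A) {f : A → ℕ} → ∑ xs f ≡ 0 → ∀ {x} → x ∈ xs → f x ≡ 0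
∑≡0⇒ xs eq x∈ = sym (∑-tight xs {λ _ → 0} (λ _ → z≤n) (ℕₚ.≤-trans (ℕₚ.≤-reflexive eq) z≤n) x∈)

module _ {X : Set} (_≟X_ : ∀ (x y : X) → Dec (x ≡ y)) where

  fibres⇒permutation : ∀ {n} (f g : Fin n → X) →
    (∀ x → ∑[ i ← allFin n ] 𝟙 (f i ≟X x) ≡ ∑[ i ← allFin n ] 𝟙 (g i ≟X x)) →
    Σ[ π ∈ Perm.Permutation n n ] (∀ i → g (Inverse.to π i) ≡ f i)
  fibres⇒permutation {zero}  f g same = Perm.id , λ ()
  fibres⇒permutation {suc n} f g same = build (Finₚ.any? (λ j → g j ≟X f zero))
    where
    Goal = Σ[ π ∈ Perm.Permutation (suc n) (suc n) ] (∀ i → g (Inverse.to π i) ≡ f i)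
    build : Dec (∃[ j ] g j ≡ f zero) → Goal
    build (no none) = ⊥-elim (ℕₚ.1+n≢0 {0} (trans (sym (𝟙-yes (f zero ≟X f zero) refl))
      (∑≡0⇒ (allFin (suc n)) {λ i → 𝟙 (f i ≟X f zero)} (trans (same (f zero))
        (trans (∑-cong (allFin (suc n)) (λ {j} _ → 𝟙-no (g j ≟X f zero) (λ eq → none (j , eq))))
          (trans (∑-allFin-const (suc n) 0) (ℕₚ.*-zeroʳ (suc n))))) (∈ₚ.∈-allFin zero))))
    build (yes (j , gj)) = Perm.insert zero j π , λ
        { zero    → gj
        ; (suc i) → trans (cong g (Perm.insert-punchIn zero j π i)) (πok i) }
      where
      ih = fibres⇒permutation (f ∘ suc) (g ∘ punchIn j) (λ x → ℕₚ.+-cancelˡ-≡ (𝟙 (f zero ≟X x)) _ _ (begin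
        𝟙 (f zero ≟X x) + ∑[ i ← allFin n ] 𝟙 (f (suc i) ≟X x)       ≡⟨ sym (∑-punchIn zero (λ i → 𝟙 (f i ≟X x))) ⟩
        ∑[ i ← allFin (suc n) ] 𝟙 (f i ≟X x)                         ≡⟨ same x ⟩
        ∑[ i ← allFin (suc n) ] 𝟙 (g i ≟X x)                         ≡⟨ ∑-punchIn j (λ i → 𝟙 (g i ≟X x)) ⟩
        𝟙 (g j ≟X x) + ∑[ i ← allFin n ] 𝟙 (g (punchIn j i) ≟X x)    ≡⟨ cong (λ y → 𝟙 (y ≟X x) + ∑[ i ← allFin n ] 𝟙 (g (punchIn j i) ≟X x)) gj ⟩
        𝟙 (f zero ≟X x) + ∑[ i ← allFin n ] 𝟙 (g (punchIn j i) ≟X x) ∎))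
        where open ≡-Reasoning
      π = proj₁ ih
      πok = proj₂ ih

  fibres⇒bijection : ∀ {m n} → m ≡ n → (f : Fin m → X) (g : Fin n → X) →
    (∀ x → ∑[ i ← allFin m ] 𝟙 (f i ≟X x) ≡ ∑[ i ← allFin n ] 𝟙 (g i ≟X x)) →
    Σ[ π ∈ Fin m ↔ Fin n ] (∀ i → g (Inverse.to π i) ≡ f i)
  fibres⇒bijection refl = fibres⇒permutation

class-size : ∀ {n m} → (Fin n → Fin m) → Fin m → ℕ
class-size {n} d c = ∑[ x ← allFin n ] 𝟙 (d x Finₚ.≟ c)

∑-class-size : ∀ {n m} (d : Fin n → Fin m) → ∑[ c ← allFin m ] class-size d c ≡ n
∑-class-size {n} {m} d = begin
  ∑[ c ← allFin m ] ∑[ x ← allFin n ] 𝟙 (d x Finₚ.≟ c)   ≡⟨ ∑-swap (allFin m) (allFin n) _ ⟩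
  ∑[ x ← allFin n ] ∑[ c ← allFin m ] 𝟙 (d x Finₚ.≟ c)   ≡⟨ ∑-cong (allFin n) (λ {x} _ → trans (∑-cong (allFin m) (λ {c} _ → 𝟙-cong (d x Finₚ.≟ c) (c Finₚ.≟ d x) sym sym)) (∑-δ (d x))) ⟩
  ∑[ x ← allFin n ] 1                                    ≡⟨ trans (∑-allFin-const n 1) (ℕₚ.*-identityʳ n) ⟩
  n                                                      ∎
  where open ≡-Reasoning

module _ {n m : ℕ} (d : Fin n → Fin m) where

  squares : ℕ
  squares = ∑[ c ← allFin m ] (class-size d c * class-size d c)

  monochromatic : ∑[ x ← allFin n ] ∑[ y ← allFin n ] 𝟙 (d y Finₚ.≟ d x) ≡ squares
  monochromatic = begin
    ∑[ x ← allFin n ] class-size d (d x)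
      ≡⟨ ∑-cong (allFin n) (λ {x} _ → sym (∑-select x)) ⟩
    ∑[ x ← allFin n ] ∑[ c ← allFin m ] (class-size d c * 𝟙 (d x Finₚ.≟ c))
      ≡⟨ ∑-swap (allFin n) (allFin m) _ ⟩
    ∑[ c ← allFin m ] ∑[ x ← allFin n ] (class-size d c * 𝟙 (d x Finₚ.≟ c))
      ≡⟨ ∑-cong (allFin m) (λ {c} _ → ∑-*ˡ (allFin n) (class-size d c) _) ⟩
    squares ∎
    where
    open ≡-Reasoning
    pick : ∀ x c → class-size d c * 𝟙 (d x Finₚ.≟ c) ≡ 𝟙 (c Finₚ.≟ d x) * class-size d (d x)
    pick x c with c Finₚ.≟ d x
    ... | yes refl = trans (cong (class-size d c *_) (𝟙-yes (c Finₚ.≟ c) refl)) (ℕₚ.*-comm (class-size d c) 1)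
    ... | no c≢    = trans (cong (class-size d c *_) (𝟙-no (d x Finₚ.≟ c) (c≢ ∘ sym))) (ℕₚ.*-zeroʳ (class-size d c))
    ∑-select : ∀ x → ∑[ c ← allFin m ] (class-size d c * 𝟙 (d x Finₚ.≟ c)) ≡ class-size d (d x)
    ∑-select x = trans (∑-cong (allFin m) (λ {c} _ → pick x c)) (∑-δ-* (d x) (class-size d (d x)))

module _ {n m : ℕ} (G : Graph n) (d : Fin n → Fin m) where

  private
    covered-pairs : ∑[ x ← allFin n ] ∑[ y ← allFin n ] (𝟙 (adj? G x y) + 𝟙 (d y Finₚ.≟ d x)) ≡ size G + squares d
    covered-pairs = trans (∑-cong (allFin n) (λ {x} _ → ∑-+ (allFin n) _ _))
      (trans (∑-+ (allFin n) _ _) (cong (size G +_) (monochromatic d)))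
    all-pairs : ∑[ x ← allFin n ] ∑[ y ← allFin n ] 1 ≡ n * n
    all-pairs = trans (∑-cong (allFin n) (λ _ → trans (∑-allFin-const n 1) (ℕₚ.*-identityʳ n))) (∑-allFin-const n n)

  module _ (proper : ∀ {x y} → Adj G x y → d x ≢ d y) where

    private
      pair≤1 : ∀ x y → 𝟙 (adj? G x y) + 𝟙 (d y Finₚ.≟ d x) ≤ 1
      pair≤1 x y with adj? G x y
      ... | yes xy = ℕₚ.≤-reflexive (cong suc (𝟙-no (d y Finₚ.≟ d x) (proper xy ∘ sym)))
      ... | no _   = 𝟙≤1 (d y Finₚ.≟ d x)

    size+squares≤ : size G + squares d ≤ n * n
    size+squares≤ = subst₂ _≤_ covered-pairs all-pairs
      (∑-mono (allFin n) (λ {x} _ → ∑-mono (allFin n) (λ {y} _ → pair≤1 x y)))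

    tight⇒adjacent : n * n ≤ size G + squares d → ∀ {x y} → d x ≢ d y → Adj G x y
    tight⇒adjacent tight {x} {y} x≢y with adj? G x y in eq
    ... | yes xy = xy
    ... | no ¬xy = ⊥-elim (ℕₚ.1+n≢0 {0} (sym (trans (sym (cong₂ _+_ (𝟙-no (adj? G x y) ¬xy) (𝟙-no (d y Finₚ.≟ d x) (x≢y ∘ sym)))) pair≡1)))
      where
      row : ∑[ y ← allFin n ] (𝟙 (adj? G x y) + 𝟙 (d y Finₚ.≟ d x)) ≡ ∑[ _ ← allFin n ] 1
      row = ∑-tight (allFin n) {λ x → ∑[ y ← allFin n ] (𝟙 (adj? G x y) + 𝟙 (d y Finₚ.≟ d x))} {λ _ → ∑[ _ ← allFin n ] 1}
        (λ {x} _ → ∑-mono (allFin n) (λ {y} _ → pair≤1 x y))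
        (subst₂ _≤_ (sym all-pairs) (sym covered-pairs) tight) (∈ₚ.∈-allFin x)
      pair≡1 : 𝟙 (adj? G x y) + 𝟙 (d y Finₚ.≟ d x) ≡ 1
      pair≡1 = ∑-tight (allFin n) (λ {y} _ → pair≤1 x y) (ℕₚ.≤-reflexive (sym row)) (∈ₚ.∈-allFin y)

  complete⇒size : (∀ x y → Adj G x y ⇔ d x ≢ d y) → size G + squares d ≡ n * n
  complete⇒size iff = trans (sym covered-pairs) (trans (∑-cong (allFin n) (λ {x} _ → ∑-cong (allFin n) (λ {y} _ →
      𝟙+𝟙¬ (adj? G x y) (d y Finₚ.≟ d x) (λ xy → Equivalence.to (iff x y) xy ∘ sym)
        (λ ¬xy → dec (d y Finₚ.≟ d x) ¬xy)))) all-pairs)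
    where
    dec : ∀ {x y} → Dec (d y ≡ d x) → ¬ Adj G x y → d y ≡ d x
    dec (yes eq) _   = eq
    dec (no ne)  ¬xy = ⊥-elim (¬xy (Equivalence.from (iff _ _) (ne ∘ sym)))

-- (x - a)(x - a - 1) ≥ 0 for integers, with equality only at x = a and x = a + 1.
square-gap : ∀ a x → ∃[ g ] (2 * a + 1) * x + g ≡ x * x + a * (a + 1) × (g ≡ 0 → x ≡ a ⊎ x ≡ suc a)
square-gap a x with ℕₚ.≤-total x a
... | inj₁ x≤a = subst (λ a → ∃[ g ] (2 * a + 1) * x + g ≡ x * x + a * (a + 1) × (g ≡ 0 → x ≡ a ⊎ x ≡ suc a))
    (ℕₚ.m+[n∸m]≡n x≤a) (below (a ∸ x))
  where
  arith : ∀ x δ → (2 * (x + δ) + 1) * x + δ * suc δ ≡ x * x + (x + δ) * (x + δ + 1)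
  arith = solve-∀
  below : ∀ δ → ∃[ g ] (2 * (x + δ) + 1) * x + g ≡ x * x + (x + δ) * (x + δ + 1) × (g ≡ 0 → x ≡ x + δ ⊎ x ≡ suc (x + δ))
  below δ = δ * suc δ , arith x δ , zero-gap δ
    where
    zero-gap : ∀ δ → δ * suc δ ≡ 0 → x ≡ x + δ ⊎ x ≡ suc (x + δ)
    zero-gap zero _ = inj₁ (sym (ℕₚ.+-identityʳ x))
... | inj₂ a≤x = subst (λ x → ∃[ g ] (2 * a + 1) * x + g ≡ x * x + a * (a + 1) × (g ≡ 0 → x ≡ a ⊎ x ≡ suc a))
    (ℕₚ.m+[n∸m]≡n a≤x) (above (x ∸ a))
  where
  above : ∀ δ → ∃[ g ] (2 * a + 1) * (a + δ) + g ≡ (a + δ) * (a + δ) + a * (a + 1) × (g ≡ 0 → a + δ ≡ a ⊎ a + δ ≡ suc a)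
  above zero          = 0 , arith a , λ _ → inj₁ (ℕₚ.+-identityʳ a)
    where
    arith : ∀ a → (2 * a + 1) * (a + 0) + 0 ≡ (a + 0) * (a + 0) + a * (a + 1)
    arith = solve-∀
  above (suc zero)    = 0 , arith a , λ _ → inj₂ (ℕₚ.+-comm a 1)
    where
    arith : ∀ a → (2 * a + 1) * (a + 1) + 0 ≡ (a + 1) * (a + 1) + a * (a + 1)
    arith = solve-∀
  above (suc (suc δ)) = suc (suc δ) * suc δ , arith a δ , λ ()
    where
    arith : ∀ a δ → (2 * a + 1) * (a + suc (suc δ)) + suc (suc δ) * suc δ ≡ (a + suc (suc δ)) * (a + suc (suc δ)) + a * (a + 1)
    arith = solve-∀

module _ {q : ℕ} (a : ℕ) (x : Fin q → ℕ) where

  private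
    gap : Fin q → ℕ
    gap c = proj₁ (square-gap a (x c))

    ∑-gap : (2 * a + 1) * ∑ (allFin q) x + ∑ (allFin q) gap ≡ ∑[ c ← allFin q ] (x c * x c) + q * (a * (a + 1))
    ∑-gap = begin
      (2 * a + 1) * ∑ (allFin q) x + ∑ (allFin q) gap           ≡⟨ cong (_+ ∑ (allFin q) gap) (sym (∑-*ˡ (allFin q) (2 * a + 1) x)) ⟩
      ∑[ c ← allFin q ] ((2 * a + 1) * x c) + ∑ (allFin q) gap  ≡⟨ sym (∑-+ (allFin q) _ _) ⟩
      ∑[ c ← allFin q ] ((2 * a + 1) * x c + gap c)             ≡⟨ ∑-cong (allFin q) (λ {c} _ → proj₁ (proj₂ (square-gap a (x c)))) ⟩
      ∑[ c ← allFin q ] (x c * x c + a * (a + 1))               ≡⟨ trans (∑-+ (allFin q) _ _) (cong ((∑[ c ← allFin q ] (x c * x c)) +_) (∑-allFin-const q _)) ⟩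
      ∑[ c ← allFin q ] (x c * x c) + q * (a * (a + 1))         ∎
      where open ≡-Reasoning

  squares-≥ : (2 * a + 1) * ∑ (allFin q) x ≤ ∑[ c ← allFin q ] (x c * x c) + q * (a * (a + 1))
  squares-≥ = subst ((2 * a + 1) * ∑ (allFin q) x ≤_) ∑-gap (ℕₚ.m≤m+n _ _)

  squares-tight : ∑[ c ← allFin q ] (x c * x c) + q * (a * (a + 1)) ≤ (2 * a + 1) * ∑ (allFin q) x →
                  ∀ c → x c ≡ a ⊎ x c ≡ suc a
  squares-tight le c = proj₂ (proj₂ (square-gap a (x c)))
    (∑≡0⇒ (allFin q) (ℕₚ.n≤0⇒n≡0 (ℕₚ.+-cancelˡ-≤ ((2 * a + 1) * ∑ (allFin q) x) _ 0
      (subst₂ _≤_ (sym ∑-gap) (sym (ℕₚ.+-identityʳ _)) le))) (∈ₚ.∈-allFin c))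

  squares-balanced : (∀ c → x c ≡ a ⊎ x c ≡ suc a) →
                     ∑[ c ← allFin q ] (x c * x c) + q * (a * (a + 1)) ≡ (2 * a + 1) * ∑ (allFin q) x
  squares-balanced two = begin
    ∑[ c ← allFin q ] (x c * x c) + q * (a * (a + 1))
      ≡⟨ sym (trans (∑-+ (allFin q) _ _) (cong ((∑[ c ← allFin q ] (x c * x c)) +_) (∑-allFin-const q _))) ⟩
    ∑[ c ← allFin q ] (x c * x c + a * (a + 1))       ≡⟨ ∑-cong (allFin q) (λ {c} _ → term (x c) (two c)) ⟩
    ∑[ c ← allFin q ] ((2 * a + 1) * x c)             ≡⟨ ∑-*ˡ (allFin q) (2 * a + 1) x ⟩
    (2 * a + 1) * ∑ (allFin q) x                      ∎
    where
    open ≡-Reasoning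
    term : ∀ y → y ≡ a ⊎ y ≡ suc a → y * y + a * (a + 1) ≡ (2 * a + 1) * y
    term y (inj₁ refl) = arith a
      where
      arith : ∀ a → a * a + a * (a + 1) ≡ (2 * a + 1) * a
      arith = solve-∀
    term y (inj₂ refl) = arith a
      where
      arith : ∀ a → suc a * suc a + a * (a + 1) ≡ (2 * a + 1) * suc a
      arith = solve-∀

-- With all sizes a or a + 1, the total determines how often each occurs.
two-valued-fibres : ∀ {q} a (x y : Fin q → ℕ) → (∀ c → x c ≡ a ⊎ x c ≡ suc a) → (∀ c → y c ≡ a ⊎ y c ≡ suc a) →
  ∑ (allFin q) x ≡ ∑ (allFin q) y → ∀ v → ∑[ c ← allFin q ] 𝟙 (x c ℕ.≟ v) ≡ ∑[ c ← allFin q ] 𝟙 (y c ℕ.≟ v)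
two-valued-fibres {q} a x y two-x two-y total v with v ℕ.≟ suc a | v ℕ.≟ a
... | yes refl | _ = ℕₚ.+-cancelʳ-≡ (q * a) _ _ (trans (upper x two-x) (trans total (sym (upper y two-y))))
  where
  upper : ∀ x → (∀ c → x c ≡ a ⊎ x c ≡ suc a) → ∑[ c ← allFin q ] 𝟙 (x c ℕ.≟ suc a) + q * a ≡ ∑ (allFin q) x
  upper x two = trans (cong ((∑[ c ← allFin q ] 𝟙 (x c ℕ.≟ suc a)) +_) (sym (∑-allFin-const q a)))
    (trans (sym (∑-+ (allFin q) _ _)) (∑-cong (allFin q) (λ {c} _ → term (x c) (two c))))
    where
    term : ∀ z → z ≡ a ⊎ z ≡ suc a → 𝟙 (z ℕ.≟ suc a) + a ≡ z
    term z (inj₁ refl) = cong (_+ a) (𝟙-no (a ℕ.≟ suc a) (ℕₚ.m≢1+m+n a ∘ (λ eq → trans eq (cong suc (sym (ℕₚ.+-identityʳ a))))))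
    term z (inj₂ refl) = cong (_+ a) (𝟙-yes (suc a ℕ.≟ suc a) refl)
... | no _ | yes refl = ℕₚ.+-cancelʳ-≡ (∑ (allFin q) x) _ _ (trans (lower x two-x) (trans (sym (lower y two-y)) (cong ((∑[ c ← allFin q ] 𝟙 (y c ℕ.≟ a)) +_) (sym total))))
  where
  lower : ∀ x → (∀ c → x c ≡ a ⊎ x c ≡ suc a) → ∑[ c ← allFin q ] 𝟙 (x c ℕ.≟ a) + ∑ (allFin q) x ≡ q * suc a
  lower x two = trans (sym (∑-+ (allFin q) _ _)) (trans (∑-cong (allFin q) (λ {c} _ → term (x c) (two c))) (∑-allFin-const q (suc a)))
    where
    term : ∀ z → z ≡ a ⊎ z ≡ suc a → 𝟙 (z ℕ.≟ a) + z ≡ suc a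
    term z (inj₁ refl) = cong (_+ a) (𝟙-yes (a ℕ.≟ a) refl)
    term z (inj₂ refl) = cong (_+ suc a) (𝟙-no (suc a ℕ.≟ a) ℕₚ.1+n≢n)
... | no v≢1+a | no v≢a = ∑-cong (allFin q) (λ {c} _ → trans (𝟙-no (x c ℕ.≟ v) (miss (two-x c))) (sym (𝟙-no (y c ℕ.≟ v) (miss (two-y c)))))
  where
  miss : ∀ {z} → z ≡ a ⊎ z ≡ suc a → z ≢ v
  miss (inj₁ refl) refl = v≢a refl
  miss (inj₂ refl) refl = v≢1+a refl

turán-size : ∀ q .{{_ : NonZero q}} → ℕ → Fin q → ℕ
turán-size q N c = partSize (residue N q) c

module _ (q : ℕ) .{{_ : NonZero q}} where

  private
    co : Fin q → ℕ
    co c = q ∸ suc (toℕ c)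

  turán-size-class : ∀ N c → turán-size q N c ≡ class-size (residue N q) c
  turán-size-class N c = length-filter (λ i → residue N q i Finₚ.≟ c) (allFin N)

  ∑-turán-size : ∀ N → ∑ (allFin q) (turán-size q N) ≡ N
  ∑-turán-size N = trans (∑-cong (allFin q) (λ {c} _ → turán-size-class N c)) (∑-class-size (residue N q))

  turán-size-two : ∀ N c → turán-size q N c ≡ N / q ⊎ turán-size q N c ≡ suc (N / q)
  turán-size-two N c = between (subst (N / q ≤_) (sym (residue-partSize q c N)) (/-monoˡ-≤ q (ℕₚ.m≤m+n N (co c))))
    (begin
      turán-size q N c    ≡⟨ residue-partSize q c N ⟩
      (N + co c) / q      ≤⟨ /-monoˡ-≤ q (ℕₚ.+-monoʳ-≤ N (ℕₚ.m∸n≤m q (suc (toℕ c)))) ⟩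
      (N + q) / q         ≡⟨ +-distrib-/-∣ʳ N ∣-refl ⟩
      N / q + q / q       ≡⟨ trans (cong (N / q +_) (n/n≡1 q)) (ℕₚ.+-comm (N / q) 1) ⟩
      suc (N / q)         ∎)
    where
    open ℕₚ.≤-Reasoning
    between : ∀ {a x} → a ≤ x → x ≤ suc a → x ≡ a ⊎ x ≡ suc a
    between {a} {x} a≤x x≤1+a with ℕₚ.m≤n⇒m<n∨m≡n a≤x
    ... | inj₁ a<x = inj₂ (ℕₚ.≤-antisym x≤1+a a<x)
    ... | inj₂ a≡x = inj₁ (sym a≡x)

  turán-size-+ : ∀ N ℓ c → turán-size q (N + q * ℓ) c ≡ turán-size q N c + ℓ
  turán-size-+ N ℓ c = begin
    turán-size q (N + q * ℓ) c          ≡⟨ residue-partSize q c (N + q * ℓ) ⟩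
    (N + q * ℓ + co c) / q              ≡⟨ cong (_/ q) (shuffle N q ℓ (co c)) ⟩
    (N + co c + ℓ * q) / q              ≡⟨ +-distrib-/-∣ʳ (N + co c) (divides-refl ℓ) ⟩
    (N + co c) / q + ℓ * q / q          ≡⟨ cong₂ _+_ (sym (residue-partSize q c N)) (m*n/n≡m ℓ q) ⟩
    turán-size q N c + ℓ                ∎
    where
    open ≡-Reasoning
    shuffle : ∀ N q ℓ z → N + q * ℓ + z ≡ N + z + ℓ * q
    shuffle = solve-∀

  turán-squares : ℕ → ℕ
  turán-squares N = ∑[ c ← allFin q ] (turán-size q N c * turán-size q N c)

  turán-squares-+ : ∀ N ℓ → turán-squares (N + q * ℓ) ≡ turán-squares N + 2 * ℓ * N + q * (ℓ * ℓ)
  turán-squares-+ N ℓ = begin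
    turán-squares (N + q * ℓ)
      ≡⟨ ∑-cong (allFin q) (λ {c} _ → trans (cong (λ s → s * s) (turán-size-+ N ℓ c)) (expand (turán-size q N c) ℓ)) ⟩
    ∑[ c ← allFin q ] (turán-size q N c * turán-size q N c + 2 * ℓ * turán-size q N c + ℓ * ℓ)
      ≡⟨ trans (∑-+ (allFin q) _ _) (cong₂ _+_ (∑-+ (allFin q) _ _) (∑-allFin-const q (ℓ * ℓ))) ⟩
    turán-squares N + ∑[ c ← allFin q ] (2 * ℓ * turán-size q N c) + q * (ℓ * ℓ)
      ≡⟨ cong (λ s → turán-squares N + s + q * (ℓ * ℓ)) (trans (∑-*ˡ (allFin q) (2 * ℓ) (turán-size q N)) (cong (2 * ℓ *_) (∑-turán-size N))) ⟩
    turán-squares N + 2 * ℓ * N + q * (ℓ * ℓ) ∎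
    where
    open ≡-Reasoning
    expand : ∀ s ℓ → (s + ℓ) * (s + ℓ) ≡ s * s + 2 * ℓ * s + ℓ * ℓ
    expand = solve-∀

  turán-squares-≤ : ∀ N → q * turán-squares N ≤ (N + q) * N
  turán-squares-≤ N = begin
    q * turán-squares N
      ≡⟨ sym (∑-*ˡ (allFin q) q _) ⟩
    ∑[ c ← allFin q ] (q * (turán-size q N c * turán-size q N c))
      ≤⟨ ∑-mono (allFin q) (λ {c} _ → ℕₚ.≤-trans (ℕₚ.≤-reflexive (sym (ℕₚ.*-assoc q _ _))) (ℕₚ.*-monoˡ-≤ (turán-size q N c) (bound c))) ⟩
    ∑[ c ← allFin q ] ((N + q) * turán-size q N c)
      ≡⟨ trans (∑-*ˡ (allFin q) (N + q) _) (cong ((N + q) *_) (∑-turán-size N)) ⟩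
    (N + q) * N ∎
    where
    open ℕₚ.≤-Reasoning
    bound : ∀ c → q * turán-size q N c ≤ N + q
    bound c = begin
      q * turán-size q N c                ≡⟨ trans (cong (q *_) (residue-partSize q c N)) (ℕₚ.*-comm q _) ⟩
      (N + co c) / q * q                  ≤⟨ m/n*n≤m (N + co c) q ⟩
      N + co c                            ≤⟨ ℕₚ.+-monoʳ-≤ N (ℕₚ.m∸n≤m q (suc (toℕ c))) ⟩
      N + q                               ∎

  turán-squares-minimal : ∀ N (x : Fin q → ℕ) → ∑ (allFin q) x ≡ N → turán-squares N ≤ ∑[ c ← allFin q ] (x c * x c)
  turán-squares-minimal N x total = ℕₚ.+-cancelʳ-≤ (q * (N / q * (N / q + 1))) _ _ (begin
    turán-squares N + q * (N / q * (N / q + 1))                     ≡⟨ squares-balanced (N / q) (turán-size q N) (turán-size-two N) ⟩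
    (2 * (N / q) + 1) * ∑ (allFin q) (turán-size q N)               ≡⟨ cong ((2 * (N / q) + 1) *_) (trans (∑-turán-size N) (sym total)) ⟩
    (2 * (N / q) + 1) * ∑ (allFin q) x                              ≤⟨ squares-≥ (N / q) x ⟩
    ∑[ c ← allFin q ] (x c * x c) + q * (N / q * (N / q + 1))       ∎)
    where open ℕₚ.≤-Reasoning

  turán-squares-unique : ∀ N (x : Fin q → ℕ) → ∑ (allFin q) x ≡ N → ∑[ c ← allFin q ] (x c * x c) ≤ turán-squares N →
    Σ[ π ∈ Perm.Permutation q q ] (∀ c → turán-size q N (Inverse.to π c) ≡ x c)
  turán-squares-unique N x total le = fibres⇒permutation ℕ._≟_ x (turán-size q N)
    (two-valued-fibres (N / q) x (turán-size q N) (squares-tight (N / q) x tight) (turán-size-two N)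
      (trans total (sym (∑-turán-size N))))
    where
    open ℕₚ.≤-Reasoning
    tight : ∑[ c ← allFin q ] (x c * x c) + q * (N / q * (N / q + 1)) ≤ (2 * (N / q) + 1) * ∑ (allFin q) x
    tight = begin
      ∑[ c ← allFin q ] (x c * x c) + q * (N / q * (N / q + 1))     ≤⟨ ℕₚ.+-monoˡ-≤ _ le ⟩
      turán-squares N + q * (N / q * (N / q + 1))                   ≡⟨ squares-balanced (N / q) (turán-size q N) (turán-size-two N) ⟩
      (2 * (N / q) + 1) * ∑ (allFin q) (turán-size q N)             ≡⟨ cong ((2 * (N / q) + 1) *_) (trans (∑-turán-size N) (sym total)) ⟩
      (2 * (N / q) + 1) * ∑ (allFin q) x                            ∎

↑ˡ≢↑ʳ : ∀ {a b} (i : Fin a) (j : Fin b) → i ↑ˡ b ≢ a ↑ʳ j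
↑ˡ≢↑ʳ {a} {b} i j eq with trans (sym (Finₚ.splitAt-↑ˡ a i b)) (trans (cong (splitAt a) eq) (Finₚ.splitAt-↑ʳ a b j))
... | ()

-- The apexes form singleton classes, which makes K_a ∨ T_{N,q} complete multipartite.
module _ (a N q : ℕ) .{{_ : NonZero q}} where

  target-tag : Fin a ⊎ Fin N → Fin (a + q)
  target-tag (inj₁ z) = z ↑ˡ q
  target-tag (inj₂ v) = a ↑ʳ residue N q v

  target-colour : Fin (a + N) → Fin (a + q)
  target-colour i = target-tag (splitAt a i)

  target-adjacent : ∀ x y → Adj (K a ∨ T N q) x y ⇔ target-colour x ≢ target-colour y
  target-adjacent x y = mk⇔ (to (splitAt a x) (splitAt a y)) (from (splitAt a x) (splitAt a y))
    where
    to : ∀ u v → JoinAdj (K a) (T N q) u v → target-tag u ≢ target-tag v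
    to (inj₁ u) (inj₁ v) u≢v  = u≢v ∘ Finₚ.↑ˡ-injective q u v
    to (inj₁ u) (inj₂ v) _    = ↑ˡ≢↑ʳ u (residue N q v)
    to (inj₂ u) (inj₁ v) _    = ↑ˡ≢↑ʳ v (residue N q u) ∘ sym
    to (inj₂ u) (inj₂ v) ne   = ne ∘ Finₚ.↑ʳ-injective a (residue N q u) (residue N q v)
    from : ∀ u v → target-tag u ≢ target-tag v → JoinAdj (K a) (T N q) u v
    from (inj₁ u) (inj₁ v) ne = ne ∘ cong (_↑ˡ q)
    from (inj₁ u) (inj₂ v) ne = tt
    from (inj₂ u) (inj₁ v) ne = tt
    from (inj₂ u) (inj₂ v) ne = ne ∘ cong (a ↑ʳ_)

  private
    ∑-split : ∀ c → class-size target-colour c ≡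
              ∑[ i ← allFin a ] 𝟙 (i ↑ˡ q Finₚ.≟ c) + ∑[ v ← allFin N ] 𝟙 (a ↑ʳ residue N q v Finₚ.≟ c)
    ∑-split c = trans (∑-allFin-+ a N (λ i → 𝟙 (target-colour i Finₚ.≟ c))) (cong₂ _+_
      (∑-cong (allFin a) (λ {i} _ → cong (λ s → 𝟙 (target-tag s Finₚ.≟ c)) (Finₚ.splitAt-↑ˡ a i N)))
      (∑-cong (allFin N) (λ {v} _ → cong (λ s → 𝟙 (target-tag s Finₚ.≟ c)) (Finₚ.splitAt-↑ʳ a N v))))

  class-size-apex : ∀ z → class-size target-colour (z ↑ˡ q) ≡ 1
  class-size-apex z = trans (∑-split (z ↑ˡ q)) (cong₂ _+_
    (trans (∑-cong (allFin a) (λ {i} _ → 𝟙-cong (i ↑ˡ q Finₚ.≟ z ↑ˡ q) (i Finₚ.≟ z) (Finₚ.↑ˡ-injective q i z) (cong (_↑ˡ q)))) (∑-δ z))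
    (trans (∑-cong (allFin N) (λ {v} _ → 𝟙-no (a ↑ʳ residue N q v Finₚ.≟ z ↑ˡ q) (↑ˡ≢↑ʳ z (residue N q v) ∘ sym)))
      (trans (∑-allFin-const N 0) (ℕₚ.*-zeroʳ N))))

  class-size-turán : ∀ c → class-size target-colour (a ↑ʳ c) ≡ turán-size q N c
  class-size-turán c = trans (∑-split (a ↑ʳ c)) (trans (cong₂ _+_
    (trans (∑-cong (allFin a) (λ {i} _ → 𝟙-no (i ↑ˡ q Finₚ.≟ a ↑ʳ c) (↑ˡ≢↑ʳ i c))) (trans (∑-allFin-const a 0) (ℕₚ.*-zeroʳ a)))
    (∑-cong (allFin N) (λ {v} _ → 𝟙-cong (a ↑ʳ residue N q v Finₚ.≟ a ↑ʳ c) (residue N q v Finₚ.≟ c) (Finₚ.↑ʳ-injective a _ _) (cong (a ↑ʳ_)))))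
    (sym (turán-size-class q N c)))

  squares-split : ∀ {n} (d : Fin n → Fin (a + q)) (s : Fin q → ℕ) → (∀ z → class-size d (z ↑ˡ q) ≡ 1) →
                  (∀ c → class-size d (a ↑ʳ c) ≡ s c) → squares d ≡ a + ∑[ c ← allFin q ] (s c * s c)
  squares-split d s one eq = trans (∑-allFin-+ a q (λ c → class-size d c * class-size d c)) (cong₂ _+_
    (trans (∑-cong (allFin a) (λ {z} _ → cong (λ m → m * m) (one z))) (trans (∑-allFin-const a 1) (ℕₚ.*-identityʳ a)))
    (∑-cong (allFin q) (λ {c} _ → cong (λ m → m * m) (eq c))))

  size-target : size (K a ∨ T N q) + (a + turán-squares q N) ≡ (a + N) * (a + N)
  size-target = trans (cong (size (K a ∨ T N q) +_) (sym (squares-split target-colour (turán-size q N) class-size-apex class-size-turán)))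
    (complete⇒size (K a ∨ T N q) target-colour target-adjacent)

module _ {n : ℕ} {q : ℕ} .{{_ : NonZero q}} (zs : List (Fin n)) (distinct : Unique zs) where
  open import Data.List.Relation.Unary.Any using (index)
  open import Data.List.Relation.Unary.Any.Properties using (lookup-index)

  private
    a = length zs

  apex-colour : (Fin n → Fin q) → Fin n → Fin (a + q)
  apex-colour cl x with x ∈? zs
  ... | yes x∈ = index x∈ ↑ˡ q
  ... | no _   = a ↑ʳ cl x

  outer-size : (Fin n → Fin q) → Fin q → ℕ
  outer-size cl c = ∑[ x ← allFin n ] 𝟙 (¬? (x ∈? zs) ×-dec (cl x Finₚ.≟ c))

  apex-colour-apex : ∀ cl z → class-size (apex-colour cl) (z ↑ˡ q) ≡ 1
  apex-colour-apex cl z = trans (∑-cong (allFin n) (λ {x} _ → 𝟙-cong (apex-colour cl x Finₚ.≟ z ↑ˡ q) (x Finₚ.≟ lookup zs z) (to x) (from x)))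
    (∑-δ (lookup zs z))
    where
    to : ∀ x → apex-colour cl x ≡ z ↑ˡ q → x ≡ lookup zs z
    to x eq with x ∈? zs
    ... | yes x∈ = trans (lookup-index x∈) (cong (lookup zs) (Finₚ.↑ˡ-injective q _ _ eq))
    ... | no _   = ⊥-elim (↑ˡ≢↑ʳ z (cl x) (sym eq))
    from : ∀ x → x ≡ lookup zs z → apex-colour cl x ≡ z ↑ˡ q
    from x eq with x ∈? zs
    ... | yes x∈ = cong (_↑ˡ q) (unique-index (trans (sym (lookup-index x∈)) eq))
      where
      unique-index : ∀ {i j} → lookup zs i ≡ lookup zs j → i ≡ j
      unique-index = lookup-injective distinct
    ... | no x∉  = ⊥-elim (x∉ (subst (_∈ zs) (sym eq) (∈ₚ.∈-lookup z)))

  apex-colour-outer : ∀ cl c → class-size (apex-colour cl) (a ↑ʳ c) ≡ outer-size cl c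
  apex-colour-outer cl c = ∑-cong (allFin n) (λ {x} _ →
      𝟙-cong (apex-colour cl x Finₚ.≟ a ↑ʳ c) (¬? (x ∈? zs) ×-dec (cl x Finₚ.≟ c)) (to x) (from x))
    where
    to : ∀ x → apex-colour cl x ≡ a ↑ʳ c → x ∉ zs × cl x ≡ c
    to x eq with x ∈? zs
    ... | yes x∈ = ⊥-elim (↑ˡ≢↑ʳ (index x∈) c eq)
    ... | no x∉  = x∉ , Finₚ.↑ʳ-injective a _ _ eq
    from : ∀ x → x ∉ zs × cl x ≡ c → apex-colour cl x ≡ a ↑ʳ c
    from x (x∉ , eq) with x ∈? zs
    ... | yes x∈ = ⊥-elim (x∉ x∈)
    ... | no _   = cong (a ↑ʳ_) eq

  outer-size-permute : ∀ cl (π : Perm.Permutation q q) c → outer-size (Inverse.to π ∘ cl) (Inverse.to π c) ≡ outer-size cl c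
  outer-size-permute cl π c = ∑-cong (allFin n) (λ {x} _ →
    𝟙-cong (¬? (x ∈? zs) ×-dec (Inverse.to π (cl x) Finₚ.≟ Inverse.to π c)) (¬? (x ∈? zs) ×-dec (cl x Finₚ.≟ c))
      (λ (x∉ , eq) → x∉ , Injection.injective (↔⇒↣ π) eq) (λ (x∉ , eq) → x∉ , cong (Inverse.to π) eq))

  ∑-outer-size : ∀ cl {N} → n ≡ a + N → ∑ (allFin q) (outer-size cl) ≡ N
  ∑-outer-size cl {N} n≡ = ℕₚ.+-cancelˡ-≡ a _ _ (begin
    a + ∑ (allFin q) (outer-size cl)
      ≡⟨ cong₂ _+_ (sym (trans (∑-cong (allFin a) (λ {z} _ → apex-colour-apex cl z)) (trans (∑-allFin-const a 1) (ℕₚ.*-identityʳ a))))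
           (∑-cong (allFin q) (λ {c} _ → sym (apex-colour-outer cl c))) ⟩
    ∑[ z ← allFin a ] class-size (apex-colour cl) (z ↑ˡ q) + ∑[ c ← allFin q ] class-size (apex-colour cl) (a ↑ʳ c)
      ≡⟨ sym (∑-allFin-+ a q (class-size (apex-colour cl))) ⟩
    ∑[ c ← allFin (a + q) ] class-size (apex-colour cl) c
      ≡⟨ ∑-class-size (apex-colour cl) ⟩
    n ≡⟨ n≡ ⟩
    a + N ∎)
    where open ≡-Reasoning

  module _ (G : Graph n) where

    apex-colour-proper : ∀ cl → (∀ {x y} → x ∉ zs → y ∉ zs → cl x ≡ cl y → ¬ Adj G x y) →
                         ∀ {x y} → Adj G x y → apex-colour cl x ≢ apex-colour cl y
    apex-colour-proper cl indep {x} {y} xy eq with x ∈? zs | y ∈? zs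
    ... | yes x∈ | yes y∈ = Graph.irrefl G (trans (lookup-index x∈)
            (trans (cong (lookup zs) (Finₚ.↑ˡ-injective q _ _ eq)) (sym (lookup-index y∈)))) xy
    ... | yes x∈ | no _   = ↑ˡ≢↑ʳ (index x∈) (cl y) eq
    ... | no _   | yes y∈ = ↑ˡ≢↑ʳ (index y∈) (cl x) (sym eq)
    ... | no x∉  | no y∉  = indep x∉ y∉ (Finₚ.↑ʳ-injective a _ _ eq) xy

    rigid⇒target : ∀ cl → (∀ {x y} → x ∉ zs → y ∉ zs → cl x ≡ cl y → ¬ Adj G x y) →
                   ∀ {N} → n ≡ a + N → ∀ {x} → n * n + x ≤ size G + (a + turán-squares q N) →
                   x ≡ 0 × G ≅ (K a ∨ T N q)
    rigid⇒target cl indep {N} n≡ {x} large = x≡0 , π′ , λ u v → mk⇔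
        (λ uv → Equivalence.from (target-adjacent a N q _ _)
           (λ eq → proper′ uv (trans (sym (π′ok u)) (trans eq (π′ok v)))))
        (λ fuv → tight⇒adjacent G (apex-colour cl′) proper′ tight
           (λ eq → Equivalence.to (target-adjacent a N q _ _) fuv (trans (π′ok u) (trans eq (sym (π′ok v))))))
      where
      s = outer-size cl
      S = ∑[ c ← allFin q ] (s c * s c)
      upper : size G + (a + S) ≤ n * n
      upper = subst (λ m → size G + m ≤ n * n)
        (squares-split a N q (apex-colour cl) s (apex-colour-apex cl) (apex-colour-outer cl))
        (size+squares≤ G (apex-colour cl) (apex-colour-proper cl indep))
      S+x≤ : S + x ≤ turán-squares q N
      S+x≤ = ≤-cancel (size G + a + n * n) (ℕₚ.+-mono-≤ upper large)
        (l S x (size G) a (n * n)) (r (n * n) (size G) a (turán-squares q N))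
        where
        l : ∀ S x g a m → S + x + (g + a + m) ≡ g + (a + S) + (m + x)
        l = solve-∀
        r : ∀ m g a t → m + (g + (a + t)) ≡ t + (g + a + m)
        r = solve-∀
      x≡0 : x ≡ 0
      x≡0 = ℕₚ.n≤0⇒n≡0 (ℕₚ.+-cancelˡ-≤ S x 0 (ℕₚ.≤-trans S+x≤
        (ℕₚ.≤-trans (turán-squares-minimal q N s (∑-outer-size cl n≡)) (ℕₚ.≤-reflexive (sym (ℕₚ.+-identityʳ S))))))
      perm = turán-squares-unique q N s (∑-outer-size cl n≡) (ℕₚ.≤-trans (ℕₚ.m≤m+n S x) S+x≤)
      π = proj₁ perm
      cl′ = Inverse.to π ∘ cl
      outer′ : ∀ c → outer-size cl′ c ≡ turán-size q N c
      outer′ c = subst (λ c → outer-size cl′ c ≡ turán-size q N c) (Inverse.strictlyInverseˡ π c)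
        (trans (outer-size-permute cl π (Inverse.from π c)) (sym (proj₂ perm (Inverse.from π c))))
      proper′ : ∀ {x y} → Adj G x y → apex-colour cl′ x ≢ apex-colour cl′ y
      proper′ = apex-colour-proper cl′ (λ x∉ y∉ eq → indep x∉ y∉ (Injection.injective (↔⇒↣ π) eq))
      sizes′ : ∀ c → class-size (apex-colour cl′) (a ↑ʳ c) ≡ turán-size q N c
      sizes′ c = trans (apex-colour-outer cl′ c) (outer′ c)
      tight : n * n ≤ size G + squares (apex-colour cl′)
      tight = ℕₚ.≤-trans (ℕₚ.m≤m+n (n * n) x) (subst (λ m → n * n + x ≤ size G + m)
        (sym (squares-split a N q (apex-colour cl′) (turán-size q N) (apex-colour-apex cl′) sizes′)) large)
      fibres : ∀ c → class-size (apex-colour cl′) c ≡ class-size (target-colour a N q) c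
      fibres c with splitAt a c in eq
      ... | inj₁ z = subst (λ c → class-size (apex-colour cl′) c ≡ class-size (target-colour a N q) c)
                       (Finₚ.splitAt⁻¹-↑ˡ eq) (trans (apex-colour-apex cl′ z) (sym (class-size-apex a N q z)))
      ... | inj₂ v = subst (λ c → class-size (apex-colour cl′) c ≡ class-size (target-colour a N q) c)
                       (Finₚ.splitAt⁻¹-↑ʳ eq) (trans (sizes′ v) (sym (class-size-turán a N q v)))
      perm′ = fibres⇒bijection Finₚ._≟_ n≡ (apex-colour cl′) (target-colour a N q) fibres
      π′ = proj₁ perm′
      π′ok = proj₂ perm′

-- The progressive induction step

-- ladder i is the part size kept while i apexes are still missing; trimmed j and slack j are
-- the part size after removing a cover and the tolerated number of missing neighbours.
record Scales (k Q t : ℕ) : Set where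
  field
    ladder trimmed slack : ℕ → ℕ
    base     : k + 2 * t * 1 ≤ ladder 0
    positive : ∀ i → 1 ≤ ladder i
    monotone : ∀ {i j} → i ≤ j → ladder i ≤ ladder j
    large    : ∀ j → k + 2 * t * suc (slack j) ≤ ladder (suc j)
    ℓ-small  : ∀ j → suc (Q * 2 * ladder j) ≤ trimmed j
    trim     : ∀ {j} → j < t → trimmed j + Q * (2 * j) ≤ ladder (suc j)
    w-large  : ∀ j → ladder (suc j) + ladder j ≤ trimmed j + slack j

scales : ∀ k Q t → Scales k Q t
scales k Q t = record
  { ladder   = ladder
  ; trimmed  = λ j → scale * ladder j
  ; slack    = λ j → (Q * 2 * t + 1) * ladder j
  ; base     = ℕₚ.n≤1+n _
  ; positive = positive
  ; monotone = monotone
  ; large    = λ j → large (ladder j) (positive j)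
  ; ℓ-small  = λ j → ℕₚ.≤-trans (ℕₚ.+-monoˡ-≤ (Q * 2 * ladder j) (positive j))
                 (ℕₚ.*-monoˡ-≤ (ladder j) (ℕₚ.m≤n+m (suc (Q * 2)) (k + 2 * t * (Q * 2 * t + 2))))
  ; trim     = λ {j} → trim (ladder j) j (positive j)
  ; w-large  = λ j → ℕₚ.≤-reflexive (arith scale (Q * 2 * t) (ladder j))
  }
  where
  scale : ℕ
  scale = k + 2 * t * (Q * 2 * t + 2) + suc (Q * 2)
  ladder : ℕ → ℕ
  ladder zero    = suc (k + 2 * t * 1)
  ladder (suc i) = (scale + Q * 2 * t) * ladder i
  1≤factor : 1 ≤ scale + Q * 2 * t
  1≤factor = ℕₚ.≤-trans (ℕₚ.≤-trans (s≤s z≤n) (ℕₚ.m≤n+m (suc (Q * 2)) _)) (ℕₚ.m≤m+n scale _)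
  positive : ∀ i → 1 ≤ ladder i
  positive zero    = s≤s z≤n
  positive (suc i) = ℕₚ.*-mono-≤ {1} {scale + Q * 2 * t} 1≤factor (positive i)
  monotone : ∀ {i j} → i ≤ j → ladder i ≤ ladder j
  monotone {i} i≤j = subst (λ j → ladder i ≤ ladder j) (ℕₚ.m+[n∸m]≡n i≤j) (up (_ ∸ i))
    where
    up : ∀ d → ladder i ≤ ladder (i + d)
    up zero    = ℕₚ.≤-reflexive (cong ladder (sym (ℕₚ.+-identityʳ i)))
    up (suc d) = subst (λ m → ladder i ≤ ladder m) (sym (ℕₚ.+-suc i d))
      (ℕₚ.≤-trans (up d) (ℕₚ.m≤n*m (ladder (i + d)) (scale + Q * 2 * t) {{ℕ.>-nonZero 1≤factor}}))
  scaled : ∀ {ℓ} → 1 ≤ ℓ → ∀ m → m ≤ m * ℓ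
  scaled {ℓ} 1≤ℓ m = ℕₚ.m≤m*n m ℓ {{ℕ.>-nonZero 1≤ℓ}}
  large : ∀ ℓ → 1 ≤ ℓ → k + 2 * t * suc ((Q * 2 * t + 1) * ℓ) ≤ (scale + Q * 2 * t) * ℓ
  large ℓ 1≤ℓ = begin
    k + 2 * t * suc w                                               ≤⟨ ℕₚ.+-mono-≤ (scaled 1≤ℓ k) (ℕₚ.*-monoʳ-≤ (2 * t) (ℕₚ.+-monoˡ-≤ w 1≤ℓ)) ⟩
    k * ℓ + 2 * t * (ℓ + w)                                         ≤⟨ ℕₚ.m≤m+n _ ((suc (Q * 2) + Q * 2 * t) * ℓ) ⟩
    k * ℓ + 2 * t * (ℓ + w) + (suc (Q * 2) + Q * 2 * t) * ℓ         ≡⟨ expand k (2 * t) (Q * 2 * t) (suc (Q * 2)) ℓ ⟩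
    (scale + Q * 2 * t) * ℓ                                         ∎
    where
    open ℕₚ.≤-Reasoning
    w = (Q * 2 * t + 1) * ℓ
    expand : ∀ k u v z ℓ → k * ℓ + u * (ℓ + (v + 1) * ℓ) + (z + v) * ℓ ≡ (k + u * (v + 2) + z + v) * ℓ
    expand = solve-∀
  trim : ∀ ℓ j → 1 ≤ ℓ → j < t → scale * ℓ + Q * (2 * j) ≤ (scale + Q * 2 * t) * ℓ
  trim ℓ j 1≤ℓ j<t = begin
    scale * ℓ + Q * (2 * j)         ≤⟨ ℕₚ.+-monoʳ-≤ (scale * ℓ) (ℕₚ.≤-trans (ℕₚ.≤-reflexive (sym (ℕₚ.*-assoc Q 2 j)))
                                         (ℕₚ.≤-trans (ℕₚ.*-monoʳ-≤ (Q * 2) (ℕₚ.<⇒≤ j<t)) (scaled 1≤ℓ (Q * 2 * t)))) ⟩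
    scale * ℓ + Q * 2 * t * ℓ       ≡⟨ sym (ℕₚ.*-distribʳ-+ ℓ scale (Q * 2 * t)) ⟩
    (scale + Q * 2 * t) * ℓ         ∎
    where open ℕₚ.≤-Reasoning
  arith : ∀ s v ℓ → (s + v) * ℓ + ℓ ≡ s * ℓ + (v + 1) * ℓ
  arith = solve-∀

module _ (k q a t : ℕ) (t≡1+a : t ≡ suc a) (sc : Scales k (suc q) t) where

  private
    Q step-bound : ℕ
    Q = suc q
    step-bound = Q * Scales.ladder sc t
    module Sc = Scales sc
    open Sc using (ladder)

  private
    threshold : ℕ
    threshold = (2 * q + 1) * Q * suc a

    1≤threshold : 1 ≤ threshold
    1≤threshold = ℕₚ.*-mono-≤ {1} {(2 * q + 1) * Q} {1} {suc a}
      (ℕₚ.*-mono-≤ {1} {2 * q + 1} {1} {Q} (ℕₚ.m≤n+m 1 (2 * q)) (s≤s z≤n)) (s≤s z≤n)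

    sparse-complement : ∀ N σ → threshold ≤ N → Q * σ ≤ (N + Q) * N →
                        (2 * q + 1) * (a + σ) ≤ 2 * ((a + N) * (a + N))
    sparse-complement N σ N≥ σ≤ = ℕₚ.*-cancelˡ-≤ Q (begin
      Q * (c * (a + σ))                                 ≡⟨ l Q c a σ ⟩
      c * Q * a + c * (Q * σ)                           ≤⟨ ℕₚ.+-mono-≤ (ℕₚ.m≤m*n (c * Q * a) N {{ℕ.>-nonZero (ℕₚ.≤-trans 1≤threshold N≥)}}) (ℕₚ.*-monoʳ-≤ c σ≤) ⟩
      c * Q * a * N + c * ((N + Q) * N)                 ≡⟨ m c Q a N ⟩
      c * (N * N) + c * Q * suc a * N                   ≤⟨ ℕₚ.+-monoʳ-≤ (c * (N * N)) (ℕₚ.*-monoˡ-≤ N N≥) ⟩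
      c * (N * N) + N * N                               ≡⟨ r q N ⟩
      Q * (2 * (N * N))                                 ≤⟨ ℕₚ.*-monoʳ-≤ Q (ℕₚ.*-monoʳ-≤ 2 (ℕₚ.*-mono-≤ (ℕₚ.m≤n+m N a) (ℕₚ.m≤n+m N a))) ⟩
      Q * (2 * ((a + N) * (a + N)))                     ∎)
      where
      open ℕₚ.≤-Reasoning
      c = 2 * q + 1
      l : ∀ Q c a σ → Q * (c * (a + σ)) ≡ c * Q * a + c * (Q * σ)
      l = solve-∀
      m : ∀ c Q a N → c * Q * a * N + c * ((N + Q) * N) ≡ c * (N * N) + c * Q * suc a * N
      m = solve-∀
      r : ∀ q N → (2 * q + 1) * (N * N) + N * N ≡ suc q * (2 * (N * N))
      r = solve-∀

    dense : ∀ N S σ x → threshold ≤ N → Q * σ ≤ (N + Q) * N → (a + N) * (a + N) + x ≤ S + (a + σ) →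
            (2 * q + 1) * ((a + N) * (a + N)) ≤ (2 * q + 1) * S + 2 * ((a + N) * (a + N))
    dense N S σ x N≥ σ≤ hyp = begin
      c * ((a + N) * (a + N))                           ≤⟨ ℕₚ.*-monoʳ-≤ c (ℕₚ.≤-trans (ℕₚ.m≤m+n _ x) hyp) ⟩
      c * (S + (a + σ))                                 ≡⟨ ℕₚ.*-distribˡ-+ c S (a + σ) ⟩
      c * S + c * (a + σ)                               ≤⟨ ℕₚ.+-monoʳ-≤ (c * S) (sparse-complement N σ N≥ σ≤) ⟩
      c * S + 2 * ((a + N) * (a + N))                   ∎
      where
      open ℕₚ.≤-Reasoning
      c = 2 * q + 1

  excess-grows : ∀ Λ N′ S S′ D σ′ x → let L = Q * Λ ; n′ = a + N′ ; n = L + n′ in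
    n * n + x ≤ S + (a + (σ′ + 2 * Λ * N′ + Q * (Λ * Λ))) →
    S + Q * Q * (Λ * Λ) ≤ S′ + 2 * D + Q * (Λ * Λ) →
    D + n * Λ < n * L + a * Λ →
    n′ * n′ + suc x ≤ S′ + (a + σ′)
  excess-grows Λ N′ S S′ D σ′ x hyp removed gain = ≤-cancel
    (Q * Λ * (Q * Λ) + 2 * (Q * Λ * (a + N′)) + S + Q * Q * (Λ * Λ) + 2 * (D + (Q * Λ + (a + N′)) * Λ) + 1)
    (ℕₚ.+-mono-≤ (ℕₚ.+-mono-≤ (ℕₚ.+-mono-≤ hyp removed) (ℕₚ.*-monoʳ-≤ 2 gain)) (z≤n {1}))
    (l Q Λ (a + N′) S D x (Q * Q * (Λ * Λ))) (r Q Λ a N′ S S′ D σ′)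
    where
    l : ∀ Q Λ n′ S D x z → n′ * n′ + suc x + (Q * Λ * (Q * Λ) + 2 * (Q * Λ * n′) + S + z + 2 * (D + (Q * Λ + n′) * Λ) + 1) ≡
        (Q * Λ + n′) * (Q * Λ + n′) + x + (S + z) + 2 * suc (D + (Q * Λ + n′) * Λ) + 0
    l = solve-∀
    r : ∀ Q Λ a N′ S S′ D σ′ →
        S + (a + (σ′ + 2 * Λ * N′ + Q * (Λ * Λ))) + (S′ + 2 * D + Q * (Λ * Λ)) + 2 * ((Q * Λ + (a + N′)) * (Q * Λ) + a * Λ) + 1 ≡
        S′ + (a + σ′) + (Q * Λ * (Q * Λ) + 2 * (Q * Λ * (a + N′)) + S + Q * Q * (Λ * Λ) + 2 * (D + (Q * Λ + (a + N′)) * Λ) + 1)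
    r = solve-∀

  module _ {F : Graph k} (A : AlmostColouring F q t) where

    Excess : ℕ → ℕ → Set₁
    Excess n x = Σ[ G ∈ Graph n ] Free F G × (∃[ N ] n ≡ a + N × n * n + x ≤ size G + (a + turán-squares Q N))

    simonovits-stage : ∀ {n} → step-bound + a ≤ n → (G : Graph n) (free : Free F G) → ∀ N → n ≡ a + N → ∀ x →
      n * n + x ≤ size G + (a + turán-squares Q N) →
      ∀ j → j < t → (P : Parts G Q (ladder (suc j))) (Z : Apexes A free P (suc j)) →
      (∀ {v} → v ∉ Apexes.apexes Z → ∃[ c ] deg G v (Parts.part P c) < ladder j) →
      (x ≡ 0 × G ≅ (K a ∨ T N Q)) ⊎ (∃[ n′ ] n′ < n × n ≤ n′ + step-bound × Excess n′ (suc x))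
    simonovits-stage {n} n≥ G free N n≡ x hyp j j<t P Z poor =
      decide (gain-or-rigid A free P Z class deg<ℓ (Sc.large j) (Sc.ℓ-small j) (Sc.trim j<t) (Sc.w-large j) a t≡1+a)
      where
      open Apexes Z
      Λ′ = Sc.trimmed j
      class : Fin n → Fin Q
      class v with v ∈? apexes
      ... | yes _ = zero
      ... | no v∉ = proj₁ (poor v∉)
      deg<ℓ : ∀ {v} → v ∉ apexes → deg G v (Parts.part P (class v)) < ladder j
      deg<ℓ {v} v∉ with v ∈? apexes
      ... | yes v∈ = ⊥-elim (v∉ v∈)
      ... | no v∉′ = proj₂ (poor v∉′)
      Core = core A free P Z class deg<ℓ (Sc.large j) (Sc.ℓ-small j) (Sc.trim j<t) (Sc.w-large j)
      open Parts Core using (vertices; vertices-unique; remainder; length-remainder; size-remainder)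
      decide : _ → (x ≡ 0 × G ≅ (K a ∨ T N Q)) ⊎ (∃[ n′ ] n′ < n × n ≤ n′ + step-bound × Excess n′ (suc x))
      decide (inj₂ (j≡0 , near)) = inj₁ (subst (λ b → x ≡ 0 × G ≅ (K b ∨ T N Q)) b≡a
          (rigid⇒target apexes distinct G class
            (rigid-independent A free P Z class deg<ℓ (Sc.large j) (Sc.ℓ-small j) (Sc.trim j<t) (Sc.w-large j) j≡0 near)
            (trans n≡ (cong (_+ N) (sym b≡a)))
            (subst (λ b → n * n + x ≤ size G + (b + turán-squares Q N)) (sym b≡a) hyp)))
        where
        b≡a : length apexes ≡ a
        b≡a = ℕₚ.suc-injective (trans (ℕₚ.+-comm 1 (length apexes)) (trans (cong (λ j → length apexes + suc j) (sym j≡0)) (trans number t≡1+a)))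
      decide (inj₁ gain) = inj₂ (n′ , n′<n , n≤n′+D , remainder , induced-free G {F = F} (Unique-rest vertices) free , N′ , n′≡ ,
          subst (λ m → m * m + suc x ≤ size remainder + (a + turán-squares Q N′)) (sym n′≡)
            (excess-grows Λ′ N′ (size G) (size remainder) (∑[ v ← allFin n ] deg G v vertices) (turán-squares Q N′) x
              (subst₂ (λ m s → m * m + x ≤ size G + (a + s)) n≡′ (trans (cong (turán-squares Q) N≡) (turán-squares-+ Q N′ Λ′)) hyp)
              size-remainder
              (subst (λ m → ∑[ v ← allFin n ] deg G v vertices + m * Λ′ < m * (Q * Λ′) + a * Λ′) n≡′ gain)))
        where
        n′ = length (rest vertices)
        QΛ′≤D : Q * Λ′ ≤ step-bound
        QΛ′≤D = ℕₚ.*-monoʳ-≤ Q (ℕₚ.≤-trans (ℕₚ.≤-trans (ℕₚ.m≤m+n Λ′ _) (Sc.trim j<t)) (Sc.monotone j<t))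
        n≤n′+D : n ≤ n′ + step-bound
        n≤n′+D = subst (_≤ n′ + step-bound) (trans (ℕₚ.+-comm n′ (Q * Λ′)) length-remainder) (ℕₚ.+-monoʳ-≤ n′ QΛ′≤D)
        n′<n : n′ < n
        n′<n = subst (n′ <_) length-remainder (ℕₚ.m<n+m n′ (ℕₚ.*-mono-≤ {1} {Q} {1} {Λ′} (s≤s z≤n) (ℕₚ.≤-trans (s≤s z≤n) (Sc.ℓ-small j))))
        a≤n′ : a ≤ n′
        a≤n′ = ℕₚ.+-cancelʳ-≤ step-bound a n′ (ℕₚ.≤-trans (ℕₚ.≤-trans (ℕₚ.≤-reflexive (ℕₚ.+-comm a step-bound))
          n≥) n≤n′+D)
        N′ = n′ ∸ a
        n′≡ : n′ ≡ a + N′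
        n′≡ = sym (ℕₚ.m+[n∸m]≡n a≤n′)
        n≡′ : n ≡ Q * Λ′ + (a + N′)
        n≡′ = trans (sym length-remainder) (cong (Q * Λ′ +_) n′≡)
        N≡ : N ≡ N′ + Q * Λ′
        N≡ = ℕₚ.+-cancelˡ-≡ a N (N′ + Q * Λ′) (trans (sym n≡) (trans n≡′ (arith (Q * Λ′) a N′)))
          where
          arith : ∀ l a N → l + (a + N) ≡ a + (N + l)
          arith = solve-∀

    module _ (n₁ : ℕ) (find : ∀ {n} → n₁ ≤ n → (G : Graph n) → Dense q G → Parts G Q (ladder t)) where

      private
        n₀ : ℕ
        n₀ = n₁ + (step-bound + (a + threshold))

      simonovits-step : ∀ {n} → n₀ ≤ n → (G : Graph n) → Free F G → ∀ N → n ≡ a + N → ∀ x →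
        n * n + x ≤ size G + (a + turán-squares Q N) →
        (x ≡ 0 × G ≅ (K a ∨ T N Q)) ⊎ (∃[ n′ ] n′ < n × n ≤ n′ + step-bound × Excess n′ (suc x))
      simonovits-step {n} n≥ G free N n≡ x hyp =
        let j , j<t , P , Z , poor = apex-search A free ladder Sc.base t P₀ Z₀
        in simonovits-stage (ℕₚ.≤-trans (ℕₚ.+-monoʳ-≤ step-bound (ℕₚ.m≤m+n a threshold)) n≥₁)
             G free N n≡ x hyp j j<t P Z poor
        where
        n≥₁ : step-bound + (a + threshold) ≤ n
        n≥₁ = ℕₚ.≤-trans (ℕₚ.m≤n+m _ n₁) n≥
        N≥ : threshold ≤ N
        N≥ = ℕₚ.+-cancelˡ-≤ a threshold N (subst (a + threshold ≤_) n≡ (ℕₚ.≤-trans (ℕₚ.m≤n+m _ step-bound) n≥₁))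
        P₀ : Parts G Q (ladder t)
        P₀ = find (ℕₚ.≤-trans (ℕₚ.m≤m+n n₁ _) n≥) G
          (subst (λ n → (2 * q + 1) * (n * n) ≤ (2 * q + 1) * size G + 2 * (n * n)) (sym n≡)
            (dense N (size G) (turán-squares Q N) x N≥ (turán-squares-≤ Q N)
              (subst (λ n → n * n + x ≤ size G + (a + turán-squares Q N)) n≡ hyp)))
        Z₀ : Apexes A free P₀ t
        Z₀ = record { apexes = [] ; distinct = [] ; number = refl ; full = λ () }

      private
        excess-bound : ∀ {n x} → Excess n (suc x) → x ≤ 4 * (n * n)
        excess-bound {n} {x} (G , _ , N , refl , hyp) = begin
          x                                       ≤⟨ ℕₚ.≤-trans (ℕₚ.n≤1+n x) (ℕₚ.m≤n+m (suc x) _) ⟩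
          (a + N) * (a + N) + suc x               ≤⟨ hyp ⟩
          size G + (a + turán-squares Q N)        ≤⟨ ℕₚ.+-mono-≤ (size≤ G) (ℕₚ.+-mono-≤ (square a N) squares≤) ⟩
          m + (m + 2 * (N * N))                   ≤⟨ ℕₚ.+-monoʳ-≤ m (ℕₚ.+-monoʳ-≤ m (ℕₚ.*-monoʳ-≤ 2 (ℕₚ.*-mono-≤ (ℕₚ.m≤n+m N a) (ℕₚ.m≤n+m N a)))) ⟩
          m + (m + 2 * m)                         ≡⟨ arith m ⟩
          4 * m                                   ∎
          where
          open ℕₚ.≤-Reasoning
          m = (a + N) * (a + N)
          arith : ∀ m → m + (m + 2 * m) ≡ 4 * m
          arith = solve-∀
          square : ∀ a N → a ≤ (a + N) * (a + N)
          square zero    N = z≤n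
          square (suc a) N = ℕₚ.≤-trans (ℕₚ.m≤m+n (suc a) N) (ℕₚ.m≤m*n (suc a + N) (suc a + N))
          squares≤ : turán-squares Q N ≤ 2 * (N * N)
          squares≤ = ℕₚ.*-cancelˡ-≤ Q (ℕₚ.≤-trans (turán-squares-≤ Q N) (bound N))
            where
            bound : ∀ N → (N + Q) * N ≤ Q * (2 * (N * N))
            bound zero    = ℕₚ.≤-reflexive (trans (ℕₚ.*-zeroʳ Q) (sym (ℕₚ.*-zeroʳ Q)))
            bound (suc N) = ℕₚ.≤-trans (ℕₚ.m≤m+n _ _) (ℕₚ.≤-reflexive (arith′ q N))
              where
              arith′ : ∀ q N → (suc N + suc q) * suc N + (q * (2 * N * suc N + suc N) + N * suc N) ≡ suc q * (2 * (suc N * suc N))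
              arith′ = solve-∀

      simonovits : ∃[ n₁ ] ∀ {n} → n₁ ≤ n → (G : Graph n) → Free F G → ∀ N → n ≡ a + N →
        n * n ≤ size G + (a + turán-squares Q N) → G ≅ (K a ∨ T N Q)
      simonovits = n₀ + (proj₁ ind + step-bound) , λ {n} n≥ G free N n≡ hyp →
        case simonovits-step (ℕₚ.≤-trans (ℕₚ.m≤m+n n₀ _) n≥) G free N n≡ 0 (subst (_≤ size G + (a + turán-squares Q N)) (sym (ℕₚ.+-identityʳ (n * n))) hyp) of λ
          { (inj₁ (_ , iso)) → iso
          ; (inj₂ (n′ , _ , n≤ , excess)) → ⊥-elim (proj₂ ind ⊥ (λ n x → Excess n (suc x)) excess-bound step
              (ℕₚ.+-cancelʳ-≤ step-bound (proj₁ ind) n′ (ℕₚ.≤-trans (ℕₚ.≤-trans (ℕₚ.m≤n+m _ n₀) n≥) n≤)) excess) }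
        where
        ind = progressive-induction 4 step-bound n₀
        step : ∀ {n x} → n₀ ≤ n → Excess n (suc x) → ⊥ ⊎ (∃[ n′ ] n′ < n × n ≤ n′ + step-bound × Excess n′ (suc (suc x)))
        step n≥ (G , free , N , n≡ , hyp) = drop-rigid (simonovits-step n≥ G free N n≡ _ hyp)
          where
          drop-rigid : ∀ {x} {B : Set} {D : Set₁} → (suc x ≡ 0 × B) ⊎ D → ⊥ ⊎ D
          drop-rigid (inj₂ next) = inj₂ next

-- Powers of cycles

-- Cyclic distance at most ℓ between positions u and v of C_k.
Within : ℕ → ℕ → ℕ → ℕ → Set
Within k ℓ u v = (u ≤ v + ℓ × v ≤ u + ℓ) ⊎ (u + k ≤ v + ℓ) ⊎ (v + k ≤ u + ℓ)

Within-sym : ∀ {k ℓ u v} → Within k ℓ u v → Within k ℓ v u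
Within-sym (inj₁ (x , y))  = inj₁ (y , x)
Within-sym (inj₂ (inj₁ x)) = inj₂ (inj₂ x)
Within-sym (inj₂ (inj₂ x)) = inj₂ (inj₁ x)

Within-mono : ∀ {k ℓ p u v} → ℓ ≤ p → Within k ℓ u v → Within k p u v
Within-mono {u = u} {v} ℓ≤p (inj₁ (x , y)) = inj₁ (ℕₚ.≤-trans x (ℕₚ.+-monoʳ-≤ v ℓ≤p) , ℕₚ.≤-trans y (ℕₚ.+-monoʳ-≤ u ℓ≤p))
Within-mono {u = u} {v} ℓ≤p (inj₂ (inj₁ x)) = inj₂ (inj₁ (ℕₚ.≤-trans x (ℕₚ.+-monoʳ-≤ v ℓ≤p)))
Within-mono {u = u} {v} ℓ≤p (inj₂ (inj₂ x)) = inj₂ (inj₂ (ℕₚ.≤-trans x (ℕₚ.+-monoʳ-≤ u ℓ≤p)))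

≤-step-+ : ∀ {x} y ℓ → x ≤ y + ℓ → x ≤ y + suc ℓ
≤-step-+ y ℓ le = ℕₚ.≤-trans le (ℕₚ.+-monoʳ-≤ y (ℕₚ.n≤1+n ℓ))

suc-≤-+ : ∀ {x} y ℓ → x ≤ y + ℓ → suc x ≤ y + suc ℓ
suc-≤-+ {x} y ℓ le = subst (suc x ≤_) (sym (ℕₚ.+-suc y ℓ)) (s≤s le)

Within-next : ∀ {k ℓ h v} → Within k ℓ (suc h) v → Within k (suc ℓ) h v
Within-next {k} {ℓ} {h} {v} (inj₁ (x , y)) = inj₁ (≤-step-+ v ℓ (ℕₚ.≤-trans (ℕₚ.n≤1+n h) x) , subst (v ≤_) (sym (ℕₚ.+-suc h ℓ)) y)
Within-next {k} {ℓ} {h} {v} (inj₂ (inj₁ x)) = inj₂ (inj₁ (≤-step-+ v ℓ (ℕₚ.≤-trans (ℕₚ.n≤1+n (h + k)) x)))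
Within-next {k} {ℓ} {h} {v} (inj₂ (inj₂ x)) = inj₂ (inj₂ (subst (v + k ≤_) (sym (ℕₚ.+-suc h ℓ)) x))

Within-previous : ∀ {k ℓ h v} → Within k ℓ h v → Within k (suc ℓ) (suc h) v
Within-previous {k} {ℓ} {h} {v} (inj₁ (x , y)) = inj₁ (suc-≤-+ v ℓ x , ℕₚ.≤-trans y (ℕₚ.+-mono-≤ (ℕₚ.n≤1+n h) (ℕₚ.n≤1+n ℓ)))
Within-previous {k} {ℓ} {h} {v} (inj₂ (inj₁ x)) = inj₂ (inj₁ (suc-≤-+ v ℓ x))
Within-previous {k} {ℓ} {h} {v} (inj₂ (inj₂ x)) = inj₂ (inj₂ (ℕₚ.≤-trans x (ℕₚ.+-mono-≤ (ℕₚ.n≤1+n h) (ℕₚ.n≤1+n ℓ))))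

Within-wrap : ∀ {ℓ h v} → v ≤ h → Within (suc h) ℓ 0 v → Within (suc h) (suc ℓ) h v
Within-wrap {ℓ} {h} {v} v≤h (inj₁ (_ , v≤ℓ)) = inj₂ (inj₂ (ℕₚ.≤-trans (ℕₚ.+-monoˡ-≤ (suc h) v≤ℓ)
  (ℕₚ.≤-reflexive (trans (ℕₚ.+-comm ℓ (suc h)) (sym (ℕₚ.+-suc h ℓ))))))
Within-wrap {ℓ} {h} {v} v≤h (inj₂ (inj₁ x)) = inj₁ (≤-step-+ v ℓ (ℕₚ.≤-trans (ℕₚ.n≤1+n h) x) , ℕₚ.≤-trans v≤h (ℕₚ.m≤m+n h (suc ℓ)))
Within-wrap {ℓ} {h} {v} v≤h (inj₂ (inj₂ x)) = inj₂ (inj₂ (ℕₚ.≤-trans x (ℕₚ.≤-trans (ℕₚ.n≤1+n ℓ) (ℕₚ.m≤n+m (suc ℓ) h))))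

Within-wrap⁻ : ∀ {ℓ h v} → v ≤ h → Within (suc h) ℓ h v → Within (suc h) (suc ℓ) 0 v
Within-wrap⁻ {ℓ} {h} {v} v≤h (inj₁ (h≤ , _)) = inj₂ (inj₁ (suc-≤-+ v ℓ h≤))
Within-wrap⁻ {ℓ} {h} {v} v≤h (inj₂ (inj₁ x)) = inj₂ (inj₁ (≤-step-+ v ℓ (ℕₚ.≤-trans (ℕₚ.m≤n+m (suc h) h) x)))
Within-wrap⁻ {ℓ} {h} {v} v≤h (inj₂ (inj₂ x)) = inj₁ (z≤n , v≤1+ℓ)
  where
  v≤1+ℓ : v ≤ suc ℓ
  v≤1+ℓ = ℕₚ.≤-trans (ℕₚ.+-cancelʳ-≤ h v ℓ (ℕₚ.≤-trans (ℕₚ.+-monoʳ-≤ v (ℕₚ.n≤1+n h))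
    (ℕₚ.≤-trans x (ℕₚ.≤-reflexive (ℕₚ.+-comm h ℓ))))) (ℕₚ.n≤1+n ℓ)

walk⇒Within : ∀ {k} ℓ {i j : Fin k} → Walk (C k) ℓ i j → Within k ℓ (toℕ i) (toℕ j)
walk⇒Within zero    refl = inj₁ (ℕₚ.m≤m+n _ 0 , ℕₚ.m≤m+n _ 0)
walk⇒Within {k} (suc ℓ) {i} {j} (h , (_ , step) , w) = case-step step (walk⇒Within ℓ w)
  where
  case-step : Next i h ⊎ Next h i → Within k ℓ (toℕ h) (toℕ j) → Within k (suc ℓ) (toℕ i) (toℕ j)
  case-step (inj₁ (inj₁ eq)) near = Within-next (subst (λ x → Within k ℓ x (toℕ j)) (sym eq) near)
  case-step (inj₂ (inj₁ eq)) near = subst (λ x → Within k (suc ℓ) x (toℕ j)) eq (Within-previous near)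
  case-step (inj₁ (inj₂ (i+1≡k , h≡0))) near = subst (λ k → Within k (suc ℓ) (toℕ i) (toℕ j)) i+1≡k
    (Within-wrap (s≤s⁻¹ (subst (toℕ j <_) (sym i+1≡k) (Finₚ.toℕ<n j)))
      (subst₂ (λ k x → Within k ℓ x (toℕ j)) (sym i+1≡k) h≡0 near))
  case-step (inj₂ (inj₂ (h+1≡k , i≡0))) near = subst₂ (λ k x → Within k (suc ℓ) x (toℕ j)) h+1≡k (sym i≡0)
    (Within-wrap⁻ (s≤s⁻¹ (subst (toℕ j <_) (sym h+1≡k) (Finₚ.toℕ<n j)))
      (subst (λ k → Within k ℓ (toℕ h) (toℕ j)) (sym h+1≡k) near))

adjacent⇒Within : ∀ {k} p {i j : Fin k} → Adj (C k ^ p) i j → Within k p (toℕ i) (toℕ j)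
adjacent⇒Within p (_ , ℓ , ℓ≤p , w) = Within-mono ℓ≤p (walk⇒Within ℓ w)

walk-++ : ∀ {n} (G : Graph n) a {b i h j} → Walk G a i h → Walk G b h j → Walk G (a + b) i j
walk-++ G zero    refl         w′ = w′
walk-++ G (suc a) (_ , ih , w) w′ = _ , ih , walk-++ G a w w′

walk-up : ∀ {k} d (i j : Fin k) → toℕ i + d ≡ toℕ j → Walk (C k) d i j
walk-up zero    i j eq = Finₚ.toℕ-injective (trans (sym (ℕₚ.+-identityʳ (toℕ i))) eq)
walk-up {k} (suc d) i j eq = h , ((λ i≡h → ℕₚ.1+n≢n (trans (sym h≡) (cong toℕ (sym i≡h)))) , inj₁ (inj₁ (sym h≡))) , walk-up d h j (trans (cong (_+ d) h≡) eq′)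
  where
  eq′ : suc (toℕ i) + d ≡ toℕ j
  eq′ = trans (sym (ℕₚ.+-suc (toℕ i) d)) eq
  lt : suc (toℕ i) < k
  lt = ℕₚ.≤-<-trans (subst (suc (toℕ i) ≤_) eq′ (ℕₚ.m≤m+n (suc (toℕ i)) d)) (Finₚ.toℕ<n j)
  h : Fin k
  h = Fin.fromℕ< lt
  h≡ : toℕ h ≡ suc (toℕ i)
  h≡ = Finₚ.toℕ-fromℕ< lt

walk-around : ∀ {k} → 2 ≤ k → ∀ {ℓ} (i j : Fin k) → toℕ i + ℓ ≡ toℕ j + k → toℕ j ≤ toℕ i → Walk (C k) ℓ i j
walk-around {suc zero}    (s≤s ())
walk-around {suc (suc k)} _ {ℓ} i j eq j≤i = subst (λ ℓ → Walk (C (suc (suc k))) ℓ i j) total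
    (walk-++ (C (suc (suc k))) up {suc (toℕ j)} (walk-up up i last (trans (ℕₚ.m+[n∸m]≡n i≤last) (sym last≡)))
      (zero , ((λ ()) , inj₁ (inj₂ (cong suc last≡ , refl))) , walk-up (toℕ j) zero j refl))
  where
  last : Fin (suc (suc k))
  last = suc (Fin.fromℕ k)
  last≡ : toℕ last ≡ suc k
  last≡ = cong suc (Finₚ.toℕ-fromℕ k)
  i≤last : toℕ i ≤ suc k
  i≤last = s≤s⁻¹ (Finₚ.toℕ<n i)
  up = suc k ∸ toℕ i
  total : up + suc (toℕ j) ≡ ℓ
  total = ℕₚ.+-cancelˡ-≡ (toℕ i) _ _ (begin
    toℕ i + (up + suc (toℕ j))     ≡⟨ sym (ℕₚ.+-assoc (toℕ i) up _) ⟩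
    toℕ i + up + suc (toℕ j)       ≡⟨ cong (_+ suc (toℕ j)) (ℕₚ.m+[n∸m]≡n i≤last) ⟩
    suc k + suc (toℕ j)            ≡⟨ arith k (toℕ j) ⟩
    toℕ j + suc (suc k)            ≡⟨ sym eq ⟩
    toℕ i + ℓ                      ∎)
    where
    open ≡-Reasoning
    arith : ∀ k j → suc k + suc j ≡ j + suc (suc k)
    arith = solve-∀

Within⇒adjacent : ∀ {k p} → 2 ≤ k → p < k → ∀ {i j : Fin k} → i ≢ j → Within k p (toℕ i) (toℕ j) → Adj (C k ^ p) i j
Within⇒adjacent {k} {p} 2≤k p<k {i} {j} i≢j near = i≢j , dist near
  where
  short : ∀ {i j : Fin k} → toℕ i ≤ toℕ j → toℕ j ≤ toℕ i + p → Dist≤ (C k) p i j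
  short {i} {j} i≤j j≤ = toℕ j ∸ toℕ i , ℕₚ.m≤n+o⇒m∸n≤o (toℕ j) (toℕ i) j≤ , walk-up _ i j (ℕₚ.m+[n∸m]≡n i≤j)
  round : ∀ {i j : Fin k} → toℕ j + k ≤ toℕ i + p → Dist≤ (C k) p i j
  round {i} {j} le = toℕ j + k ∸ toℕ i , ℕₚ.m≤n+o⇒m∸n≤o (toℕ j + k) (toℕ i) le ,
    walk-around 2≤k i j (ℕₚ.m+[n∸m]≡n (ℕₚ.≤-trans (ℕₚ.<⇒≤ (Finₚ.toℕ<n i)) (ℕₚ.m≤n+m k (toℕ j))))
      (ℕₚ.+-cancelʳ-≤ k (toℕ j) (toℕ i) (ℕₚ.≤-trans le (ℕₚ.+-monoʳ-≤ (toℕ i) (ℕₚ.<⇒≤ p<k))))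
  reverse : ∀ {i j : Fin k} → Dist≤ (C k) p i j → Dist≤ (C k) p j i
  reverse (ℓ , ℓ≤p , w) = ℓ , ℓ≤p , walk-sym (C k) ℓ w
  dist : Within k p (toℕ i) (toℕ j) → Dist≤ (C k) p i j
  dist (inj₁ (i≤ , j≤)) with ℕₚ.≤-total (toℕ i) (toℕ j)
  ... | inj₁ i≤j = short i≤j j≤
  ... | inj₂ j≤i = reverse (short j≤i i≤)
  dist (inj₂ (inj₁ le)) = reverse (round le)
  dist (inj₂ (inj₂ le)) = round le

-- The windows [v , v + p] around the vertices v of an independent set are disjoint.
independent-bound : ∀ {k p} → p < k → (I : List (Fin k)) → Unique I →
  (∀ {u v} → u ∈ I → v ∈ I → Within k p (toℕ u) (toℕ v) → u ≡ v) → length I * suc p ≤ k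
independent-bound {k} {p} p<k I distinct indep = Finₚ.injective⇒≤ {f = f} f-injective
  where
  point : ∀ d → d ≤ p → (u : Fin k) → ∃[ z ] (toℕ z ≡ toℕ u + d ⊎ toℕ z + k ≡ toℕ u + d)
  point d d≤p u with toℕ u + d ℕ.<? k
  ... | yes lt = Fin.fromℕ< lt , inj₁ (Finₚ.toℕ-fromℕ< lt)
  ... | no ≮   = Fin.fromℕ< lt , inj₂ (trans (cong (_+ k) (Finₚ.toℕ-fromℕ< lt)) (ℕₚ.m∸n+n≡m (ℕₚ.≮⇒≥ ≮)))
    where
    lt : toℕ u + d ∸ k < k
    lt = ℕₚ.+-cancelʳ-< k _ k (subst (_< k + k) (sym (ℕₚ.m∸n+n≡m (ℕₚ.≮⇒≥ ≮))) (ℕₚ.+-mono-< (Finₚ.toℕ<n u) (ℕₚ.≤-<-trans d≤p p<k)))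
  d≤p : (d : Fin (suc p)) → toℕ d ≤ p
  d≤p d = s≤s⁻¹ (Finₚ.toℕ<n d)
  g : Fin (length I) × Fin (suc p) → Fin k
  g (i , d) = proj₁ (point (toℕ d) (d≤p d) (lookup I i))
  compare : ∀ {u v : Fin k} {d d′ z} → d ≤ p → d′ ≤ p →
            z ≡ toℕ u + d ⊎ z + k ≡ toℕ u + d → z ≡ toℕ v + d′ ⊎ z + k ≡ toℕ v + d′ →
            Within k p (toℕ u) (toℕ v) × (u ≡ v → d ≡ d′)
  compare {u} {v} {d} {d′} {z} d≤ d′≤ = go
    where
    same : ∀ {y} → y ≡ toℕ u + d → y ≡ toℕ v + d′ → Within k p (toℕ u) (toℕ v) × (u ≡ v → d ≡ d′)
    same refl eq =
      inj₁ (ℕₚ.≤-trans (subst (toℕ u ≤_) eq (ℕₚ.m≤m+n (toℕ u) d)) (ℕₚ.+-monoʳ-≤ (toℕ v) d′≤) ,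
            ℕₚ.≤-trans (subst (toℕ v ≤_) (sym eq) (ℕₚ.m≤m+n (toℕ v) d′)) (ℕₚ.+-monoʳ-≤ (toℕ u) d≤)) ,
      λ { refl → ℕₚ.+-cancelˡ-≡ (toℕ u) d d′ eq }
    wrapped : ∀ {u v : Fin k} {d d′} → d ≤ p → z + k ≡ toℕ u + d → z ≡ toℕ v + d′ → toℕ v + k ≤ toℕ u + p × u ≢ v
    wrapped {u} {v} {d} {d′} d≤ eq refl = le , λ { refl → ℕₚ.<⇒≱ p<k (ℕₚ.+-cancelˡ-≤ (toℕ u) k p le) }
      where
      le : toℕ v + k ≤ toℕ u + p
      le = ℕₚ.≤-trans (ℕₚ.+-monoˡ-≤ k (ℕₚ.m≤m+n (toℕ v) d′)) (ℕₚ.≤-trans (ℕₚ.≤-reflexive eq) (ℕₚ.+-monoʳ-≤ (toℕ u) d≤))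
    go : z ≡ toℕ u + d ⊎ z + k ≡ toℕ u + d → z ≡ toℕ v + d′ ⊎ z + k ≡ toℕ v + d′ →
         Within k p (toℕ u) (toℕ v) × (u ≡ v → d ≡ d′)
    go (inj₁ x) (inj₁ y) = same x y
    go (inj₂ x) (inj₂ y) = same x y
    go (inj₂ x) (inj₁ y) with wrapped {u} {v} d≤ x y
    ... | le , u≢v = inj₂ (inj₂ le) , ⊥-elim ∘ u≢v
    go (inj₁ x) (inj₂ y) with wrapped {v} {u} d′≤ y x
    ... | le , v≢u = inj₂ (inj₁ le) , ⊥-elim ∘ v≢u ∘ sym
  g-injective : ∀ {x y} → g x ≡ g y → x ≡ y
  g-injective {i , d} {j , d′} eq with compare {lookup I i} {lookup I j} (d≤p d) (d≤p d′) (proj₂ (point (toℕ d) (d≤p d) (lookup I i)))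
      (subst (λ z → toℕ z ≡ _ ⊎ toℕ z + k ≡ _) (sym eq) (proj₂ (point (toℕ d′) (d≤p d′) (lookup I j))))
  ... | near , d≡ with indep (∈ₚ.∈-lookup i) (∈ₚ.∈-lookup j) near
  ... | u≡v with lookup-injective distinct u≡v | Finₚ.toℕ-injective (d≡ u≡v)
  ... | refl | refl = refl
  f : Fin (length I * suc p) → Fin k
  f x = g (Fin.remQuot (suc p) x)
  f-injective : Injective _≡_ _≡_ f
  f-injective {x} {y} eq = trans (sym (Finₚ.combine-remQuot {length I} (suc p) x))
    (trans (cong (λ (i , d) → Fin.combine i d) (g-injective eq)) (Finₚ.combine-remQuot {length I} (suc p) y))

-- Vertices of C_k in order, k = s Q + t: first t blocks of length Q + 1, whose first two vertices form
-- a bad edge of colour 0, then s - t blocks of length Q; otherwise colours increase along a block.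
module _ {s q t k : ℕ} (t≤s : t ≤ s) (k≡ : k ≡ s * suc q + t) where

  private
    Q = suc q

  data Place (v : ℕ) : Set where
    left  : (b : Fin t) → v ≡ toℕ b * Q + toℕ b → Place v
    right : (b : Fin t) → v ≡ toℕ b * Q + suc (toℕ b) → Place v
    long  : (b : Fin t) (c : Fin q) → v ≡ toℕ b * Q + suc (toℕ c) + suc (toℕ b) → Place v
    short : ∀ b (c : Fin Q) → t ≤ b → b < s → v ≡ b * Q + toℕ c + t → Place v

  tag : ∀ {v} → Place v → Fin Q ⊎ (Fin t × Bool)
  tag (left b _)        = inj₂ (b , true)
  tag (right b _)       = inj₂ (b , false)
  tag (long b c _)      = inj₁ (suc c)
  tag (short b c _ _ _) = inj₁ c

  block colour-number shift : ∀ {v} → Place v → ℕ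
  block (left b _)        = toℕ b
  block (right b _)       = toℕ b
  block (long b c _)      = toℕ b
  block (short b c _ _ _) = b

  colour-number (left b _)        = 0
  colour-number (right b _)       = 0
  colour-number (long b c _)      = suc (toℕ c)
  colour-number (short b c _ _ _) = toℕ c

  shift (left b _)        = toℕ b
  shift (right b _)       = suc (toℕ b)
  shift (long b c _)      = suc (toℕ b)
  shift (short b c _ _ _) = t

  place-eq : ∀ {v} (P : Place v) → v ≡ block P * Q + colour-number P + shift P
  place-eq (left b eq)        = trans eq (cong (_+ toℕ b) (sym (ℕₚ.+-identityʳ (toℕ b * Q))))
  place-eq (right b eq)       = trans eq (cong (_+ suc (toℕ b)) (sym (ℕₚ.+-identityʳ (toℕ b * Q))))
  place-eq (long b c eq)      = eq
  place-eq (short b c _ _ eq) = eq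

  block<s : ∀ {v} (P : Place v) → block P < s
  block<s (left b _)          = ℕₚ.<-≤-trans (Finₚ.toℕ<n b) t≤s
  block<s (right b _)         = ℕₚ.<-≤-trans (Finₚ.toℕ<n b) t≤s
  block<s (long b c _)        = ℕₚ.<-≤-trans (Finₚ.toℕ<n b) t≤s
  block<s (short b c _ b<s _) = b<s

  shift≤t : ∀ {v} (P : Place v) → shift P ≤ t
  shift≤t (left b _)        = ℕₚ.<⇒≤ (Finₚ.toℕ<n b)
  shift≤t (right b _)       = Finₚ.toℕ<n b
  shift≤t (long b c _)      = Finₚ.toℕ<n b
  shift≤t (short b c _ _ _) = ℕₚ.≤-refl

  shift-mono : ∀ {u v} (P : Place u) (P′ : Place v) → block P < block P′ → shift P ≤ shift P′
  shift-mono P P′ lt = above P′ (ℕₚ.≤-trans (below P) lt) (shift≤t P)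
    where
    below : ∀ {u} (P : Place u) → shift P ≤ suc (block P)
    below (left b _)          = ℕₚ.n≤1+n _
    below (right b _)         = ℕₚ.≤-refl
    below (long b c _)        = ℕₚ.≤-refl
    below (short b c t≤b _ _) = ℕₚ.≤-trans t≤b (ℕₚ.n≤1+n b)
    above : ∀ {v x} (P : Place v) → x ≤ block P → x ≤ t → x ≤ shift P
    above (left b _)        x≤b _   = x≤b
    above (right b _)       x≤b _   = ℕₚ.≤-trans x≤b (ℕₚ.n≤1+n _)
    above (long b c _)      x≤b _   = ℕₚ.≤-trans x≤b (ℕₚ.n≤1+n _)
    above (short b c _ _ _) _   x≤t = x≤t

  place : ∀ v → v < k → Place v
  place v v<k with v ℕ.<? t * suc Q
  ... | yes v<tQ = in-long (v / suc Q) (v % suc Q) (m<n*o⇒m/o<n v<tQ) (m%n<n v (suc Q)) (m≡m%n+[m/n]*n v (suc Q))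
    where
    in-long : ∀ b o → b < t → o < suc Q → v ≡ o + b * suc Q → Place v
    in-long b zero b<t _ eq = left (Fin.fromℕ< b<t) (trans eq (subst (λ x → b * suc Q ≡ x * Q + x) (sym (Finₚ.toℕ-fromℕ< b<t)) (arith b Q)))
      where
      arith : ∀ b Q → b * suc Q ≡ b * Q + b
      arith = solve-∀
    in-long b (suc zero) b<t _ eq = right (Fin.fromℕ< b<t) (trans eq (subst (λ x → 1 + b * suc Q ≡ x * Q + suc x) (sym (Finₚ.toℕ-fromℕ< b<t)) (arith b Q)))
      where
      arith : ∀ b Q → 1 + b * suc Q ≡ b * Q + suc b
      arith = solve-∀
    in-long b (suc (suc c)) b<t (s≤s (s≤s c<q)) eq = long (Fin.fromℕ< b<t) (Fin.fromℕ< c<q)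
      (trans eq (subst₂ (λ x y → suc (suc c) + b * suc Q ≡ x * Q + suc y + suc x) (sym (Finₚ.toℕ-fromℕ< b<t)) (sym (Finₚ.toℕ-fromℕ< c<q)) (arith b Q c)))
      where
      arith : ∀ b Q c → suc (suc c) + b * suc Q ≡ b * Q + suc c + suc b
      arith = solve-∀
  ... | no v≮tQ = in-short (w / Q) (w % Q) (m%n<n w Q) (m≡m%n+[m/n]*n w Q)
    where
    w = v ∸ t * suc Q
    in-short : ∀ b c → c < Q → w ≡ c + b * Q → Place v
    in-short b c c<Q w≡ = short (t + b) (Fin.fromℕ< c<Q) (ℕₚ.m≤m+n t b)
        (ℕₚ.*-cancelʳ-< Q (t + b) s (ℕₚ.+-cancelʳ-< t _ _ (ℕₚ.≤-<-trans (ℕₚ.m≤m+n ((t + b) * Q + t) c)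
          (subst₂ _<_ (trans v≡ (arith′ (t + b) Q c t)) k≡ v<k))))
        (trans v≡ (cong (λ y → (t + b) * Q + y + t) (sym (Finₚ.toℕ-fromℕ< c<Q))))
      where
      arith : ∀ t b Q c → t * suc Q + (c + b * Q) ≡ (t + b) * Q + c + t
      arith = solve-∀
      arith′ : ∀ b Q c t → b * Q + c + t ≡ b * Q + t + c
      arith′ = solve-∀
      v≡ : v ≡ (t + b) * Q + c + t
      v≡ = trans (sym (ℕₚ.m+[n∸m]≡n (ℕₚ.≮⇒≥ v≮tQ))) (trans (cong (t * suc Q +_) w≡) (arith t b Q c))

  module _ {p : ℕ} (p<Q : p < Q) where

    far : ∀ {u v} (P : Place u) (P′ : Place v) → colour-number P ≡ colour-number P′ → block P < block P′ → ¬ Within k p u v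
    far {u} {v} P P′ c≡ lt = apart
      where
      u+Q≤v : u + Q ≤ v
      u+Q≤v = begin
        u + Q                                                    ≡⟨ cong (_+ Q) (place-eq P) ⟩
        block P * Q + colour-number P + shift P + Q              ≡⟨ arith (block P) Q (colour-number P) (shift P) ⟩
        suc (block P) * Q + colour-number P + shift P            ≤⟨ ℕₚ.+-mono-≤ (ℕₚ.+-mono-≤ (ℕₚ.*-monoˡ-≤ Q lt) (ℕₚ.≤-reflexive c≡)) (shift-mono P P′ lt) ⟩
        block P′ * Q + colour-number P′ + shift P′               ≡⟨ sym (place-eq P′) ⟩
        v                                                        ∎
        where
        open ℕₚ.≤-Reasoning
        arith : ∀ b Q c δ → b * Q + c + δ + Q ≡ suc b * Q + c + δ
        arith = solve-∀
      v+Q≤u+k : v + Q ≤ u + k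
      v+Q≤u+k = begin
        v + Q                                                    ≡⟨ cong (_+ Q) (place-eq P′) ⟩
        block P′ * Q + colour-number P′ + shift P′ + Q           ≡⟨ arith (block P′) Q (colour-number P′) (shift P′) ⟩
        colour-number P′ + (suc (block P′) * Q + shift P′)       ≤⟨ ℕₚ.+-mono-≤ (ℕₚ.≤-reflexive (sym c≡)) (ℕₚ.+-mono-≤ (ℕₚ.*-monoˡ-≤ Q (block<s P′)) (shift≤t P′)) ⟩
        colour-number P + (s * Q + t)                            ≤⟨ ℕₚ.+-mono-≤ (ℕₚ.≤-trans (ℕₚ.m≤n+m _ (block P * Q)) (ℕₚ.m≤m+n _ (shift P))) (ℕₚ.≤-reflexive (sym k≡)) ⟩
        block P * Q + colour-number P + shift P + k              ≡⟨ cong (_+ k) (sym (place-eq P)) ⟩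
        u + k                                                    ∎
        where
        open ℕₚ.≤-Reasoning
        arith : ∀ b Q c δ → b * Q + c + δ + Q ≡ c + (suc b * Q + δ)
        arith = solve-∀
      apart : ¬ Within k p u v
      apart (inj₁ (_ , v≤)) = ℕₚ.<⇒≱ p<Q (ℕₚ.+-cancelˡ-≤ u Q p (ℕₚ.≤-trans u+Q≤v v≤))
      apart (inj₂ (inj₁ le)) = ℕₚ.<⇒≱ p<Q (ℕₚ.+-cancelˡ-≤ v Q p (ℕₚ.≤-trans v+Q≤u+k le))
      apart (inj₂ (inj₂ le)) = ℕₚ.<⇒≱ p<Q (ℕₚ.+-cancelˡ-≤ u Q p (ℕₚ.≤-trans u+Q≤v (ℕₚ.≤-trans (ℕₚ.m≤m+n v k) le)))

    same-block : ∀ {u v} (P : Place u) (P′ : Place v) → colour-number P ≡ colour-number P′ → Within k p u v → block P ≡ block P′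
    same-block P P′ c≡ near with ℕₚ.<-cmp (block P) (block P′)
    ... | tri< lt _ _ = ⊥-elim (far P P′ c≡ lt near)
    ... | tri≈ _ eq _ = eq
    ... | tri> _ _ gt = ⊥-elim (far P′ P (sym c≡) gt (Within-sym near))

    normal-determined : ∀ {u v c} (P : Place u) (P′ : Place v) → tag P ≡ inj₁ c → tag P′ ≡ inj₁ c → block P ≡ block P′ → u ≡ v
    normal-determined (long b c eq) (long b′ .c eq′) refl refl b≡ with Finₚ.toℕ-injective b≡
    ... | refl = trans eq (sym eq′)
    normal-determined (long b c eq) (short b′ _ t≤b′ _ _) refl _ b≡ = ⊥-elim (ℕₚ.<⇒≱ (Finₚ.toℕ<n b) (subst (t ≤_) (sym b≡) t≤b′))
    normal-determined (short b _ t≤b _ _) (long b′ c _) _ refl b≡ = ⊥-elim (ℕₚ.<⇒≱ (Finₚ.toℕ<n b′) (subst (t ≤_) b≡ t≤b))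
    normal-determined (short b c _ _ eq) (short .b .c _ _ eq′) refl refl refl = trans eq (sym eq′)

    bad-determined : ∀ {u v z} (P : Place u) (P′ : Place v) → tag P ≡ inj₂ z → tag P′ ≡ inj₂ z → u ≡ v
    bad-determined (left b eq)  (left .b eq′)  refl refl = trans eq (sym eq′)
    bad-determined (right b eq) (right .b eq′) refl refl = trans eq (sym eq′)

    number-of : ∀ {v c} (P : Place v) → tag P ≡ inj₁ c → colour-number P ≡ toℕ c
    number-of (long b c _)      refl = refl
    number-of (short b c _ _ _) refl = refl

    number-of-bad : ∀ {v z} (P : Place v) → tag P ≡ inj₂ z → colour-number P ≡ 0 × block P ≡ toℕ (proj₁ z)
    number-of-bad (left b _)  refl = refl , refl
    number-of-bad (right b _) refl = refl , refl

    zero⇒short : ∀ {v} (P : Place v) → tag P ≡ inj₁ zero → t ≤ block P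
    zero⇒short (short b _ t≤b _ _) refl = t≤b

    almost-colouring : AlmostColouring (C k ^ p) q t
    almost-colouring = record
      { colour     = λ v → tag (at v)
      ; proper     = λ {u} {v} uv cu cv → λ { refl → Graph.irrefl (C k ^ p)
          (Finₚ.toℕ-injective (normal-determined (at u) (at v) cu cv
            (same-block (at u) (at v) (trans (number-of (at u) cu) (sym (number-of (at v) cv))) (adjacent⇒Within p uv)))) uv }
      ; proper₀    = λ {u} {v} {c} {z} uv cu cv → λ { refl → ℕₚ.<⇒≱ (Finₚ.toℕ<n (proj₁ z))
          (subst (t ≤_) (trans (same-block (at u) (at v) (trans (number-of (at u) cu) (sym (proj₁ (number-of-bad (at v) cv)))) (adjacent⇒Within p uv))
                               (proj₂ (number-of-bad (at v) cv)))
            (zero⇒short (at u) cu)) }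
      ; matched    = λ {u} {v} {i} {b} {j} {c} uv cu cv →
          let i≡j = Finₚ.toℕ-injective (trans (sym (proj₂ (number-of-bad (at u) cu)))
                      (trans (same-block (at u) (at v) (trans (proj₁ (number-of-bad (at u) cu)) (sym (proj₁ (number-of-bad (at v) cv)))) (adjacent⇒Within p uv))
                             (proj₂ (number-of-bad (at v) cv))))
          in i≡j , λ b≡c → Graph.irrefl (C k ^ p)
               (Finₚ.toℕ-injective (bad-determined (at u) (at v) cu (trans cv (cong₂ (λ i b → inj₂ (i , b)) (sym i≡j) (sym b≡c))))) uv
      ; injective₂ = λ {u} {v} cu cv → Finₚ.toℕ-injective (bad-determined (at u) (at v) cu cv)
      }
      where
      at : (v : Fin k) → Place (toℕ v)
      at v = place (toℕ v) (Finₚ.toℕ<n v)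

∑-injective : ∀ {m n} (f : Fin m → Fin n) → Injective _≡_ _≡_ f → (h : Fin n → ℕ) → ∑[ v ← allFin m ] h (f v) ≤ ∑ (allFin n) h
∑-injective {m} {n} f inj h = begin
  ∑[ v ← allFin m ] h (f v)            ≡⟨ sym (∑-map f (allFin m) h) ⟩
  ∑ (map f (allFin m)) h               ≤⟨ ℕₚ.m≤m+n _ _ ⟩
  ∑ image h + ∑ (rest image) h         ≡⟨ sym (trans (∑-↭ (allFin-↭ (Uniqueₚ.map⁺ inj (Uniqueₚ.allFin⁺ m))) h) (∑-++ image (rest image) h)) ⟩
  ∑ (allFin n) h                       ∎
  where
  open ℕₚ.≤-Reasoning
  image = map f (allFin m)

-- Deleting the a vertices mapped to apexes would leave s Q + 1 vertices to be covered by Q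
-- independent sets, but each of these has at most s vertices.
target-free : ∀ {k p s Q a N} .{{_ : NonZero Q}} → 2 ≤ k → p < k → k < suc s * suc p → k ≡ s * Q + suc a →
              Free (C k ^ p) (K a ∨ T N Q)
target-free {k} {p} {s} {Q} {a} {N} 2≤k p<k k<  k≡ (f , inj , hom) = ℕₚ.<⇒≱ (subst (a + Q * s <_) (sym k≡) too-many) (begin
  k
    ≡⟨ sym (∑-class-size d) ⟩
  ∑ (allFin (a + Q)) (class-size d)
    ≡⟨ ∑-allFin-+ a Q (class-size d) ⟩
  ∑[ z ← allFin a ] class-size d (z ↑ˡ Q) + ∑[ c ← allFin Q ] class-size d (a ↑ʳ c)
    ≤⟨ ℕₚ.+-mono-≤ (∑-mono (allFin a) (λ {z} _ → apex z)) (∑-mono (allFin Q) (λ {c} _ → outer c)) ⟩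
  ∑[ z ← allFin a ] 1 + ∑[ c ← allFin Q ] s
    ≡⟨ cong₂ _+_ (trans (∑-allFin-const a 1) (ℕₚ.*-identityʳ a)) (∑-allFin-const Q s) ⟩
  a + Q * s ∎)
  where
  open ℕₚ.≤-Reasoning
  d : Fin k → Fin (a + Q)
  d = target-colour a N Q ∘ f
  too-many : a + Q * s < s * Q + suc a
  too-many = ℕₚ.≤-reflexive (arith a Q s)
    where
    arith : ∀ a Q s → suc (a + Q * s) ≡ s * Q + suc a
    arith = solve-∀
  apex : ∀ z → class-size d (z ↑ˡ Q) ≤ 1
  apex z = ℕₚ.≤-trans (∑-injective f inj (λ x → 𝟙 (target-colour a N Q x Finₚ.≟ z ↑ˡ Q)))
    (ℕₚ.≤-reflexive (class-size-apex a N Q z))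
  outer : ∀ c → class-size d (a ↑ʳ c) ≤ s
  outer c = subst (_≤ s) (length-filter in-class? (allFin k))
    (s≤s⁻¹ (ℕₚ.*-cancelʳ-< (suc p) (length I) (suc s) (ℕₚ.≤-<-trans (independent-bound p<k I
      (Uniqueₚ.filter⁺ in-class? (Uniqueₚ.allFin⁺ k)) indep) k<)))
    where
    in-class? : ∀ v → Dec (d v ≡ a ↑ʳ c)
    in-class? v = d v Finₚ.≟ a ↑ʳ c
    I = filter in-class? (allFin k)
    ∈I : ∀ {v} → v ∈ I → d v ≡ a ↑ʳ c
    ∈I v∈ = proj₂ (∈ₚ.∈-filter⁻ in-class? {xs = allFin k} v∈)
    indep : ∀ {u v} → u ∈ I → v ∈ I → Within k p (toℕ u) (toℕ v) → u ≡ v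
    indep {u} {v} u∈ v∈ near with u Finₚ.≟ v
    ... | yes u≡v = u≡v
    ... | no u≢v  = ⊥-elim (Equivalence.to (target-adjacent a N Q (f u) (f v))
            (hom u v (Within⇒adjacent 2≤k p<k u≢v near)) (trans (∈I u∈) (sym (∈I v∈))))

Free-≅ : ∀ {k m n} {F : Graph k} {G : Graph m} {H : Graph n} → G ≅ H → Free F H → Free F G
Free-≅ (φ , iso) free (f , inj , hom) = free (Inverse.to φ ∘ f , inj ∘ Injection.injective (↔⇒↣ φ) ,
  λ u v uv → Equivalence.to (iso (f u) (f v)) (hom u v uv))

≅⇒e≡ : ∀ {m n} {G : Graph m} {H : Graph n} → G ≅ H → e G ≡ e H
≅⇒e≡ {G = G} {H} iso = ℕₚ.*-cancelˡ-≡ (e G) (e H) 2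
  (trans (2e≡size G) (trans (size-≅ {G = G} {H = H} iso) (sym (2e≡size H))))

unique-extremal : ∀ {k n M} {F : Graph k} (H : Graph M) → n ≡ M → Free F H →
  ((G : Graph n) → Free F G → e H ≤ e G → G ≅ H) → (G : Graph n) → EX n F G ⇔ G ≅ H
unique-extremal {n = n} {F = F} H refl freeH unique G = mk⇔
  (λ (free , _ , maximal) → unique G free (maximal H freeH))
  (λ iso → Free-≅ {F = F} {G = G} {H = H} iso freeH , (G , Free-≅ {F = F} {G = G} {H = H} iso freeH , refl) , λ G′ free′ →
    case ℕₚ.≤-total (e G′) (e H) of λ
      { (inj₁ le) → subst (e G′ ≤_) (sym (≅⇒e≡ {G = G} {H = H} iso)) le
      ; (inj₂ ge) → ℕₚ.≤-reflexive (trans (≅⇒e≡ {G = G′} {H = H} (unique G′ free′ ge)) (sym (≅⇒e≡ {G = G} {H = H} iso))) })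

theorem1p1 : ∀ (k p s r m t : ℕ) → 1 ≤ k → 1 ≤ p → k ≥ 2 * p + 1 →
    k ≡ s * (p + 1) + r → 1 ≤ s → r < p + 1 → r ≢ 0 →
    1 ≤ t → t ≤ s → r ≡ m * s + t →
    ∃[ N ] ∀ n → n ≥ N → ∀ (G : Graph n) →
    EX n (C k ^ p) G ⇔ G ≅ (K (t ∸ 1) ∨ T (n ∸ t + 1) (1 + p + m))
theorem1p1 k p s r m (suc a) _ 1≤p k≥ k≡ _ r<1+p _ _ t≤s r≡ = N₂ + suc a , characterise
  where
  q t : ℕ
  q = p + m
  t = suc a
  k≡′ : k ≡ s * suc q + t
  k≡′ = trans k≡ (trans (cong (s * (p + 1) +_) r≡) (arith s p m t))
    where
    arith : ∀ s p m t → s * (p + 1) + (m * s + t) ≡ s * suc (p + m) + t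
    arith = solve-∀
  p<k : p < k
  p<k = ℕₚ.≤-trans (s≤s (ℕₚ.m≤m+n p (p + 0))) (ℕₚ.≤-trans (ℕₚ.≤-reflexive (ℕₚ.+-comm 1 (2 * p))) k≥)
  k< : k < suc s * suc p
  k< = subst₂ _<_ (sym k≡) (arith s p) (ℕₚ.+-monoʳ-< (s * (p + 1)) r<1+p)
    where
    arith : ∀ s p → s * (p + 1) + (p + 1) ≡ suc s * suc p
    arith = solve-∀
  A : AlmostColouring (C k ^ p) q t
  A = almost-colouring t≤s k≡′ (s≤s (ℕₚ.m≤m+n p m))
  sc = scales k (suc q) t
  es = erdős-stone q (Scales.ladder sc t) (Scales.positive sc t)
  sim = simonovits k q a t refl sc A (proj₁ es) (proj₂ es)
  N₂ = proj₁ sim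
  characterise : ∀ n → n ≥ N₂ + t → (G : Graph n) → EX n (C k ^ p) G ⇔ G ≅ (K a ∨ T (n ∸ t + 1) (suc q))
  characterise n n≥ = unique-extremal {F = C k ^ p} (K a ∨ T M (suc q)) n≡
      (target-free {s = s} {N = M} (ℕₚ.≤-trans (s≤s 1≤p) p<k) p<k k< k≡′)
      (λ G free larger → proj₂ sim (ℕₚ.≤-trans (ℕₚ.m≤m+n N₂ t) n≥) G free M n≡ (begin
        n * n                                                    ≡⟨ cong (λ n → n * n) n≡ ⟩
        (a + M) * (a + M)                                        ≡⟨ sym (size-target a M (suc q)) ⟩
        size (K a ∨ T M (suc q)) + (a + turán-squares (suc q) M) ≤⟨ ℕₚ.+-monoˡ-≤ _ (subst₂ _≤_ (2e≡size (K a ∨ T M (suc q))) (2e≡size G) (ℕₚ.*-monoʳ-≤ 2 larger)) ⟩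
        size G + (a + turán-squares (suc q) M)                   ∎))
    where
    open ℕₚ.≤-Reasoning
    M = n ∸ t + 1
    n≡ : n ≡ a + M
    n≡ = trans (sym (ℕₚ.m+[n∸m]≡n (ℕₚ.≤-trans (ℕₚ.m≤n+m t N₂) n≥))) (arith a (n ∸ t))
      where
      arith : ∀ a x → suc a + x ≡ a + (x + 1)
      arith = solve-∀
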